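{- Let $\varepsilon<\frac13$ be a positive real number, let $n\ge 0$ be an integer, and let $\theta_0,\dots,\theta_n\in\mathbb{R}$ be pairwise distinct angles (modulo $2\pi$). If the set $\bigcup_{j=0}^{n}R_{\theta_j}E_{\varepsilon}$ is periodic, then it does not cover the whole plane, i.e. $\bigcup_{j=0}^{n}R_{\theta_j}E_{\varepsilon}\neq\mathbb{R}^2$.
   Context: For real $x$, $\|x\|$ denotes the distance from $x$ to the nearest integer. For $\varepsilon>0$, $E_{\varepsilon}=\{(x,y)\in\mathbb{R}^2:\|x\|\le\varepsilon\}$. $R_{\theta}$ denotes the counterclockwise rotation of the plane $\mathbb{R}^2$ by angle $\theta$ around the origin. Put $\mathbf{u}_j=(\cos\theta_j,\sin\theta_j)\in\mathbb{R}^2$. Given $\theta_0,\dots,\theta_n$, a vector $\mathbf{v}\in\mathbb{R}^2$ is called a period-vector of $\bigcup_{j=0}^{n}R_{\theta_j}E_{\varepsilon}$ if $\langle\mathbf{u}_j,\mathbf{v}\rangle\in\mathbb{Z}$ for every $j=0,\dots,n$ (standard inner product). The set $\bigcup_{j=0}^{n}R_{\theta_j}E_{\varepsilon}$ is called periodic if it has two $\mathbb{R}$-linearly independent period-vectors in this sense. -}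

module Defs where

open import Data.Bool.Base using (true; false; if_then_else_)
open import Data.Fin.Base using (Fin)
open import Data.Integer.Base as ℤ using (ℤ; +_)
import Data.Integer.DivMod as ℤ
import Data.Integer.Properties as ℤ
open import Data.Nat.Base as ℕ using (ℕ; zero; suc)
import Data.Nat.Properties as ℕ
open import Data.Product.Base using (∃-syntax; _×_; _,_)
open import Data.Rational.Base hiding (_≃_)
open import Data.Rational.Properties
open import Data.Rational.Solver
import Data.Rational.Unnormalised.Base as ℚᵘ
import Data.Rational.Unnormalised.Properties as ℚᵘ
open import Data.Sum.Base using (_⊎_; inj₁; inj₂)
open import Level using (0ℓ)
open import Relation.Binary.PropositionalEquality
  using (_≡_; _≢_; refl; sym; trans; cong; cong₂; subst; subst₂)
open import Relation.Binary.Definitions using (tri<; tri≈; tri>)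
open import Relation.Nullary using (yes; no; contradiction)
open import Relation.Unary using (Pred; _∈_; ⋃)

open +-*-Solver using (solve; _:+_; _:*_; _:-_; :-_; _:=_; con)

fromℤ : ℤ → ℚ
fromℤ i = i / 1

toℚᵘ-fromℤ : ∀ i → toℚᵘ (fromℤ i) ℚᵘ.≃ ℚᵘ.mkℚᵘ i 0
toℚᵘ-fromℤ i = toℚᵘ-fromℚᵘ (ℚᵘ.mkℚᵘ i 0)

fromℤ-+ : ∀ i j → fromℤ (i ℤ.+ j) ≡ fromℤ i + fromℤ j
fromℤ-+ i j = toℚᵘ-injective (begin-equality
  toℚᵘ (fromℤ (i ℤ.+ j))              ≃⟨ toℚᵘ-fromℤ (i ℤ.+ j) ⟩
  ℚᵘ.mkℚᵘ (i ℤ.+ j) 0                 ≃⟨ ℚᵘ.*≡* (cong (ℤ._* (+ 1)) (cong₂ ℤ._+_ (sym (ℤ.*-identityʳ i)) (sym (ℤ.*-identityʳ j)))) ⟩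
  ℚᵘ.mkℚᵘ i 0 ℚᵘ.+ ℚᵘ.mkℚᵘ j 0        ≃⟨ ℚᵘ.+-cong (ℚᵘ.≃-sym (toℚᵘ-fromℤ i)) (ℚᵘ.≃-sym (toℚᵘ-fromℤ j)) ⟩
  toℚᵘ (fromℤ i) ℚᵘ.+ toℚᵘ (fromℤ j)  ≃⟨ ℚᵘ.≃-sym (toℚᵘ-homo-+ (fromℤ i) (fromℤ j)) ⟩
  toℚᵘ (fromℤ i + fromℤ j)            ∎)
  where open ℚᵘ.≤-Reasoning

fromℤ-neg : ∀ i → fromℤ (ℤ.- i) ≡ - fromℤ i
fromℤ-neg i = toℚᵘ-injective (begin-equality
  toℚᵘ (fromℤ (ℤ.- i))    ≃⟨ toℚᵘ-fromℤ (ℤ.- i) ⟩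
  ℚᵘ.- ℚᵘ.mkℚᵘ i 0        ≃⟨ ℚᵘ.-‿cong (ℚᵘ.≃-sym (toℚᵘ-fromℤ i)) ⟩
  ℚᵘ.- toℚᵘ (fromℤ i)     ≃⟨ ℚᵘ.≃-sym (toℚᵘ-homo‿- (fromℤ i)) ⟩
  toℚᵘ (- fromℤ i)        ∎)
  where open ℚᵘ.≤-Reasoning

fromℤ-mono-≤ : ∀ {i j} → i ℤ.≤ j → fromℤ i ≤ fromℤ j
fromℤ-mono-≤ {i} {j} i≤j = toℚᵘ-cancel-≤ (begin
  toℚᵘ (fromℤ i)  ≃⟨ toℚᵘ-fromℤ i ⟩
  ℚᵘ.mkℚᵘ i 0     ≤⟨ ℚᵘ.*≤* (ℤ.*-monoʳ-≤-nonNeg (+ 1) i≤j) ⟩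
  ℚᵘ.mkℚᵘ j 0     ≃⟨ ℚᵘ.≃-sym (toℚᵘ-fromℤ j) ⟩
  toℚᵘ (fromℤ j)  ∎)
  where open ℚᵘ.≤-Reasoning

opaque
  0<1 : 0ℚ < 1ℚ
  0<1 = positive⁻¹ 1ℚ

-- Opaque so that normalisation does not unfold the gcd in fromℤ.
opaque
  fromℕ : ℕ → ℚ
  fromℕ n = fromℤ (+ n)

  toℚᵘ-fromℕ : ∀ n → toℚᵘ (fromℕ n) ℚᵘ.≃ ℚᵘ.mkℚᵘ (+ n) 0
  toℚᵘ-fromℕ n = toℚᵘ-fromℤ (+ n)

  fromℕ-0 : fromℕ 0 ≡ 0ℚ
  fromℕ-0 = refl

  fromℕ-1 : fromℕ 1 ≡ 1ℚ
  fromℕ-1 = refl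

  fromℕ-+ : ∀ m n → fromℕ (m ℕ.+ n) ≡ fromℕ m + fromℕ n
  fromℕ-+ m n = fromℤ-+ (+ m) (+ n)

  fromℕ-mono-≤ : ∀ {m n} → m ℕ.≤ n → fromℕ m ≤ fromℕ n
  fromℕ-mono-≤ {m} {n} m≤n = fromℤ-mono-≤ {+ m} {+ n} (ℤ.+≤+ m≤n)

fromℕ-suc : ∀ n → fromℕ (suc n) ≡ 1ℚ + fromℕ n
fromℕ-suc n = trans (fromℕ-+ 1 n) (cong (_+ fromℕ n) fromℕ-1)

0≤fromℕ : ∀ n → 0ℚ ≤ fromℕ n
0≤fromℕ n = subst (_≤ fromℕ n) fromℕ-0 (fromℕ-mono-≤ ℕ.z≤n)

1≤fromℕ-suc : ∀ n → 1ℚ ≤ fromℕ (suc n)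
1≤fromℕ-suc n = subst (_≤ fromℕ (suc n)) fromℕ-1 (fromℕ-mono-≤ (ℕ.s≤s ℕ.z≤n))

0<fromℕ-suc : ∀ n → 0ℚ < fromℕ (suc n)
0<fromℕ-suc n = <-≤-trans 0<1 (1≤fromℕ-suc n)

opaque
  archimedean : ∀ q → ∃[ n ] q ≤ fromℕ n
  archimedean q@(mkℚ i d-1 _) = ℤ.∣ i ∣ , toℚᵘ-cancel-≤ (begin
    ℚᵘ.mkℚᵘ i d-1             ≤⟨ ℚᵘ.*≤* lemma ⟩
    ℚᵘ.mkℚᵘ (+ ℤ.∣ i ∣) 0     ≃⟨ ℚᵘ.≃-sym (toℚᵘ-fromℕ ℤ.∣ i ∣) ⟩
    toℚᵘ (fromℕ ℤ.∣ i ∣)      ∎)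
    where
    open ℚᵘ.≤-Reasoning
    i≤∣i∣ : ∀ i → i ℤ.≤ + ℤ.∣ i ∣
    i≤∣i∣ (+ n)      = ℤ.≤-refl
    i≤∣i∣ ℤ.-[1+ n ] = ℤ.-≤+
    lemma : i ℤ.* + 1 ℤ.≤ + ℤ.∣ i ∣ ℤ.* + suc d-1
    lemma = subst₂ ℤ._≤_ (sym (ℤ.*-identityʳ i)) (ℤ.pos-* ℤ.∣ i ∣ (suc d-1))
      (ℤ.≤-trans (i≤∣i∣ i) (ℤ.+≤+ (ℕ.m≤m*n ℤ.∣ i ∣ (suc d-1))))

*-mono-≤ˡ : ∀ {p q r} → 0ℚ ≤ r → p ≤ q → p * r ≤ q * r
*-mono-≤ˡ {r = r} 0≤r = *-monoʳ-≤-nonNeg r {{nonNegative 0≤r}}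

*-mono-≤ʳ : ∀ {p q r} → 0ℚ ≤ r → p ≤ q → r * p ≤ r * q
*-mono-≤ʳ {r = r} 0≤r = *-monoˡ-≤-nonNeg r {{nonNegative 0≤r}}

*-mono-<ˡ : ∀ {p q r} → 0ℚ < r → p < q → p * r < q * r
*-mono-<ˡ {r = r} 0<r = *-monoˡ-<-pos r {{positive 0<r}}

*-mono-≤-≤ : ∀ {p q r s} → 0ℚ ≤ r → 0ℚ ≤ q → p ≤ q → r ≤ s → p * r ≤ q * s
*-mono-≤-≤ 0≤r 0≤q p≤q r≤s = ≤-trans (*-mono-≤ˡ 0≤r p≤q) (*-mono-≤ʳ 0≤q r≤s)

0≤* : ∀ {p q} → 0ℚ ≤ p → 0ℚ ≤ q → 0ℚ ≤ p * q
0≤* {p} {q} 0≤p 0≤q =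
  nonNegative⁻¹ (p * q) {{nonNeg*nonNeg⇒nonNeg p {{nonNegative 0≤p}} q {{nonNegative 0≤q}}}}

opaque
  0<* : ∀ {p q} → 0ℚ < p → 0ℚ < q → 0ℚ < p * q
  0<* {p} {q} 0<p 0<q = positive⁻¹ (p * q) {{pos*pos⇒pos p {{positive 0<p}} q {{positive 0<q}}}}

p≤p+q : ∀ {p q} → 0ℚ ≤ q → p ≤ p + q
p≤p+q {p} {q} 0≤q = subst (_≤ p + q) (+-identityʳ p) (+-monoʳ-≤ p 0≤q)

p-q≥0 : ∀ {p q} → q ≤ p → 0ℚ ≤ p - q
p-q≥0 {p} {q} q≤p = subst (_≤ p - q) (+-inverseʳ q) (+-monoˡ-≤ (- q) q≤p)

p≤q+r⇒p-q≤r : ∀ {p q r} → p ≤ q + r → p - q ≤ r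
p≤q+r⇒p-q≤r {p} {q} {r} h = subst (p - q ≤_)
  (solve 2 (λ q r → (q :+ r) :- q := r) refl q r) (+-monoˡ-≤ (- q) h)

opaque
  divide : ∀ {ε b} → 0ℚ < ε → 0ℚ < b → ∃[ δ ] (0ℚ < δ × δ * b ≡ ε)
  divide {ε} {b} 0<ε 0<b = ε * r , 0<* 0<ε 0<r ,
    trans (*-assoc ε r b) (trans (cong (ε *_) (*-inverseˡ b)) (*-identityʳ ε))
    where
    instance
      b-pos : Positive b
      b-pos = positive 0<b
      b≢0 : NonZero b
      b≢0 = pos⇒nonZero b
    r : ℚ
    r = 1/ b
    0<r : 0ℚ < r
    0<r = positive⁻¹ r {{1/pos⇒pos b}}

opaque
  0<½ : 0ℚ < ½
  0<½ = positive⁻¹ ½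

0<½* : ∀ {ε} → 0ℚ < ε → 0ℚ < ε * ½
0<½* 0<ε = 0<* 0<ε 0<½

halves : ∀ ε → ε * ½ + ε * ½ ≡ ε
halves ε = trans (sym (*-distribˡ-+ ε ½ ½)) (*-identityʳ ε)

∣p-q∣≡∣q-p∣ : ∀ p q → ∣ p - q ∣ ≡ ∣ q - p ∣
∣p-q∣≡∣q-p∣ p q = trans (sym (∣-p∣≡∣p∣ (p - q)))
  (cong ∣_∣ (solve 2 (λ p q → :- (p :- q) := q :- p) refl p q))

triangle : ∀ p q r → ∣ p - r ∣ ≤ ∣ p - q ∣ + ∣ q - r ∣
triangle p q r = subst (λ z → ∣ z ∣ ≤ ∣ p - q ∣ + ∣ q - r ∣)
  (solve 3 (λ p q r → (p :- q) :+ (q :- r) := p :- r) refl p q r)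
  (∣p+q∣≤∣p∣+∣q∣ (p - q) (q - r))

∣∣-lub : ∀ {p q} → p ≤ q → - p ≤ q → ∣ p ∣ ≤ q
∣∣-lub {p} {q} p≤q -p≤q with ∣p∣≡p∨∣p∣≡-p p
... | inj₁ eq = subst (_≤ q) (sym eq) p≤q
... | inj₂ eq = subst (_≤ q) (sym eq) -p≤q

p≤∣p∣ : ∀ p → p ≤ ∣ p ∣
p≤∣p∣ p with ≤-total 0ℚ p
... | inj₁ 0≤p = ≤-reflexive (sym (0≤p⇒∣p∣≡p 0≤p))
... | inj₂ p≤0 = ≤-trans p≤0 (0≤∣p∣ p)

∣p∣≤∣p-q∣+∣q∣ : ∀ p q → ∣ p ∣ ≤ ∣ p - q ∣ + ∣ q ∣
∣p∣≤∣p-q∣+∣q∣ p q = subst (λ z → ∣ z ∣ ≤ ∣ p - q ∣ + ∣ q ∣)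
  (solve 2 (λ p q → (p :- q) :+ q := p) refl p q) (∣p+q∣≤∣p∣+∣q∣ (p - q) q)

-- A real number is a Cauchy sequence of rationals; _≃_ is equality of reals.
-- The cauchy fields below are opaque, the sequences themselves compute.

IsCauchy : (ℕ → ℚ) → Set
IsCauchy s = ∀ ε → 0ℚ < ε → ∃[ N ] ∀ m n → N ℕ.≤ m → N ℕ.≤ n → ∣ s m - s n ∣ < ε

record ℝ : Set where
  constructor mkℝ
  field
    seq    : ℕ → ℚ
    cauchy : IsCauchy seq

open ℝ public

infix 4 _≃_ _<ʳ_ _≤ʳ_

_≃_ : ℝ → ℝ → Set
x ≃ y = ∀ ε → 0ℚ < ε → ∃[ N ] ∀ n → N ℕ.≤ n → ∣ seq x n - seq y n ∣ < ε

_<ʳ_ : ℝ → ℝ → Set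
x <ʳ y = ∃[ δ ] 0ℚ < δ × ∃[ N ] ∀ n → N ℕ.≤ n → seq x n + δ ≤ seq y n

_≤ʳ_ : ℝ → ℝ → Set
x ≤ʳ y = ∀ ε → 0ℚ < ε → ∃[ N ] ∀ n → N ℕ.≤ n → seq x n ≤ seq y n + ε

≤⊔ˡ : ∀ {m n k} → m ℕ.⊔ n ℕ.≤ k → m ℕ.≤ k
≤⊔ˡ {m} {n} = ℕ.≤-trans (ℕ.m≤m⊔n m n)

≤⊔ʳ : ∀ {m n k} → m ℕ.⊔ n ℕ.≤ k → n ℕ.≤ k
≤⊔ʳ {m} {n} = ℕ.≤-trans (ℕ.m≤n⊔m m n)

opaque
  const-cauchy : ∀ q → IsCauchy (λ _ → q)
  const-cauchy q ε 0<ε = 0 , λ _ _ _ _ → subst (λ z → ∣ z ∣ < ε) (sym (+-inverseʳ q)) 0<ε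

opaque
  lipschitz-cauchy : (f : ℚ → ℚ) → (∀ p q → ∣ f p - f q ∣ ≤ ∣ p - q ∣) →
                     ∀ s → IsCauchy s → IsCauchy (λ n → f (s n))
  lipschitz-cauchy f lip s cs ε 0<ε with cs ε 0<ε
  ... | N , h = N , λ m n N≤m N≤n → ≤-<-trans (lip (s m) (s n)) (h m n N≤m N≤n)

neg-lipschitz : ∀ p q → ∣ - p - - q ∣ ≤ ∣ p - q ∣
neg-lipschitz p q = ≤-reflexive (trans
  (cong ∣_∣ (solve 2 (λ p q → :- p :- (:- q) := q :- p) refl p q)) (∣p-q∣≡∣q-p∣ q p))

opaque
  +-cauchy : ∀ s t → IsCauchy s → IsCauchy t → IsCauchy (λ n → s n + t n)
  +-cauchy s t cs ct ε 0<ε with cs (ε * ½) (0<½* 0<ε) | ct (ε * ½) (0<½* 0<ε)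
  ... | M , h | N , k = M ℕ.⊔ N , λ m n m≥ n≥ → begin-strict
    ∣ (s m + t m) - (s n + t n) ∣    ≡⟨ cong ∣_∣ (solve 4 (λ a b c d → (a :+ b) :- (c :+ d) := (a :- c) :+ (b :- d)) refl (s m) (t m) (s n) (t n)) ⟩
    ∣ (s m - s n) + (t m - t n) ∣    ≤⟨ ∣p+q∣≤∣p∣+∣q∣ (s m - s n) (t m - t n) ⟩
    ∣ s m - s n ∣ + ∣ t m - t n ∣    <⟨ +-mono-< (h m n (≤⊔ˡ {M} {N} m≥) (≤⊔ˡ {M} {N} n≥)) (k m n (≤⊔ʳ {M} {N} m≥) (≤⊔ʳ {M} {N} n≥)) ⟩
    ε * ½ + ε * ½                    ≡⟨ halves ε ⟩
    ε                                ∎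
    where open ≤-Reasoning

opaque
  bounded : ∀ s → IsCauchy s → ∃[ b ] ∃[ N ] ∀ n → N ℕ.≤ n → ∣ s n ∣ ≤ fromℕ b
  bounded s cs with cs 1ℚ 0<1
  ... | N , h with archimedean (1ℚ + ∣ s N ∣)
  ... | b , le = b , N , λ n N≤n → begin
    ∣ s n ∣                    ≤⟨ ∣p∣≤∣p-q∣+∣q∣ (s n) (s N) ⟩
    ∣ s n - s N ∣ + ∣ s N ∣    ≤⟨ +-monoˡ-≤ ∣ s N ∣ (<⇒≤ (h n N N≤n ℕ.≤-refl)) ⟩
    1ℚ + ∣ s N ∣               ≤⟨ le ⟩
    fromℕ b                    ∎
    where open ≤-Reasoning

opaque
  bounded⁺ : ∀ s → IsCauchy s → ∃[ b ] 0ℚ < b × ∃[ N ] ∀ n → N ℕ.≤ n → ∣ s n ∣ ≤ b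
  bounded⁺ s cs with bounded s cs
  ... | b , N , h = fromℕ (suc b) , 0<fromℕ-suc b , N , λ n N≤n →
    ≤-trans (h n N≤n) (fromℕ-mono-≤ (ℕ.n≤1+n b))

opaque
  *-cauchy : ∀ s t → IsCauchy s → IsCauchy t → IsCauchy (λ n → s n * t n)
  *-cauchy s t cs ct ε 0<ε with bounded⁺ s cs | bounded⁺ t ct
  ... | b , 0<b , K , hb | c , 0<c , L , hc
    with divide (0<½* 0<ε) 0<c | divide (0<½* 0<ε) 0<b
  ... | δ , 0<δ , δc | η , 0<η , ηb with cs δ 0<δ | ct η 0<η
  ... | M , h | N , k = (K ℕ.⊔ L) ℕ.⊔ (M ℕ.⊔ N) , λ m n m≥ n≥ →
    let K≤n = ≤⊔ˡ {K} {L} (≤⊔ˡ {K ℕ.⊔ L} {M ℕ.⊔ N} n≥)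
        L≤m = ≤⊔ʳ {K} {L} (≤⊔ˡ {K ℕ.⊔ L} {M ℕ.⊔ N} m≥)
        M≤m = ≤⊔ˡ {M} {N} (≤⊔ʳ {K ℕ.⊔ L} {M ℕ.⊔ N} m≥)
        M≤n = ≤⊔ˡ {M} {N} (≤⊔ʳ {K ℕ.⊔ L} {M ℕ.⊔ N} n≥)
        N≤m = ≤⊔ʳ {M} {N} (≤⊔ʳ {K ℕ.⊔ L} {M ℕ.⊔ N} m≥)
        N≤n = ≤⊔ʳ {M} {N} (≤⊔ʳ {K ℕ.⊔ L} {M ℕ.⊔ N} n≥)
    in begin-strict
    ∣ s m * t m - s n * t n ∣
      ≡⟨ cong ∣_∣ (solve 4 (λ a b c d → a :* b :- c :* d := (a :- c) :* b :+ (b :- d) :* c) refl (s m) (t m) (s n) (t n)) ⟩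
    ∣ (s m - s n) * t m + (t m - t n) * s n ∣
      ≤⟨ ∣p+q∣≤∣p∣+∣q∣ ((s m - s n) * t m) ((t m - t n) * s n) ⟩
    ∣ (s m - s n) * t m ∣ + ∣ (t m - t n) * s n ∣
      ≡⟨ cong₂ _+_ (∣p*q∣≡∣p∣*∣q∣ (s m - s n) (t m)) (∣p*q∣≡∣p∣*∣q∣ (t m - t n) (s n)) ⟩
    ∣ s m - s n ∣ * ∣ t m ∣ + ∣ t m - t n ∣ * ∣ s n ∣
      ≤⟨ +-mono-≤ (*-mono-≤ʳ (0≤∣p∣ (s m - s n)) (hc m L≤m)) (*-mono-≤ʳ (0≤∣p∣ (t m - t n)) (hb n K≤n)) ⟩
    ∣ s m - s n ∣ * c + ∣ t m - t n ∣ * b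
      <⟨ +-mono-< (*-mono-<ˡ 0<c (h m n M≤m M≤n)) (*-mono-<ˡ 0<b (k m n N≤m N≤n)) ⟩
    δ * c + η * b  ≡⟨ cong₂ _+_ δc ηb ⟩
    ε * ½ + ε * ½  ≡⟨ halves ε ⟩
    ε              ∎
    where open ≤-Reasoning

fromℚ : ℚ → ℝ
fromℚ q = mkℝ (λ _ → q) (const-cauchy q)

0ʳ : ℝ
0ʳ = fromℚ 0ℚ

infix  8 -ʳ_
infixl 7 _*ʳ_
infixl 6 _+ʳ_ _-ʳ_

_+ʳ_ : ℝ → ℝ → ℝ
x +ʳ y = mkℝ (λ n → seq x n + seq y n) (+-cauchy (seq x) (seq y) (cauchy x) (cauchy y))

-ʳ_ : ℝ → ℝ
-ʳ x = mkℝ (λ n → - seq x n) (lipschitz-cauchy -_ neg-lipschitz (seq x) (cauchy x))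

_-ʳ_ : ℝ → ℝ → ℝ
x -ʳ y = x +ʳ (-ʳ y)

_*ʳ_ : ℝ → ℝ → ℝ
x *ʳ y = mkℝ (λ n → seq x n * seq y n) (*-cauchy (seq x) (seq y) (cauchy x) (cauchy y))

-- distℤ is the distance to the nearest integer (distℤ-minimal below). Being
-- 1-Lipschitz, it extends to reals termwise.

distℤ : ℚ → ℚ
distℤ q = ∣ q - fromℤ (round q) ∣

opaque
  floor-≤ : ∀ q → fromℤ (floor q) ≤ q
  floor-≤ q@(mkℚ i d-1 _) = toℚᵘ-cancel-≤ (begin
    toℚᵘ (fromℤ (floor q))  ≃⟨ toℚᵘ-fromℤ (floor q) ⟩
    ℚᵘ.mkℚᵘ (floor q) 0     ≤⟨ ℚᵘ.*≤* (subst (floor q ℤ.* + suc d-1 ℤ.≤_) (sym (ℤ.*-identityʳ i)) (ℤ.[n/d]*d≤n i (+ suc d-1))) ⟩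
    toℚᵘ q                  ∎)
    where open ℚᵘ.≤-Reasoning

opaque
  <-floor : ∀ q → q < 1ℚ + fromℤ (floor q)
  <-floor q@(mkℚ i d-1 _) = subst (q <_) (fromℤ-+ (+ 1) (floor q)) (toℚᵘ-cancel-< (begin-strict
    toℚᵘ q                            <⟨ ℚᵘ.*<* lemma ⟩
    ℚᵘ.mkℚᵘ (+ 1 ℤ.+ floor q) 0       ≃⟨ ℚᵘ.≃-sym (toℚᵘ-fromℤ (+ 1 ℤ.+ floor q)) ⟩
    toℚᵘ (fromℤ (+ 1 ℤ.+ floor q))    ∎))
    where
    open ℚᵘ.≤-Reasoning
    lemma : i ℤ.* + 1 ℤ.< (+ 1 ℤ.+ floor q) ℤ.* + suc d-1
    lemma = subst₂ ℤ._<_ (sym (ℤ.*-identityʳ i))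
      (cong (λ z → (+ 1 ℤ.+ z) ℤ.* + suc d-1) (sym (ℤ.div-pos-is-/ℕ i (suc d-1))))
      (ℤ.n<s[n/ℕd]*d i (suc d-1))

ceiling-def : ∀ q → ceiling q ≡ ℤ.- floor (- q)
ceiling-def record{} = refl

opaque
  round-near : ∀ q b → let r = fromℤ (if b then ceiling (q - ½) else floor (q + ½)) in
               q ≤ r + ½ × r ≤ q + ½
  round-near q false =
    subst₂ _≤_
      (solve 1 (λ q → (q :+ con ½) :- con ½ := q) refl q)
      (solve 1 (λ f → (con 1ℚ :+ f) :- con ½ := f :+ con ½) refl f)
      (+-monoˡ-≤ (- ½) (<⇒≤ (<-floor (q + ½)))) ,
    floor-≤ (q + ½)
    where
    f : ℚ
    f = fromℤ (floor (q + ½))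
  round-near q true rewrite ceiling-def (q - ½) | fromℤ-neg (floor (- (q - ½))) =
    subst₂ _≤_
      (solve 2 (λ q f → f :+ (q :- f) := q) refl q f)
      (solve 2 (λ q f → (:- (q :- con ½)) :+ (q :- f) := (:- f) :+ con ½) refl q f)
      (+-monoˡ-≤ (q - f) (floor-≤ (- (q - ½)))) ,
    subst₂ _≤_
      (solve 2 (λ q f → (:- (q :- con ½)) :+ ((q :- con ½) :- f) := :- f) refl q f)
      (solve 2 (λ q f → (con 1ℚ :+ f) :+ ((q :- con ½) :- f) := q :+ con ½) refl q f)
      (+-monoˡ-≤ ((q - ½) - f) (<⇒≤ (<-floor (- (q - ½)))))
    where
    f : ℚ
    f = fromℤ (floor (- (q - ½)))

opaque
  distℤ≤½ : ∀ q → distℤ q ≤ ½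
  distℤ≤½ q with round-near q (q ≤ᵇ 0ℚ)
  ... | q≤ , r≤ = ∣∣-lub (p≤q+r⇒p-q≤r q≤)
    (subst (_≤ ½) (solve 2 (λ q r → r :- q := :- (q :- r)) refl q (fromℤ (round q))) (p≤q+r⇒p-q≤r r≤))

1≤∣fromℤ∣ : ∀ {i j} → i ℤ.< j → 1ℚ ≤ ∣ fromℤ i - fromℤ j ∣
1≤∣fromℤ∣ {i} {j} i<j = begin
  1ℚ                          ≡⟨ solve 1 (λ i → con 1ℚ := (con 1ℚ :+ i) :- i) refl (fromℤ i) ⟩
  (1ℚ + fromℤ i) - fromℤ i    ≡⟨ cong (_- fromℤ i) (sym (fromℤ-+ (+ 1) i)) ⟩
  fromℤ (ℤ.suc i) - fromℤ i   ≤⟨ +-monoˡ-≤ (- fromℤ i) (fromℤ-mono-≤ {ℤ.suc i} {j} (ℤ.i<j⇒suc[i]≤j i<j)) ⟩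
  fromℤ j - fromℤ i           ≤⟨ p≤∣p∣ (fromℤ j - fromℤ i) ⟩
  ∣ fromℤ j - fromℤ i ∣       ≡⟨ ∣p-q∣≡∣q-p∣ (fromℤ j) (fromℤ i) ⟩
  ∣ fromℤ i - fromℤ j ∣       ∎
  where open ≤-Reasoning

1≤∣fromℤ∣-≢ : ∀ {i j} → i ≢ j → 1ℚ ≤ ∣ fromℤ i - fromℤ j ∣
1≤∣fromℤ∣-≢ {i} {j} i≢j with ℤ.<-cmp i j
... | tri< i<j _ _ = 1≤∣fromℤ∣ i<j
... | tri≈ _ i≡j _ = contradiction i≡j i≢j
... | tri> _ _ j<i = subst (1ℚ ≤_) (∣p-q∣≡∣q-p∣ (fromℤ j) (fromℤ i)) (1≤∣fromℤ∣ j<i)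

distℤ-minimal : ∀ q i → distℤ q ≤ ∣ q - fromℤ i ∣
distℤ-minimal q i with round q ℤ.≟ i
... | yes eq = ≤-reflexive (cong (λ j → ∣ q - fromℤ j ∣) eq)
... | no ne  = ≤-trans (distℤ≤½ q) (begin
    ½              ≡⟨⟩
    1ℚ - ½         ≤⟨ p≤q+r⇒p-q≤r {1ℚ} {½} (begin
      1ℚ                                ≤⟨ 1≤∣fromℤ∣-≢ ne ⟩
      ∣ fromℤ (round q) - fromℤ i ∣     ≤⟨ triangle (fromℤ (round q)) q (fromℤ i) ⟩
      ∣ fromℤ (round q) - q ∣ + d       ≡⟨ cong (_+ d) (∣p-q∣≡∣q-p∣ (fromℤ (round q)) q) ⟩
      distℤ q + d                       ≤⟨ +-monoˡ-≤ d (distℤ≤½ q) ⟩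
      ½ + d                             ∎) ⟩
    d              ∎)
  where
  open ≤-Reasoning
  d = ∣ q - fromℤ i ∣

opaque
  distℤ-lipschitz : ∀ p q → ∣ distℤ p - distℤ q ∣ ≤ ∣ p - q ∣
  distℤ-lipschitz p q = ∣∣-lub
    (p≤q+r⇒p-q≤r (one p q))
    (subst₂ _≤_ (solve 2 (λ a b → b :- a := :- (a :- b)) refl (distℤ p) (distℤ q)) (∣p-q∣≡∣q-p∣ q p)
      (p≤q+r⇒p-q≤r (one q p)))
    where
    open ≤-Reasoning
    one : ∀ p q → distℤ p ≤ distℤ q + ∣ p - q ∣
    one p q = begin
      distℤ p                          ≤⟨ distℤ-minimal p (round q) ⟩
      ∣ p - fromℤ (round q) ∣          ≤⟨ triangle p q (fromℤ (round q)) ⟩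
      ∣ p - q ∣ + distℤ q              ≡⟨ +-comm ∣ p - q ∣ (distℤ q) ⟩
      distℤ q + ∣ p - q ∣              ∎

∥_∥ : ℝ → ℝ
∥ x ∥ = mkℝ (λ n → distℤ (seq x n)) (lipschitz-cauchy distℤ distℤ-lipschitz (seq x) (cauchy x))

Σ< : ℕ → (ℕ → ℚ) → ℚ
Σ< zero    f = 0ℚ
Σ< (suc n) f = Σ< n f + f n

Σ-tail : ∀ f g → (∀ k → ∣ f k ∣ ≤ g k) → ∀ {m n} → m ℕ.≤′ n →
         ∣ Σ< n f - Σ< m f ∣ ≤ Σ< n g - Σ< m g
Σ-tail f g f≤g {m} (ℕ.≤′-reflexive refl) = ≤-reflexive
  (trans (cong ∣_∣ (+-inverseʳ (Σ< m f))) (sym (+-inverseʳ (Σ< m g))))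
Σ-tail f g f≤g {m} (ℕ.≤′-step {n} m≤n) = begin
  ∣ (Σ< n f + f n) - Σ< m f ∣       ≡⟨ cong ∣_∣ (solve 3 (λ a b c → (a :+ b) :- c := (a :- c) :+ b) refl (Σ< n f) (f n) (Σ< m f)) ⟩
  ∣ (Σ< n f - Σ< m f) + f n ∣       ≤⟨ ∣p+q∣≤∣p∣+∣q∣ (Σ< n f - Σ< m f) (f n) ⟩
  ∣ Σ< n f - Σ< m f ∣ + ∣ f n ∣     ≤⟨ +-mono-≤ (Σ-tail f g f≤g m≤n) (f≤g n) ⟩
  (Σ< n g - Σ< m g) + g n           ≡⟨ solve 3 (λ a b c → (a :- c) :+ b := (a :+ b) :- c) refl (Σ< n g) (g n) (Σ< m g) ⟩
  (Σ< n g + g n) - Σ< m g           ∎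
  where open ≤-Reasoning

opaque
  Σ-compare : ∀ g → IsCauchy (λ n → Σ< n g) → ∀ ε → 0ℚ < ε →
              ∃[ N ] ∀ f → (∀ k → ∣ f k ∣ ≤ g k) →
              ∀ m n → N ℕ.≤ m → N ℕ.≤ n → ∣ Σ< m f - Σ< n f ∣ < ε
  Σ-compare g cg ε 0<ε with cg ε 0<ε
  ... | N , h = N , λ f f≤g m n N≤m N≤n → go f f≤g m n N≤m N≤n (ℕ.≤-total n m)
    where
    open ≤-Reasoning
    ordered : ∀ f → (∀ k → ∣ f k ∣ ≤ g k) → ∀ m n → N ℕ.≤ m → N ℕ.≤ n → n ℕ.≤ m →
              ∣ Σ< m f - Σ< n f ∣ < ε
    ordered f f≤g m n N≤m N≤n n≤m = begin-strict
      ∣ Σ< m f - Σ< n f ∣   ≤⟨ Σ-tail f g f≤g (ℕ.≤⇒≤′ n≤m) ⟩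
      Σ< m g - Σ< n g       ≤⟨ p≤∣p∣ (Σ< m g - Σ< n g) ⟩
      ∣ Σ< m g - Σ< n g ∣   <⟨ h m n N≤m N≤n ⟩
      ε                     ∎
    go : ∀ f → (∀ k → ∣ f k ∣ ≤ g k) → ∀ m n → N ℕ.≤ m → N ℕ.≤ n → n ℕ.≤ m ⊎ m ℕ.≤ n →
         ∣ Σ< m f - Σ< n f ∣ < ε
    go f f≤g m n N≤m N≤n (inj₁ n≤m) = ordered f f≤g m n N≤m N≤n n≤m
    go f f≤g m n N≤m N≤n (inj₂ m≤n) = subst (_< ε) (∣p-q∣≡∣q-p∣ (Σ< n f) (Σ< m f))
      (ordered f f≤g n m N≤n N≤m m≤n)

module Ratio (t : ℕ → ℚ) (K : ℕ) (0≤t : ∀ k → 0ℚ ≤ t k)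
             (ratio : ∀ k → K ℕ.≤ k → t (suc k) ≤ t k * ½) where

  open ≤-Reasoning

  2t : ℕ → ℚ
  2t n = t n + t n

  0≤2t : ∀ n → 0ℚ ≤ 2t n
  0≤2t n = +-mono-≤ (0≤t n) (0≤t n)

  2t-step : ∀ k → K ℕ.≤ k → 2t (suc k) ≤ t k
  2t-step k K≤k = subst (2t (suc k) ≤_) (halves (t k)) (+-mono-≤ (ratio k K≤k) (ratio k K≤k))

  bound : ∀ {m n} → K ℕ.≤ m → m ℕ.≤′ n → Σ< n t + 2t n ≤ Σ< m t + 2t m
  bound K≤m (ℕ.≤′-reflexive refl) = ≤-refl
  bound {m} K≤m (ℕ.≤′-step {n} m≤n) = begin
    (Σ< n t + t n) + 2t (suc n)   ≤⟨ +-monoʳ-≤ (Σ< n t + t n) (2t-step n (ℕ.≤-trans K≤m (ℕ.≤′⇒≤ m≤n))) ⟩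
    (Σ< n t + t n) + t n          ≡⟨ +-assoc (Σ< n t) (t n) (t n) ⟩
    Σ< n t + 2t n                 ≤⟨ bound K≤m m≤n ⟩
    Σ< m t + 2t m                 ∎

  tail : ∀ {m n} → K ℕ.≤ m → m ℕ.≤ n → ∣ Σ< n t - Σ< m t ∣ ≤ 2t m
  tail {m} {n} K≤m m≤n = begin
    ∣ Σ< n t - Σ< m t ∣   ≤⟨ Σ-tail t t (λ k → ≤-reflexive (0≤p⇒∣p∣≡p (0≤t k))) (ℕ.≤⇒≤′ m≤n) ⟩
    Σ< n t - Σ< m t       ≤⟨ p≤q+r⇒p-q≤r {Σ< n t} {Σ< m t} (≤-trans (p≤p+q {Σ< n t} (0≤2t n)) (bound K≤m (ℕ.≤⇒≤′ m≤n))) ⟩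
    2t m                  ∎

  decay : ∀ j → fromℕ (suc j) * 2t (j ℕ.+ K) ≤ 2t K
  decay zero    = ≤-reflexive (trans (cong (_* 2t K) fromℕ-1) (*-identityˡ (2t K)))
  decay (suc j) = begin
    fromℕ (suc (suc j)) * 2t (suc k)             ≡⟨ cong (_* 2t (suc k)) (fromℕ-suc (suc j)) ⟩
    (1ℚ + fromℕ (suc j)) * 2t (suc k)            ≤⟨ *-mono-≤ʳ (≤-trans (0≤fromℕ (suc (suc j))) (≤-reflexive (fromℕ-suc (suc j)))) (2t-step k (ℕ.m≤n+m K j)) ⟩
    (1ℚ + fromℕ (suc j)) * t k                   ≤⟨ *-mono-≤ˡ (0≤t k) (+-monoˡ-≤ (fromℕ (suc j)) (1≤fromℕ-suc j)) ⟩
    (fromℕ (suc j) + fromℕ (suc j)) * t k        ≡⟨ solve 2 (λ a b → (a :+ a) :* b := a :* (b :+ b)) refl (fromℕ (suc j)) (t k) ⟩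
    fromℕ (suc j) * 2t k                         ≤⟨ decay j ⟩
    2t K                                         ∎
    where k = j ℕ.+ K

  opaque
    small : ∀ ε → 0ℚ < ε → ∃[ N ] K ℕ.≤ N × 2t N < ε
    small ε 0<ε with divide {1ℚ} 0<1 0<ε
    ... | r , 0<r , rε≡1 with archimedean (2t K * r)
    ... | j , le = j ℕ.+ K , ℕ.m≤n+m K j ,
      *-cancelˡ-<-nonNeg (fromℕ (suc j)) {{nonNegative (0≤fromℕ (suc j))}} (begin-strict
        fromℕ (suc j) * 2t (j ℕ.+ K)   ≤⟨ decay j ⟩
        2t K                           ≡⟨ sym (*-identityʳ (2t K)) ⟩
        2t K * 1ℚ                      ≡⟨ cong (2t K *_) (sym rε≡1) ⟩
        2t K * (r * ε)                 ≡⟨ sym (*-assoc (2t K) r ε) ⟩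
        (2t K * r) * ε                 ≤⟨ *-mono-≤ˡ (<⇒≤ 0<ε) le ⟩
        fromℕ j * ε                    <⟨ *-mono-<ˡ 0<ε (subst₂ _<_ (+-identityˡ (fromℕ j)) (sym (fromℕ-suc j)) (+-monoˡ-< (fromℕ j) 0<1)) ⟩
        fromℕ (suc j) * ε              ∎)

  opaque
    Σ-cauchy : IsCauchy (λ n → Σ< n t)
    Σ-cauchy ε 0<ε with small (ε * ½) (0<½* 0<ε)
    ... | N , K≤N , 2tN<ε/2 = N , λ m n N≤m N≤n → begin-strict
      ∣ Σ< m t - Σ< n t ∣                          ≤⟨ triangle (Σ< m t) (Σ< N t) (Σ< n t) ⟩
      ∣ Σ< m t - Σ< N t ∣ + ∣ Σ< N t - Σ< n t ∣    ≡⟨ cong (λ z → ∣ Σ< m t - Σ< N t ∣ + z) (∣p-q∣≡∣q-p∣ (Σ< N t) (Σ< n t)) ⟩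
      ∣ Σ< m t - Σ< N t ∣ + ∣ Σ< n t - Σ< N t ∣    ≤⟨ +-mono-≤ (tail K≤N N≤m) (tail K≤N N≤n) ⟩
      2t N + 2t N                                  <⟨ +-mono-< 2tN<ε/2 2tN<ε/2 ⟩
      ε * ½ + ε * ½                                ≡⟨ halves ε ⟩
      ε                                            ∎

-- Euler's series  π = Σ 2ᵏ⁺¹ (k!)² / (2k+1)!

πTerm : ℕ → ℚ
πTerm zero    = fromℤ (+ 2)
πTerm (suc k) = πTerm k * (+ suc k / suc (suc (suc (2 ℕ.* k))))

0≤/ : ∀ m n .{{_ : ℕ.NonZero n}} → 0ℚ ≤ + m / n
0≤/ m n = nonNegative⁻¹ (+ m / n) {{normalize-nonNeg m n}}

0≤πTerm : ∀ k → 0ℚ ≤ πTerm k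
0≤πTerm zero    = nonNegative⁻¹ (fromℤ (+ 2))
0≤πTerm (suc k) = 0≤* (0≤πTerm k) (0≤/ (suc k) (3 ℕ.+ 2 ℕ.* k))

/≤½ : ∀ m n → 2 ℕ.* m ℕ.≤ suc n → + m / suc n ≤ ½
/≤½ m n 2m≤n = toℚᵘ-cancel-≤ (begin
  toℚᵘ (+ m / suc n)  ≃⟨ toℚᵘ-fromℚᵘ (ℚᵘ.mkℚᵘ (+ m) n) ⟩
  ℚᵘ.mkℚᵘ (+ m) n     ≤⟨ ℚᵘ.*≤* (subst₂ ℤ._≤_ (ℤ.pos-* m 2) (sym (ℤ.*-identityˡ (+ suc n)))
                           (ℤ.+≤+ (subst (ℕ._≤ suc n) (ℕ.*-comm 2 m) 2m≤n))) ⟩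
  toℚᵘ ½              ∎)
  where open ℚᵘ.≤-Reasoning

π-ratio : ∀ k → 0 ℕ.≤ k → πTerm (suc k) ≤ πTerm k * ½
π-ratio k _ = *-mono-≤ʳ (0≤πTerm k)
  (/≤½ (suc k) (2 ℕ.+ 2 ℕ.* k) (subst (ℕ._≤ 3 ℕ.+ 2 ℕ.* k) (sym (ℕ.*-suc 2 k)) (ℕ.n≤1+n (2 ℕ.+ 2 ℕ.* k))))

π : ℝ
π = mkℝ (λ n → Σ< n πTerm) (Ratio.Σ-cauchy πTerm 0 0≤πTerm π-ratio)

-- qᵏ / k!
expTerm : ℚ → ℕ → ℚ
expTerm q zero    = 1ℚ
expTerm q (suc k) = (expTerm q k * q) * (+ 1 / suc k)

-- k-th derivatives of cos and sin at 0
cosCoeff : ℕ → ℚ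
cosCoeff 0             = 1ℚ
cosCoeff 1             = 0ℚ
cosCoeff (suc (suc k)) = - cosCoeff k

sinCoeff : ℕ → ℚ
sinCoeff 0             = 0ℚ
sinCoeff 1             = 1ℚ
sinCoeff (suc (suc k)) = - sinCoeff k

taylor : (ℕ → ℚ) → ℕ → ℚ → ℚ
taylor c n q = Σ< n (λ k → c k * expTerm q k)

∣cosCoeff∣≤1 : ∀ k → ∣ cosCoeff k ∣ ≤ 1ℚ
∣cosCoeff∣≤1 0             = ≤-refl
∣cosCoeff∣≤1 1             = <⇒≤ 0<1
∣cosCoeff∣≤1 (suc (suc k)) = subst (_≤ 1ℚ) (sym (∣-p∣≡∣p∣ (cosCoeff k))) (∣cosCoeff∣≤1 k)

∣sinCoeff∣≤1 : ∀ k → ∣ sinCoeff k ∣ ≤ 1ℚ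
∣sinCoeff∣≤1 0             = <⇒≤ 0<1
∣sinCoeff∣≤1 1             = ≤-refl
∣sinCoeff∣≤1 (suc (suc k)) = subst (_≤ 1ℚ) (sym (∣-p∣≡∣p∣ (sinCoeff k))) (∣sinCoeff∣≤1 k)

module ExpBound (b : ℕ) where

  open ≤-Reasoning

  M : ℕ → ℚ
  M = expTerm (fromℕ b)

  r : ℕ → ℚ
  r k = + 1 / suc k

  0≤r : ∀ k → 0ℚ ≤ r k
  0≤r k = 0≤/ 1 (suc k)

  r-inverse : ∀ k → fromℕ (suc k) * r k ≡ 1ℚ
  r-inverse k = toℚᵘ-injective (ℚᵘ.≃-trans (toℚᵘ-homo-* (fromℕ (suc k)) (r k))
    (ℚᵘ.≃-trans (ℚᵘ.*-cong (toℚᵘ-fromℕ (suc k)) (toℚᵘ-fromℚᵘ (ℚᵘ.mkℚᵘ (+ 1) k)))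
      (ℚᵘ.*-inverseʳ (ℚᵘ.mkℚᵘ (+ suc k) 0))))

  0≤M : ∀ k → 0ℚ ≤ M k
  0≤M zero    = <⇒≤ 0<1
  0≤M (suc k) = 0≤* (0≤* (0≤M k) (0≤fromℕ b)) (0≤r k)

  br≤½ : ∀ k → b ℕ.+ b ℕ.≤ k → fromℕ b * r k ≤ ½
  br≤½ k 2b≤k = subst (_≤ ½)
    (solve 3 (λ b r h → ((b :+ b) :* r) :* con ½ := b :* r) refl (fromℕ b) (r k) ½)
    (*-mono-≤ˡ {q = 1ℚ} (<⇒≤ 0<½) (begin
      (fromℕ b + fromℕ b) * r k   ≡⟨ cong (_* r k) (sym (fromℕ-+ b b)) ⟩
      fromℕ (b ℕ.+ b) * r k       ≤⟨ *-mono-≤ˡ (0≤r k) (fromℕ-mono-≤ (ℕ.m≤n⇒m≤1+n 2b≤k)) ⟩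
      fromℕ (suc k) * r k         ≡⟨ r-inverse k ⟩
      1ℚ                          ∎))

  ratio : ∀ k → b ℕ.+ b ℕ.≤ k → M (suc k) ≤ M k * ½
  ratio k 2b≤k = begin
    (M k * fromℕ b) * r k   ≡⟨ *-assoc (M k) (fromℕ b) (r k) ⟩
    M k * (fromℕ b * r k)   ≤⟨ *-mono-≤ʳ (0≤M k) (br≤½ k 2b≤k) ⟩
    M k * ½                 ∎

  opaque
    S-cauchy : IsCauchy (λ n → Σ< n M)
    S-cauchy = Ratio.Σ-cauchy M (b ℕ.+ b) 0≤M ratio

  ∣*r∣ : ∀ p k → ∣ p * r k ∣ ≡ ∣ p ∣ * r k
  ∣*r∣ p k = trans (∣p*q∣≡∣p∣*∣q∣ p (r k)) (cong (∣ p ∣ *_) (0≤p⇒∣p∣≡p (0≤r k)))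

  ∣expTerm∣≤M : ∀ {q} → ∣ q ∣ ≤ fromℕ b → ∀ k → ∣ expTerm q k ∣ ≤ M k
  ∣expTerm∣≤M q≤b zero    = ≤-refl
  ∣expTerm∣≤M {q} q≤b (suc k) = begin
    ∣ (expTerm q k * q) * r k ∣       ≡⟨ ∣*r∣ (expTerm q k * q) k ⟩
    ∣ expTerm q k * q ∣ * r k         ≡⟨ cong (_* r k) (∣p*q∣≡∣p∣*∣q∣ (expTerm q k) q) ⟩
    (∣ expTerm q k ∣ * ∣ q ∣) * r k   ≤⟨ *-mono-≤ˡ (0≤r k) (*-mono-≤-≤ (0≤∣p∣ q) (0≤M k) (∣expTerm∣≤M q≤b k) q≤b) ⟩
    (M k * fromℕ b) * r k             ∎

  expTerm-lipschitz : ∀ {p q} → ∣ p ∣ ≤ fromℕ b → ∣ q ∣ ≤ fromℕ b → ∀ k →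
    ∣ expTerm p (suc k) - expTerm q (suc k) ∣ ≤ ∣ p - q ∣ * M k
  expTerm-lipschitz {p} {q} p≤b q≤b zero = ≤-reflexive (begin-equality
    ∣ (1ℚ * p) * 1ℚ - (1ℚ * q) * 1ℚ ∣
      ≡⟨ cong ∣_∣ (solve 2 (λ p q → (con 1ℚ :* p) :* con 1ℚ :- (con 1ℚ :* q) :* con 1ℚ := p :- q) refl p q) ⟩
    ∣ p - q ∣
      ≡⟨ sym (*-identityʳ ∣ p - q ∣) ⟩
    ∣ p - q ∣ * 1ℚ ∎)
  expTerm-lipschitz {p} {q} p≤b q≤b (suc k) = begin
    ∣ (A * p) * R - (B * q) * R ∣
      ≡⟨ cong ∣_∣ (solve 5 (λ A B p q R → (A :* p) :* R :- (B :* q) :* R := (A :* (p :- q) :+ (A :- B) :* q) :* R) refl A B p q R) ⟩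
    ∣ (A * (p - q) + (A - B) * q) * R ∣
      ≡⟨ ∣*r∣ (A * (p - q) + (A - B) * q) (suc k) ⟩
    ∣ A * (p - q) + (A - B) * q ∣ * R
      ≤⟨ *-mono-≤ˡ (0≤r (suc k)) (begin
        ∣ A * (p - q) + (A - B) * q ∣            ≤⟨ ∣p+q∣≤∣p∣+∣q∣ (A * (p - q)) ((A - B) * q) ⟩
        ∣ A * (p - q) ∣ + ∣ (A - B) * q ∣        ≡⟨ cong₂ _+_ (∣p*q∣≡∣p∣*∣q∣ A (p - q)) (∣p*q∣≡∣p∣*∣q∣ (A - B) q) ⟩
        ∣ A ∣ * D + ∣ A - B ∣ * ∣ q ∣            ≤⟨ +-mono-≤ (*-mono-≤ˡ (0≤∣p∣ (p - q)) (∣expTerm∣≤M p≤b (suc k)))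
                                                      (*-mono-≤-≤ (0≤∣p∣ q) (0≤* (0≤∣p∣ (p - q)) (0≤M k)) (expTerm-lipschitz p≤b q≤b k) q≤b) ⟩
        M (suc k) * D + (D * M k) * fromℕ b      ∎) ⟩
    (M (suc k) * D + (D * M k) * fromℕ b) * R
      ≡⟨ cong (λ z → (M (suc k) * D + z) * R) (sym (begin-equality
        (D * M (suc k)) * fromℕ (suc k)
          ≡⟨ solve 5 (λ D m b r s → (D :* ((m :* b) :* r)) :* s := ((D :* m) :* b) :* (s :* r)) refl D (M k) (fromℕ b) (r k) (fromℕ (suc k)) ⟩
        ((D * M k) * fromℕ b) * (fromℕ (suc k) * r k)
          ≡⟨ cong (((D * M k) * fromℕ b) *_) (r-inverse k) ⟩
        ((D * M k) * fromℕ b) * 1ℚ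
          ≡⟨ *-identityʳ ((D * M k) * fromℕ b) ⟩
        (D * M k) * fromℕ b ∎)) ⟩
    (M (suc k) * D + (D * M (suc k)) * fromℕ (suc k)) * R
      ≡⟨ solve 4 (λ m D s R → (m :* D :+ (D :* m) :* s) :* R := (D :* m) :* ((con 1ℚ :+ s) :* R)) refl (M (suc k)) D (fromℕ (suc k)) R ⟩
    (D * M (suc k)) * ((1ℚ + fromℕ (suc k)) * R)
      ≡⟨ cong (λ z → (D * M (suc k)) * (z * R)) (sym (fromℕ-suc (suc k))) ⟩
    (D * M (suc k)) * (fromℕ (suc (suc k)) * R)
      ≡⟨ cong ((D * M (suc k)) *_) (r-inverse (suc k)) ⟩
    (D * M (suc k)) * 1ℚ
      ≡⟨ *-identityʳ (D * M (suc k)) ⟩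
    D * M (suc k) ∎
    where
    A = expTerm p (suc k)
    B = expTerm q (suc k)
    D = ∣ p - q ∣
    R = r (suc k)

  module _ (c : ℕ → ℚ) (c≤1 : ∀ k → ∣ c k ∣ ≤ 1ℚ) where

    ∣c*∣≤ : ∀ p k → ∣ c k * p ∣ ≤ ∣ p ∣
    ∣c*∣≤ p k = begin
      ∣ c k * p ∣       ≡⟨ ∣p*q∣≡∣p∣*∣q∣ (c k) p ⟩
      ∣ c k ∣ * ∣ p ∣   ≤⟨ *-mono-≤ˡ (0≤∣p∣ p) (c≤1 k) ⟩
      1ℚ * ∣ p ∣        ≡⟨ *-identityˡ ∣ p ∣ ⟩
      ∣ p ∣             ∎

    taylorTerm≤M : ∀ {q} → ∣ q ∣ ≤ fromℕ b → ∀ k → ∣ c k * expTerm q k ∣ ≤ M k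
    taylorTerm≤M {q} q≤b k = ≤-trans (∣c*∣≤ (expTerm q k) k) (∣expTerm∣≤M q≤b k)

    taylor-lipschitz-suc : ∀ {p q} → ∣ p ∣ ≤ fromℕ b → ∣ q ∣ ≤ fromℕ b → ∀ n →
      ∣ taylor c (suc n) p - taylor c (suc n) q ∣ ≤ ∣ p - q ∣ * Σ< n M
    taylor-lipschitz-suc {p} {q} p≤b q≤b zero = ≤-reflexive
      (trans (cong ∣_∣ (+-inverseʳ (0ℚ + c 0 * 1ℚ))) (sym (*-zeroʳ ∣ p - q ∣)))
    taylor-lipschitz-suc {p} {q} p≤b q≤b (suc n) = begin
      ∣ (T p + c k * E p) - (T q + c k * E q) ∣
        ≡⟨ cong ∣_∣ (solve 5 (λ a b c d e → (a :+ c :* d) :- (b :+ c :* e) := (a :- b) :+ c :* (d :- e)) refl (T p) (T q) (c k) (E p) (E q)) ⟩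
      ∣ (T p - T q) + c k * (E p - E q) ∣
        ≤⟨ ∣p+q∣≤∣p∣+∣q∣ (T p - T q) (c k * (E p - E q)) ⟩
      ∣ T p - T q ∣ + ∣ c k * (E p - E q) ∣
        ≤⟨ +-mono-≤ (taylor-lipschitz-suc p≤b q≤b n)
             (≤-trans (∣c*∣≤ (E p - E q) k) (expTerm-lipschitz p≤b q≤b n)) ⟩
      ∣ p - q ∣ * Σ< n M + ∣ p - q ∣ * M n
        ≡⟨ sym (*-distribˡ-+ ∣ p - q ∣ (Σ< n M) (M n)) ⟩
      ∣ p - q ∣ * (Σ< n M + M n) ∎
      where
      k = suc n
      T = taylor c (suc n)
      E : ℚ → ℚ
      E x = expTerm x k

    taylor-lipschitz : ∀ {p q} → ∣ p ∣ ≤ fromℕ b → ∣ q ∣ ≤ fromℕ b → ∀ n →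
      ∣ taylor c n p - taylor c n q ∣ ≤ ∣ p - q ∣ * Σ< n M
    taylor-lipschitz {p} {q} p≤b q≤b zero = ≤-reflexive (sym (*-zeroʳ ∣ p - q ∣))
    taylor-lipschitz {p} {q} p≤b q≤b (suc n) = ≤-trans (taylor-lipschitz-suc p≤b q≤b n)
      (*-mono-≤ʳ (0≤∣p∣ (p - q)) (p≤p+q (0≤M n)))

opaque
  taylor-cauchy : ∀ c → (∀ k → ∣ c k ∣ ≤ 1ℚ) → ∀ s → IsCauchy s → IsCauchy (λ n → taylor c n (s n))
  taylor-cauchy c c≤1 s cs ε 0<ε with bounded s cs
  ... | b , K , s≤b with bounded⁺ (λ n → Σ< n (expTerm (fromℕ b))) (ExpBound.S-cauchy b)
  ... | B , 0<B , L , S≤B with divide (0<½* 0<ε) 0<B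
  ... | δ , 0<δ , δB with cs δ 0<δ | Σ-compare (expTerm (fromℕ b)) (ExpBound.S-cauchy b) (ε * ½) (0<½* 0<ε)
  ... | P , h | N , k = (K ℕ.⊔ L) ℕ.⊔ (P ℕ.⊔ N) , λ m n m≥ n≥ →
    let K≤n = ≤⊔ˡ {K} {L} (≤⊔ˡ {K ℕ.⊔ L} {P ℕ.⊔ N} n≥)
        K≤m = ≤⊔ˡ {K} {L} (≤⊔ˡ {K ℕ.⊔ L} {P ℕ.⊔ N} m≥)
        L≤n = ≤⊔ʳ {K} {L} (≤⊔ˡ {K ℕ.⊔ L} {P ℕ.⊔ N} n≥)
        P≤m = ≤⊔ˡ {P} {N} (≤⊔ʳ {K ℕ.⊔ L} {P ℕ.⊔ N} m≥)
        P≤n = ≤⊔ˡ {P} {N} (≤⊔ʳ {K ℕ.⊔ L} {P ℕ.⊔ N} n≥)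
        N≤m = ≤⊔ʳ {P} {N} (≤⊔ʳ {K ℕ.⊔ L} {P ℕ.⊔ N} m≥)
        N≤n = ≤⊔ʳ {P} {N} (≤⊔ʳ {K ℕ.⊔ L} {P ℕ.⊔ N} n≥)
    in begin-strict
    ∣ taylor c m (s m) - taylor c n (s n) ∣
      ≤⟨ triangle (taylor c m (s m)) (taylor c n (s m)) (taylor c n (s n)) ⟩
    ∣ taylor c m (s m) - taylor c n (s m) ∣ + ∣ taylor c n (s m) - taylor c n (s n) ∣
      <⟨ +-mono-<-≤
           (k (λ j → c j * expTerm (s m) j) (ExpBound.taylorTerm≤M b c c≤1 (s≤b m K≤m)) m n N≤m N≤n)
           (ExpBound.taylor-lipschitz b c c≤1 (s≤b m K≤m) (s≤b n K≤n) n) ⟩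
    ε * ½ + ∣ s m - s n ∣ * Σ< n (expTerm (fromℕ b))
      ≤⟨ +-monoʳ-≤ (ε * ½) (*-mono-≤ʳ (0≤∣p∣ (s m - s n)) (≤-trans (p≤∣p∣ (Σ< n (expTerm (fromℕ b)))) (S≤B n L≤n))) ⟩
    ε * ½ + ∣ s m - s n ∣ * B
      ≤⟨ +-monoʳ-≤ (ε * ½) (*-mono-≤ˡ (<⇒≤ 0<B) (<⇒≤ (h m n P≤m P≤n))) ⟩
    ε * ½ + δ * B   ≡⟨ cong (λ z → ε * ½ + z) δB ⟩
    ε * ½ + ε * ½   ≡⟨ halves ε ⟩
    ε               ∎
    where open ≤-Reasoning

-- cos and sin are their Taylor series at 0. The n-th term of the sequence is the
-- degree < n Taylor polynomial evaluated at the n-th rational approximation.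
cos : ℝ → ℝ
cos x = mkℝ (λ n → taylor cosCoeff n (seq x n)) (taylor-cauchy cosCoeff ∣cosCoeff∣≤1 (seq x) (cauchy x))

sin : ℝ → ℝ
sin x = mkℝ (λ n → taylor sinCoeff n (seq x n)) (taylor-cauchy sinCoeff ∣sinCoeff∣≤1 (seq x) (cauchy x))

ℝ² : Set
ℝ² = ℝ × ℝ

infix 4 _≃²_

_≃²_ : ℝ² → ℝ² → Set
(x , y) ≃² (x′ , y′) = x ≃ x′ × y ≃ y′

0² : ℝ²
0² = 0ʳ , 0ʳ

infixl 6 _+²_
infixr 7 _·_

_+²_ : ℝ² → ℝ² → ℝ²
(x , y) +² (x′ , y′) = x +ʳ x′ , y +ʳ y′

_·_ : ℝ → ℝ² → ℝ²
a · (x , y) = a *ʳ x , a *ʳ y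

⟨_,_⟩ : ℝ² → ℝ² → ℝ
⟨ (x , y) , (x′ , y′) ⟩ = x *ʳ x′ +ʳ y *ʳ y′

LinearlyIndependent : ℝ² → ℝ² → Set
LinearlyIndependent v w = ∀ a b → a · v +² b · w ≃² 0² → a ≃ 0ʳ × b ≃ 0ʳ

rotate : ℝ → ℝ² → ℝ²
rotate θ (x , y) = cos θ *ʳ x -ʳ sin θ *ʳ y , sin θ *ʳ x +ʳ cos θ *ʳ y

-- Image of S under the rotation by θ, closed under equality of reals.
R[_] : ℝ → Pred ℝ² 0ℓ → Pred ℝ² 0ℓ
R[ θ ] S p = ∃[ q ] q ∈ S × rotate θ q ≃² p

E : ℝ → Pred ℝ² 0ℓ
E ε (x , y) = ∥ x ∥ ≤ʳ ε

u : ℝ → ℝ²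
u θ = cos θ , sin θ

IsInteger : ℝ → Set
IsInteger x = ∃[ m ] x ≃ fromℚ (fromℤ m)

CongruentMod2π : ℝ → ℝ → Set
CongruentMod2π θ φ = ∃[ m ] θ -ʳ φ ≃ fromℚ (fromℤ (+ 2 ℤ.* m)) *ʳ π

strips : ℝ → ∀ {n} → (Fin (suc n) → ℝ) → Pred ℝ² 0ℓ
strips ε {n} θ = ⋃ (Fin (suc n)) (λ j → R[ θ j ] (E ε))

IsPeriodVector : ∀ {n} → (Fin (suc n) → ℝ) → ℝ² → Set
IsPeriodVector θ v = ∀ j → IsInteger ⟨ u (θ j) , v ⟩

Periodic : ∀ {n} → (Fin (suc n) → ℝ) → Set
Periodic θ = ∃[ v ] ∃[ w ] IsPeriodVector θ v × IsPeriodVector θ w × LinearlyIndependent v w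

{-# OPTIONS --safe #-}
module Submission where

-- Let v, w be independent period-vectors. The pairs (⟨u j , v⟩ , ⟨u j , w⟩) are
-- integral and, u j being a unit vector, they lie on the ellipse
-- |w|² a² - 2⟨v , w⟩ ab + |v|² b² = det(v , w)². Three pairwise non-parallel pairs
-- determine this ellipse up to scaling, and with fewer of them there is room for a
-- rational one, so all pairs lie on a conic Ax² + Bxy + Cy² = N with integer
-- coefficients and D = 4AC - B² > 0. As D ≡ 0 or 3 modulo 4, it has a prime divisor
-- p, and modulo p the form is a multiple of ℓ² for a linear form ℓ. If p ∤ N, then
-- ℓ ≡ ±r ≢ 0 at all pairs, and a multiple of ℓ / p takes only values ±⌊p/2⌋ / p
-- modulo 1, which are at distance at least 1/3 from 0: this is a point outside all
-- strips. If p ∣ N, the pairs lie in the sublattice p ∣ ℓ, on which the form is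
-- divisible by p, and dividing by p lowers N to N / p.

open import Defs

-- Equality and order of Cauchy reals cannot be decided, and the ellipse need not be proportional to
-- an integral one. All case distinctions are therefore made on the integral pairs. The reals only
-- enter through equations between integer multiples of T = det(v , w)² and of one further real
-- number, and an integer m with T m = 0 is 0 because T ≠ 0. The constant: (p - 1) / (2p) increases
-- with the odd prime p and equals 1/3 at p = 3, while p = 2 gives 1/2. So 1/3 is the worst case
-- over all primes. D > 0 is more than a convenience. It excludes D = 0 and also D = -1, the
-- discriminant of xy, which is 3 modulo 4 but has no prime divisor. It survives the descent:
-- passing to the sublattice keeps D, and dividing all coefficients by p divides it by p². The
-- descent never follows a point of the plane. It transports an integral functional s a + t b with a
-- denominator m, which pulls back along every change of coordinates that occurs; the point (s v + t
-- w) / m is formed from it only at the end.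

module BinaryForms where

  open import Data.Integer.Base hiding (suc) renaming (∣_∣ to abs)
  open import Data.Integer.Properties hiding (_≟_)
  open import Data.Integer.Divisibility.Signed
  open import Data.Integer.DivMod using (_%ℕ_; _/ℕ_; a≡a%ℕn+[a/ℕn]*n; n%ℕd<d)
  open import Data.Integer.Solver using (module +-*-Solver)
  open import Data.Nat.Base as ℕ using (ℕ; suc; zero)
  import Data.Nat.Coprimality as Coprimality
  import Data.Nat.Divisibility as ℕ
  import Data.Nat.Properties as ℕ
  open import Data.Nat.GCD using (module Bézout)
  open import Data.Nat.Induction using (Acc; acc; <-wellFounded)
  open import Data.Nat.ListAction using (product)
  open import Data.Nat.Primality
  open import Data.Nat.Primality.Factorisation using (factorise)
  open import Data.List.Base using ([]; _∷_)
  open import Data.List.Relation.Unary.All using (_∷_)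
  open import Data.Product.Base using (∃-syntax; _×_; _,_)
  open import Data.Sum.Base as Sum using (_⊎_; inj₁; inj₂)
  open import Function.Base using (id; _∘_)
  open import Relation.Binary.PropositionalEquality
  open import Relation.Nullary using (¬_; yes; no; contradiction)

  open +-*-Solver using (solve; _:+_; _:*_; _:-_; :-_; _:=_; con)

  -- Divisibility and binary forms modulo a prime

  ∣-resp : ∀ {k a b} → a ≡ b → k ∣ a → k ∣ b
  ∣-resp eq = subst (_ ∣_) eq

  even∨odd : ∀ z → + 2 ∣ z ⊎ + 2 ∣ z - 1ℤ
  even∨odd z with z %ℕ 2 | a≡a%ℕn+[a/ℕn]*n z 2 | n%ℕd<d z 2
  ... | 0 | eq | _ = inj₁ (divides (z /ℕ 2) (trans eq (+-identityˡ (z /ℕ 2 * + 2))))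
  ... | 1 | eq | _ = inj₂ (divides (z /ℕ 2) (trans (cong (_- 1ℤ) eq)
          (solve 1 (λ q → con 1ℤ :+ q :- con 1ℤ := q) refl (z /ℕ 2 * + 2))))
  ... | suc (suc _) | _ | ℕ.s≤s (ℕ.s≤s ())

  module _ {p : ℕ} (p-prime : Prime p) where

    prime∣* : ∀ a b → + p ∣ a * b → + p ∣ a ⊎ + p ∣ b
    prime∣* a b p∣ab = Sum.map ∣ᵤ⇒∣ ∣ᵤ⇒∣
      (euclidsLemma (abs a) (abs b) p-prime (subst (p ℕ.∣_) (abs-* a b) (∣⇒∣ᵤ p∣ab)))

    prime∣*ʳ : ∀ {a b} → ¬ + p ∣ a → + p ∣ a * b → + p ∣ b
    prime∣*ʳ {a} {b} p∤a p∣ab = Sum.[ (λ p∣a → contradiction p∣a p∤a) , id ] (prime∣* a b p∣ab)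

    prime∣² : ∀ {a} → + p ∣ a * a → + p ∣ a
    prime∣² {a} p∣a² = Sum.[ id , id ] (prime∣* a a p∣a²)

    instance
      p≢0 : ℕ.NonZero p
      p≢0 = prime⇒nonZero p-prime

    0<p : 0ℤ < + p
    0<p = +<+ (ℕ.n≢0⇒n>0 (ℕ.≢-nonZero⁻¹ p))

    inverse-ℕ : ∀ n → ¬ p ℕ.∣ n → ∃[ k ] + p ∣ + n * k - 1ℤ
    inverse-ℕ n p∤n with Coprimality.coprime-Bézout coprime
      where
      coprime : Coprimality.Coprime p n
      coprime (d∣p , d∣n) with prime⇒irreducible p-prime d∣p
      ... | inj₁ d≡1 = d≡1
      ... | inj₂ refl = contradiction d∣n p∤n
    ... | Bézout.Identity.+- x y eq = - + y , divides (- + x) (begin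
        + n * - + y - 1ℤ       ≡⟨ solve 2 (λ n y → n :* (:- y) :- con 1ℤ := :- (con 1ℤ :+ y :* n)) refl (+ n) (+ y) ⟩
        - (1ℤ + + y * + n)     ≡⟨ cong (-_ ∘ (_+_ 1ℤ)) (sym (pos-* y n)) ⟩
        - + (1 ℕ.+ y ℕ.* n)    ≡⟨ cong (-_ ∘ +_) eq ⟩
        - + (x ℕ.* p)          ≡⟨ cong -_ (pos-* x p) ⟩
        - (+ x * + p)          ≡⟨ neg-distribˡ-* (+ x) (+ p) ⟩
        - + x * + p            ∎)
      where open ≡-Reasoning
    ... | Bézout.Identity.-+ x y eq = + y , divides (+ x) (begin
        + n * + y - 1ℤ                   ≡⟨ cong (_- 1ℤ) (*-comm (+ n) (+ y)) ⟩
        + y * + n - 1ℤ                   ≡⟨ cong (_- 1ℤ) (sym (pos-* y n)) ⟩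
        + (y ℕ.* n) - 1ℤ                 ≡⟨ cong (λ z → + z - 1ℤ) (sym eq) ⟩
        1ℤ + + (x ℕ.* p) - 1ℤ            ≡⟨ solve 1 (λ z → con 1ℤ :+ z :- con 1ℤ := z) refl (+ (x ℕ.* p)) ⟩
        + (x ℕ.* p)                      ≡⟨ pos-* x p ⟩
        + x * + p                        ∎)
      where open ≡-Reasoning

    inverse : ∀ {a} → ¬ + p ∣ a → ∃[ k ] + p ∣ a * k - 1ℤ
    inverse {+ n} p∤a = inverse-ℕ n (p∤a ∘ ∣ᵤ⇒∣)
    inverse { -[1+ n ]} p∤a with inverse-ℕ (suc n) (p∤a ∘ ∣ᵤ⇒∣)
    ... | k , p∣ = - k , ∣-resp (solve 2 (λ n k → n :* k :- con 1ℤ := (:- n) :* (:- k) :- con 1ℤ) refl (+ suc n) k) p∣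

    -- A binary form of discriminant divisible by p is A(x - ey)² modulo p.
    double-root : ∀ {A B C} → ¬ + p ∣ A → + p ∣ + 4 * A * C - B * B →
      ∃[ e ] (+ p ∣ + 2 * A * e + B × + p ∣ A * e * e - C)
    double-root {A} {B} {C} p∤A p∣D with + p ∣? + 2 * A
    ... | no p∤2A with inverse p∤2A
    -- Here e = -B / (2A) modulo p, and (2Ae + B)(2Ae - B) - D = 4A(Ae² - C), where p divides
    -- neither 2 nor A.
    ...   | k , p∣1 = e , p∣root , prime∣*ʳ p∤A (prime∣*ʳ p∤2 (prime∣*ʳ p∤2 (∣-resp
              (solve 4 (λ A B C e → (con (+ 2) :* A :* e :+ B) :* (con (+ 2) :* A :* e :- B) :- (con (+ 4) :* A :* C :- B :* B)
                := con (+ 2) :* (con (+ 2) :* (A :* (A :* e :* e :- C)))) refl A B C e)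
              (∣m∣n⇒∣m-n (∣m⇒∣m*n (+ 2 * A * e - B) p∣root) p∣D))))
      where
      e = - B * k
      p∤2 : ¬ + p ∣ + 2
      p∤2 p∣2 = p∤2A (∣m⇒∣m*n A p∣2)
      p∣root : + p ∣ + 2 * A * e + B
      p∣root = ∣-resp (solve 3 (λ A B k → (:- B) :* (con (+ 2) :* A :* k :- con 1ℤ) := con (+ 2) :* A :* ((:- B) :* k) :+ B) refl A B k)
        (∣n⇒∣m*n (- B) p∣1)
    -- Now p = 2 and A is odd, and B is even because B² = 4AC - D. Modulo 2 the form is x² + Cy²,
    -- and C² ≡ C makes it (x - Cy)². This is why e = C.
    double-root {A} {B} {C} p∤A p∣D | yes p∣2A = C ,
      ∣m∣n⇒∣m+n (∣m⇒∣m*n C p∣2A) p∣B ,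
      ∣-trans (∣-reflexive p≡2) (∣-resp
        (solve 2 (λ A C → (A :- con 1ℤ) :* (C :* C) :+ C :* (C :- con 1ℤ) := A :* C :* C :- C) refl A C)
        (∣m∣n⇒∣m+n (∣m⇒∣m*n (C * C) 2∣A-1) 2∣C[C-1]))
      where
      p∣2 : + p ∣ + 2
      p∣2 = prime∣*ʳ p∤A (∣-resp (*-comm (+ 2) A) p∣2A)
      p≡2 : + p ≡ + 2
      p≡2 with prime⇒irreducible prime[2] (∣⇒∣ᵤ p∣2)
      ... | inj₁ refl = contradiction p-prime ¬prime[1]
      ... | inj₂ refl = refl
      p∣B : + p ∣ B
      p∣B = prime∣² (∣-resp
        (solve 3 (λ A B C → con (+ 2) :* (con (+ 2) :* A :* C) :- (con (+ 4) :* A :* C :- B :* B) := B :* B) refl A B C)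
        (∣m∣n⇒∣m-n (∣m⇒∣m*n (+ 2 * A * C) p∣2) p∣D))
      2∣A-1 : + 2 ∣ A - 1ℤ
      2∣A-1 with even∨odd A
      ... | inj₁ 2∣A = contradiction (∣-trans (∣-reflexive p≡2) 2∣A) p∤A
      ... | inj₂ 2∣A-1 = 2∣A-1
      2∣C[C-1] : + 2 ∣ C * (C - 1ℤ)
      2∣C[C-1] with even∨odd C
      ... | inj₁ 2∣C = ∣m⇒∣m*n (C - 1ℤ) 2∣C
      ... | inj₂ 2∣C-1 = ∣n⇒∣m*n C 2∣C-1

  prime-divisor : ∀ n → .{{ℕ.NonZero n}} → n ≢ 1 → ∃[ p ] Prime p × p ℕ.∣ n
  prime-divisor n n≢1 with factorise n
  ... | record { factors = [] ; isFactorisation = eq } = contradiction eq n≢1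
  ... | record { factors = p ∷ ps ; isFactorisation = eq ; factorsPrime = p-prime ∷ _ } =
    p , p-prime , ℕ.divides (product ps) (trans eq (ℕ.*-comm p (product ps)))

  -- For even B the left side is divisible by 4, for odd B it is so after adding 1; the value 1
  -- would give 4 ∣ 1 or 4 ∣ 2. Together with positivity this provides the prime of each descent
  -- step.
  4AC-B²≢1 : ∀ A B C → + 4 * A * C - B * B ≢ 1ℤ
  4AC-B²≢1 A B C eq with even∨odd B
  ... | inj₁ (divides b B≡) = contradiction (∣-resp {+ 4} (sym (begin
      1ℤ                                      ≡⟨ sym eq ⟩
      + 4 * A * C - B * B                     ≡⟨ cong (λ B → + 4 * A * C - B * B) B≡ ⟩
      + 4 * A * C - b * + 2 * (b * + 2)       ≡⟨ solve 3 (λ A b C → con (+ 4) :* A :* C :- b :* con (+ 2) :* (b :* con (+ 2))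
                                                   := (A :* C :- b :* b) :* con (+ 4)) refl A b C ⟩
      (A * C - b * b) * + 4                   ∎)) (divides (A * C - b * b) refl))
      λ 4∣1 → ℕ.>⇒∤ (ℕ.s≤s (ℕ.s≤s ℕ.z≤n)) (∣⇒∣ᵤ 4∣1)
    where open ≡-Reasoning
  ... | inj₂ (divides b B-1≡) = contradiction (∣-resp {+ 4} (sym (begin
      + 2                                     ≡⟨ cong (_+_ 1ℤ) (sym eq) ⟩
      1ℤ + (+ 4 * A * C - B * B)              ≡⟨ cong (λ B → 1ℤ + (+ 4 * A * C - B * B)) B≡ ⟩
      1ℤ + (+ 4 * A * C - (b * + 2 + 1ℤ) * (b * + 2 + 1ℤ))
        ≡⟨ solve 3 (λ A b C → con 1ℤ :+ (con (+ 4) :* A :* C :- (b :* con (+ 2) :+ con 1ℤ) :* (b :* con (+ 2) :+ con 1ℤ))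
             := (A :* C :- b :* b :- b) :* con (+ 4)) refl A b C ⟩
      (A * C - b * b - b) * + 4               ∎)) (divides (A * C - b * b - b) refl))
      λ 4∣2 → ℕ.>⇒∤ (ℕ.s≤s (ℕ.s≤s (ℕ.s≤s ℕ.z≤n))) (∣⇒∣ᵤ 4∣2)
    where
    open ≡-Reasoning
    B≡ : B ≡ b * + 2 + 1ℤ
    B≡ = trans (solve 1 (λ B → B := B :- con 1ℤ :+ con 1ℤ) refl B) (cong (_+ 1ℤ) B-1≡)

  -- z / m is at distance at least 1/3 from every integer.
  record MiddleThird (m z : ℤ) : Set where
    constructor middleThird
    field
      q     : ℤ
      lower : m ≤ + 3 * (z - q * m)
      upper : + 3 * (z - q * m) ≤ + 2 * m

  -- The arithmetic form of an uncovered point. With the pairs (⟨u j , v⟩ , ⟨u j , w⟩) as x and y,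
  -- the point (s v + t w) / m has inner products (s x + t y) / m with the u j, and all of them are
  -- at distance at least 1/3 from the integers.
  record Separated {I : Set} (x y : I → ℤ) : Set where
    constructor separated
    field
      m s t  : ℤ
      0<m    : 0ℤ < m
      middle : ∀ i → MiddleThird m (s * x i + t * y i)

  middleThird-resp : ∀ {m z h} → m ≤ + 3 * h → + 3 * h ≤ + 2 * m → m ∣ z - h → MiddleThird m z
  middleThird-resp {m} {z} {h} lo hi (divides q eq) = middleThird q
    (subst (λ w → m ≤ + 3 * w) (sym z-qm≡h) lo) (subst (λ w → + 3 * w ≤ + 2 * m) (sym z-qm≡h) hi)
    where
    z-qm≡h : z - q * m ≡ h
    z-qm≡h = trans (cong (λ w → z - w) (sym eq)) (solve 2 (λ z h → z :- (z :- h) := h) refl z h)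

  middleThird-scale : ∀ {p m z} → 0ℤ < p → MiddleThird m z →
    MiddleThird (m * p) (z * p)
  middleThird-scale {p} {m} {z} 0<p (middleThird q lo hi) = middleThird q
    (subst (m * p ≤_) eq (*-monoʳ-≤-nonNeg p lo))
    (subst₂ _≤_ eq (solve 2 (λ m p → con (+ 2) :* m :* p := con (+ 2) :* (m :* p)) refl m p) (*-monoʳ-≤-nonNeg p hi))
    where
    instance
      p≥0 : NonNegative p
      p≥0 = nonNegative (<⇒≤ 0<p)
    eq : + 3 * (z - q * m) * p ≡ + 3 * (z * p - q * (m * p))
    eq = solve 4 (λ p m z q → con (+ 3) :* (z :- q :* m) :* p := con (+ 3) :* (z :* p :- q :* (m :* p))) refl p m z q

  -- A functional of (x′ , y′) becomes, after multiplication by p, an integral functional of (x ,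
  -- y). Enlarging the denominator from m to m p leaves all quotients unchanged. This serves the
  -- sublattice of index p and, with p = 1, the coordinates from Cramer's rule.
  separated-linear : ∀ {I : Set} {x y x′ y′ : I → ℤ} {p} (a b c d : ℤ) → 0ℤ < p →
    (∀ i → x′ i * p ≡ a * x i + b * y i) → (∀ i → y′ i * p ≡ c * x i + d * y i) →
    Separated x′ y′ → Separated x y
  separated-linear {x = x} {y} {x′} {y′} {p} a b c d 0<p x′-eq y′-eq (separated m s t 0<m mid) =
    separated (m * p) (s * a + t * c) (s * b + t * d)
      (subst (_< m * p) (*-zeroˡ p) (*-monoʳ-<-pos p 0<m))
      (λ i → subst (MiddleThird (m * p)) (eq i) (middleThird-scale 0<p (mid i)))
    where
    instance
      p>0 : Positive p
      p>0 = positive 0<p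
    open ≡-Reasoning
    eq : ∀ i → (s * x′ i + t * y′ i) * p ≡ (s * a + t * c) * x i + (s * b + t * d) * y i
    eq i = begin
      (s * x′ i + t * y′ i) * p
        ≡⟨ solve 5 (λ s t X Y p → (s :* X :+ t :* Y) :* p := s :* (X :* p) :+ t :* (Y :* p)) refl s t (x′ i) (y′ i) p ⟩
      s * (x′ i * p) + t * (y′ i * p)
        ≡⟨ cong₂ (λ X Y → s * X + t * Y) (x′-eq i) (y′-eq i) ⟩
      s * (a * x i + b * y i) + t * (c * x i + d * y i)
        ≡⟨ solve 8 (λ a b c d s t X Y → s :* (a :* X :+ b :* Y) :+ t :* (c :* X :+ d :* Y)
             := (s :* a :+ t :* c) :* X :+ (s :* b :+ t :* d) :* Y) refl a b c d s t (x i) (y i) ⟩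
      (s * a + t * c) * x i + (s * b + t * d) * y i ∎

  -- The two numbers are the halves of p, rounded down and up. Raising p by 2 raises each half by 1,
  -- and the 3 gained on one side lies between the 2 and the 4 gained on the others. For p = 3 the
  -- bounds are attained. As h + k = p, the number k represents -h modulo p.
  thirds : ∀ p → 2 ℕ.≤ p → ∃[ h ] ∃[ k ] (h ℕ.+ k ≡ p ×
    p ℕ.≤ 3 ℕ.* h × 3 ℕ.* h ℕ.≤ 2 ℕ.* p × p ℕ.≤ 3 ℕ.* k × 3 ℕ.* k ℕ.≤ 2 ℕ.* p)
  thirds 1 (ℕ.s≤s ())
  thirds 2 _ = 1 , 1 , refl , ℕ.m≤m+n 2 1 , ℕ.m≤m+n 3 1 , ℕ.m≤m+n 2 1 , ℕ.m≤m+n 3 1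
  thirds 3 _ = 1 , 2 , refl , ℕ.≤-refl , ℕ.m≤m+n 3 3 , ℕ.m≤m+n 3 3 , ℕ.≤-refl
  thirds (suc (suc p@(suc (suc _)))) _ with thirds p (ℕ.s≤s (ℕ.s≤s ℕ.z≤n))
  ... | h , k , h+k≡p , p≤3h , 3h≤2p , p≤3k , 3k≤2p =
    suc h , suc k , cong suc (trans (ℕ.+-suc h k) (cong suc h+k≡p)) , lo p≤3h , hi 3h≤2p , lo p≤3k , hi 3k≤2p
    where
    lo : ∀ {h} → p ℕ.≤ 3 ℕ.* h → 2 ℕ.+ p ℕ.≤ 3 ℕ.* suc h
    lo {h} p≤3h = subst (2 ℕ.+ p ℕ.≤_) (sym (ℕ.*-suc 3 h)) (ℕ.+-mono-≤ (ℕ.m≤m+n 2 1) p≤3h)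
    hi : ∀ {h} → 3 ℕ.* h ℕ.≤ 2 ℕ.* p → 3 ℕ.* suc h ℕ.≤ 2 ℕ.* (2 ℕ.+ p)
    hi {h} 3h≤2p = subst₂ ℕ._≤_ (sym (ℕ.*-suc 3 h)) (sym (ℕ.*-distribˡ-+ 2 2 p)) (ℕ.+-mono-≤ (ℕ.m≤m+n 3 1) 3h≤2p)

  -- Integral conics and the descent on N

  record OnConic {I : Set} (A B C N : ℤ) (x y : I → ℤ) : Set where
    constructor onConic
    field at : ∀ i → A * x i * x i + B * x i * y i + C * y i * y i ≡ N

  open OnConic

  -- A common interface for the two reductions, passing to a sublattice and dividing the
  -- coefficients. Only the way back, `lift`, is recorded, so the relation between the old and the
  -- new pairs can differ.
  record Descent {I : Set} (p : ℕ) (N : ℤ) (x y : I → ℤ) : Set where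
    constructor descend
    field
      {A B C N′}  : ℤ
      {x′ y′}     : I → ℤ
      N≡N′p       : N ≡ N′ * + p
      0<disc      : 0ℤ < + 4 * A * C - B * B
      on          : OnConic A B C N′ x′ y′
      lift        : Separated x′ y′ → Separated x y

  swap-conic : ∀ {I : Set} {A B C N} {x y : I → ℤ} → OnConic A B C N x y → OnConic C B A N y x
  swap-conic {A = A} {B} {C} {x = x} {y} on = onConic λ i → trans
    (solve 5 (λ A B C x y → C :* y :* y :+ B :* y :* x :+ A :* x :* x := A :* x :* x :+ B :* x :* y :+ C :* y :* y)
      refl A B C (x i) (y i)) (at on i)

  swap-disc : ∀ A B C → + 4 * A * C - B * B ≡ + 4 * C * A - B * B
  swap-disc = solve 3 (λ A B C → con (+ 4) :* A :* C :- B :* B := con (+ 4) :* C :* A :- B :* B) refl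

  separated-swap : ∀ {I : Set} {x y : I → ℤ} → Separated x y → Separated y x
  separated-swap {x = x} {y} (separated m s t 0<m mid) = separated m t s 0<m
    λ i → subst (MiddleThird m) (+-comm (s * x i) (t * y i)) (mid i)

  descent-swap : ∀ {I : Set} {p N} {x y : I → ℤ} → Descent p N x y → Descent p N y x
  descent-swap (descend N≡N′p 0<disc on lift) = descend N≡N′p 0<disc on (separated-swap ∘ lift)

  form-shift : ∀ A B C e x y → A * (x - e * y) * (x - e * y) + (+ 2 * A * e + B) * (x - e * y) * y
    + (A * e * e + B * e + C) * y * y ≡ A * x * x + B * x * y + C * y * y
  form-shift = solve 6 (λ A B C e x y →
    A :* (x :- e :* y) :* (x :- e :* y) :+ (con (+ 2) :* A :* e :+ B) :* (x :- e :* y) :* y :+ (A :* e :* e :+ B :* e :+ C) :* y :* y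
    := A :* x :* x :+ B :* x :* y :+ C :* y :* y) refl

  form-scale : ∀ p A B C x y → (p * A * x * x + B * x * y + C * y * y) * p
    ≡ A * (x * p) * (x * p) + B * (x * p) * y + (C * p) * y * y
  form-scale = solve 6 (λ p A B C x y → (p :* A :* x :* x :+ B :* x :* y :+ C :* y :* y) :* p
    := A :* (x :* p) :* (x :* p) :+ B :* (x :* p) :* y :+ (C :* p) :* y :* y) refl

  -- In the coordinates (x - e y , y) the form has coefficients A, 2Ae + B and its value at (e , 1).
  -- With x - e y = x′ p and that value equal to C′ p, every term contains a factor p, which is
  -- cancelled.
  substitute : ∀ A B C e x y p x′ C′ {N′} {{_ : ℕ.NonZero p}} → x - e * y ≡ x′ * + p → A * e * e + B * e + C ≡ C′ * + p →
    A * x * x + B * x * y + C * y * y ≡ N′ * + p →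
    + p * A * x′ * x′ + (+ 2 * A * e + B) * x′ * y + C′ * y * y ≡ N′
  substitute A B C e x y p x′ C′ {N′} {{p≢0}} x-ey≡ Q[e]≡ Q≡ =
    *-cancelʳ-≡ (+ p * A * x′ * x′ + (+ 2 * A * e + B) * x′ * y + C′ * y * y) N′ (+ p) {{p≢0}}
      (trans (form-scale (+ p) A (+ 2 * A * e + B) C′ x′ y)
        (trans (sym (cong₂ (λ l c → A * l * l + (+ 2 * A * e + B) * l * y + c * y * y) x-ey≡ Q[e]≡))
          (trans (form-shift A B C e x y) Q≡)))

  disc-scale : ∀ a b c p → + 4 * (a * p) * (c * p) - b * p * (b * p) ≡ (+ 4 * a * c - b * b) * p * p
  disc-scale = solve 4 (λ a b c p → con (+ 4) :* (a :* p) :* (c :* p) :- b :* p :* (b :* p)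
    := (con (+ 4) :* a :* c :- b :* b) :* p :* p) refl

  disc-cong : ∀ {A B C a b c} → A ≡ a → B ≡ b → C ≡ c → + 4 * A * C - B * B ≡ + 4 * a * c - b * b
  disc-cong refl refl refl = refl

  form-cong : ∀ {A B C a b c x y} → A ≡ a → B ≡ b → C ≡ c →
    A * x * x + B * x * y + C * y * y ≡ a * x * x + b * x * y + c * y * y
  form-cong refl refl refl = refl

  form-factor : ∀ a b c p x y → a * p * x * x + b * p * x * y + c * p * y * y ≡ (a * x * x + b * x * y + c * y * y) * p
  form-factor = solve 6 (λ a b c p x y → a :* p :* x :* x :+ b :* p :* x :* y :+ c :* p :* y :* y
    := (a :* x :* x :+ b :* x :* y :+ c :* y :* y) :* p) refl

  module _ {I : Set} (i₀ : I) {p : ℕ} (p-prime : Prime p) where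

    module _ {A B C N} {x y : I → ℤ} (p∤A : ¬ + p ∣ A) (on : OnConic A B C N x y)
             {e} (p∣root : + p ∣ + 2 * A * e + B) (p∣prod : + p ∣ A * e * e - C) where

      private
        ℓ : I → ℤ
        ℓ i = x i - e * y i

        N≡Aℓ² : ∀ i → + p ∣ N - A * (ℓ i * ℓ i)
        N≡Aℓ² i = ∣-resp (begin
            (+ 2 * A * e + B) * (x i * y i) - (A * e * e - C) * (y i * y i)
              ≡⟨ solve 6 (λ A B C e x y → (con (+ 2) :* A :* e :+ B) :* (x :* y) :- (A :* e :* e :- C) :* (y :* y)
                   := (A :* x :* x :+ B :* x :* y :+ C :* y :* y) :- A :* ((x :- e :* y) :* (x :- e :* y)))
                   refl A B C e (x i) (y i) ⟩
            A * x i * x i + B * x i * y i + C * y i * y i - A * (ℓ i * ℓ i)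
              ≡⟨ cong (_- A * (ℓ i * ℓ i)) (at on i) ⟩
            N - A * (ℓ i * ℓ i) ∎)
          (∣m∣n⇒∣m-n (∣m⇒∣m*n (x i * y i) p∣root) (∣m⇒∣m*n (y i * y i) p∣prod))
          where open ≡-Reasoning

      module _ (h k m : ℤ) (p∣ℓ₀k-1 : + p ∣ ℓ i₀ * k - 1ℤ) where

        private
          -- This is h k ℓ, where k inverts ℓ i₀ modulo p. Its residue is therefore h where ℓ ≡ ℓ
          -- i₀, and -h, represented by m, where ℓ ≡ -ℓ i₀.
          f : I → ℤ
          f i = h * k * x i + - (h * k * e) * y i

        f≡h : ∀ i → + p ∣ ℓ i - ℓ i₀ → + p ∣ f i - h
        f≡h i p∣ℓ-ℓ₀ = ∣-resp
          (solve 6 (λ h k e x y m → h :* k :* (x :- e :* y :- m) :+ h :* (m :* k :- con 1ℤ)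
             := h :* k :* x :+ (:- (h :* k :* e)) :* y :- h) refl h k e (x i) (y i) (ℓ i₀))
          (∣m∣n⇒∣m+n (∣n⇒∣m*n (h * k) p∣ℓ-ℓ₀) (∣n⇒∣m*n h p∣ℓ₀k-1))

        f≡-h : ∀ i → + p ∣ h + m → + p ∣ ℓ i + ℓ i₀ → + p ∣ f i - m
        f≡-h i p∣h+m p∣ℓ+ℓ₀ = ∣-resp
          (solve 7 (λ h h′ k e x y m → h :* k :* (x :- e :* y :+ m) :- h :* (m :* k :- con 1ℤ) :- (h :+ h′)
             := h :* k :* x :+ (:- (h :* k :* e)) :* y :- h′) refl h m k e (x i) (y i) (ℓ i₀))
          (∣m∣n⇒∣m-n (∣m∣n⇒∣m-n (∣n⇒∣m*n (h * k) p∣ℓ+ℓ₀) (∣n⇒∣m*n h p∣ℓ₀k-1)) p∣h+m)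

      separated-mod : ¬ + p ∣ N → Separated x y
      separated-mod p∤N = conclude
        (inverse p-prime p∤ℓ₀) (thirds p (ℕ.nonTrivial⇒n>1 p {{prime⇒nonTrivial p-prime}}))
        where
        p∤ℓ₀ : ¬ + p ∣ ℓ i₀
        p∤ℓ₀ p∣ℓ₀ = p∤N (∣-resp
          (solve 2 (λ N X → N :- X :+ X := N) refl N (A * (ℓ i₀ * ℓ i₀)))
          (∣m∣n⇒∣m+n (N≡Aℓ² i₀) (∣n⇒∣m*n A (∣m⇒∣m*n (ℓ i₀) p∣ℓ₀))))

        ℓ≡±ℓ₀ : ∀ i → + p ∣ ℓ i - ℓ i₀ ⊎ + p ∣ ℓ i + ℓ i₀
        ℓ≡±ℓ₀ i = prime∣* p-prime (ℓ i - ℓ i₀) (ℓ i + ℓ i₀) (prime∣*ʳ p-prime p∤A (∣-resp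
          (solve 4 (λ N A l m → (N :- A :* (m :* m)) :- (N :- A :* (l :* l)) := A :* ((l :- m) :* (l :+ m)))
            refl N A (ℓ i) (ℓ i₀))
          (∣m∣n⇒∣m-n (N≡Aℓ² i₀) (N≡Aℓ² i))))

        conclude : ∃[ k ] + p ∣ ℓ i₀ * k - 1ℤ → ∃[ h ] ∃[ m ] (h ℕ.+ m ≡ p ×
          p ℕ.≤ 3 ℕ.* h × 3 ℕ.* h ℕ.≤ 2 ℕ.* p × p ℕ.≤ 3 ℕ.* m × 3 ℕ.* m ℕ.≤ 2 ℕ.* p) → Separated x y
        conclude (k , p∣ℓ₀k-1) (h , m , h+m≡p , p≤3h , 3h≤2p , p≤3m , 3m≤2p) =
          separated (+ p) (+ h * k) (- (+ h * k * e)) (0<p p-prime) λ i → Sum.[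
            (λ p∣ℓ-ℓ₀ → middleThird-resp (lo {h} p≤3h) (hi {h} 3h≤2p) (f≡h (+ h) k (+ m) p∣ℓ₀k-1 i p∣ℓ-ℓ₀)) ,
            (λ p∣ℓ+ℓ₀ → middleThird-resp (lo {m} p≤3m) (hi {m} 3m≤2p) (f≡-h (+ h) k (+ m) p∣ℓ₀k-1 i
              (∣-reflexive (cong +_ (sym h+m≡p))) p∣ℓ+ℓ₀)) ] (ℓ≡±ℓ₀ i)
          where
          lo : ∀ {b} → p ℕ.≤ 3 ℕ.* b → + p ≤ + 3 * + b
          lo {b} p≤3b = subst (+ p ≤_) (pos-* 3 b) (+≤+ p≤3b)
          hi : ∀ {b} → 3 ℕ.* b ℕ.≤ 2 ℕ.* p → + 3 * + b ≤ + 2 * + p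
          hi {b} 3b≤2p = subst₂ _≤_ (pos-* 3 b) (pos-* 2 p) (+≤+ 3b≤2p)

      -- The substitution x = e y + p x′ has determinant p and multiplies the discriminant by p²;
      -- dividing the resulting form by p divides it by p² again. So the discriminant is preserved
      -- exactly while N loses a factor p.
      descent-sublattice : 0ℤ < + 4 * A * C - B * B → + p ∣ N → Descent p N x y
      descent-sublattice 0<D p∣N@(divides N′ N≡N′p) = descend N≡N′p
        (subst (0ℤ <_) disc-eq 0<D) onConic′
        -- The coordinate y is kept, written as (0 x + p y) / p to share the denominator of x′ = (x
        -- - e y) / p.
        (separated-linear 1ℤ (- e) 0ℤ (+ p) (0<p p-prime)
          (λ i → trans (sym (ℓ≡x′p i)) (solve 3 (λ x y e → x :- e :* y := con 1ℤ :* x :+ (:- e) :* y) refl (x i) (y i) e))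
          (λ i → solve 3 (λ x y p → y :* p := con 0ℤ :* x :+ p :* y) refl (x i) (y i) (+ p)))
        where
        open ≡-Reasoning
        p∣ℓ : ∀ i → + p ∣ ℓ i
        p∣ℓ i = prime∣² p-prime (prime∣*ʳ p-prime p∤A (∣-resp
          (solve 2 (λ N X → N :- (N :- X) := X) refl N (A * (ℓ i * ℓ i))) (∣m∣n⇒∣m-n p∣N (N≡Aℓ² i))))
        x′ : I → ℤ
        x′ i = _∣_.quotient (p∣ℓ i)
        ℓ≡x′p : ∀ i → ℓ i ≡ x′ i * + p
        ℓ≡x′p i = _∣_.equality (p∣ℓ i)
        p∣Q[e] : + p ∣ A * e * e + B * e + C
        p∣Q[e] = ∣-resp
          (solve 4 (λ A B C e → e :* (con (+ 2) :* A :* e :+ B) :- (A :* e :* e :- C) := A :* e :* e :+ B :* e :+ C) refl A B C e)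
          (∣m∣n⇒∣m-n (∣n⇒∣m*n e p∣root) p∣prod)
        C′ : ℤ
        C′ = _∣_.quotient p∣Q[e]
        Q[e]≡C′p : A * e * e + B * e + C ≡ C′ * + p
        Q[e]≡C′p = _∣_.equality p∣Q[e]
        B′ = + 2 * A * e + B
        disc-eq : + 4 * A * C - B * B ≡ + 4 * (+ p * A) * C′ - B′ * B′
        disc-eq = begin
          + 4 * A * C - B * B
            ≡⟨ solve 4 (λ A B C e → con (+ 4) :* A :* C :- B :* B :=
                 con (+ 4) :* A :* (A :* e :* e :+ B :* e :+ C) :- (con (+ 2) :* A :* e :+ B) :* (con (+ 2) :* A :* e :+ B)) refl A B C e ⟩
          + 4 * A * (A * e * e + B * e + C) - B′ * B′
            ≡⟨ cong (λ z → + 4 * A * z - B′ * B′) Q[e]≡C′p ⟩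
          + 4 * A * (C′ * + p) - B′ * B′
            ≡⟨ cong (_- B′ * B′) (solve 3 (λ A c p → con (+ 4) :* A :* (c :* p) := con (+ 4) :* (p :* A) :* c) refl A C′ (+ p)) ⟩
          + 4 * (+ p * A) * C′ - B′ * B′ ∎
        onConic′ : OnConic (+ p * A) B′ C′ N′ x′ y
        onConic′ = onConic λ i → substitute A B C e (x i) (y i) p (x′ i) C′ {{p≢0 p-prime}}
          (ℓ≡x′p i) Q[e]≡C′p (trans (at on i) N≡N′p)

    pivot : ∀ {A B C N} {x y : I → ℤ} → ¬ + p ∣ A → + p ∣ + 4 * A * C - B * B → 0ℤ < + 4 * A * C - B * B →
      OnConic A B C N x y → Separated x y ⊎ Descent p N x y
    pivot {N = N} p∤A p∣D 0<D on with double-root p-prime p∤A p∣D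
    ... | e , p∣root , p∣prod with + p ∣? N
    ...   | yes p∣N = inj₂ (descent-sublattice p∤A on p∣root p∣prod 0<D p∣N)
    ...   | no  p∤N = inj₁ (separated-mod p∤A on p∣root p∣prod p∤N)

    -- From B² = 4AC - D also p ∣ B, so the whole form is divisible by p, and N is too, being its
    -- value at i₀. The pairs stay the same.
    descent-divide : ∀ {A B C N} {x y : I → ℤ} → + p ∣ A → + p ∣ C → + p ∣ + 4 * A * C - B * B →
      0ℤ < + 4 * A * C - B * B → OnConic A B C N x y → Descent p N x y
    descent-divide {A} {B} {C} {N} {x} {y} p∣A@(divides a A≡ap) (divides c C≡cp) p∣D 0<D on = descend {A = a} {b} {c} {x′ = x} {y}
      (trans (sym (at on i₀)) (factor i₀))
      (*-cancelʳ-<-nonNeg {0ℤ} {+ 4 * a * c - b * b} (+ p) (*-cancelʳ-<-nonNeg {0ℤ} {(+ 4 * a * c - b * b) * + p} (+ p)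
        (subst (0ℤ <_) (trans (disc-cong {A} {B} {C} A≡ap B≡bp C≡cp) (disc-scale a b c (+ p))) 0<D)))
      (onConic λ i → *-cancelʳ-≡ (q i) (q i₀) (+ p) {{p≢0 p-prime}}
        (trans (sym (factor i)) (trans (at on i) (trans (sym (at on i₀)) (factor i₀)))))
      id
      where
      p∣B : + p ∣ B
      p∣B = prime∣² p-prime (∣-resp
        (solve 3 (λ A B C → A :* (con (+ 4) :* C) :- (con (+ 4) :* A :* C :- B :* B) := B :* B) refl A B C)
        (∣m∣n⇒∣m-n (∣m⇒∣m*n (+ 4 * C) p∣A) p∣D))
      b : ℤ
      b = _∣_.quotient p∣B
      B≡bp : B ≡ b * + p
      B≡bp = _∣_.equality p∣B
      q : I → ℤ
      q i = a * x i * x i + b * x i * y i + c * y i * y i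
      factor : ∀ i → A * x i * x i + B * x i * y i + C * y i * y i ≡ q i * + p
      factor i = trans (form-cong A≡ap B≡bp C≡cp) (form-factor a b c (+ p) (x i) (y i))

    separated⊎descent : ∀ {A B C N} {x y : I → ℤ} → + p ∣ + 4 * A * C - B * B → 0ℤ < + 4 * A * C - B * B →
      OnConic A B C N x y → Separated x y ⊎ Descent p N x y
    separated⊎descent {A} {B} {C} p∣D 0<D on with + p ∣? A | + p ∣? C
    ... | no p∤A  | _       = pivot p∤A p∣D 0<D on
    ... | yes _   | no p∤C  = Sum.map separated-swap descent-swap
      (pivot p∤C (subst (+ p ∣_) (swap-disc A B C) p∣D) (subst (0ℤ <_) (swap-disc A B C) 0<D) (swap-conic on))
    ... | yes p∣A | yes p∣C = inj₂ (descent-divide p∣A p∣C p∣D 0<D on)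

  module _ {I : Set} (i₀ : I) where

    private
      -- The prime is chosen afresh in each round, since dividing the form by p may remove p from
      -- the discriminant. N ≠ 0 makes the absolute value of N strictly decrease.
      go : ∀ {A B C N} {x y : I → ℤ} → Acc ℕ._<_ (abs N) → N ≢ 0ℤ →
        0ℤ < + 4 * A * C - B * B → OnConic A B C N x y → Separated x y
      go {A} {B} {C} {N} (acc rec) N≢0 0<D on
        with prime-divisor (abs (+ 4 * A * C - B * B))
               {{>-nonZero 0<D}} (λ ∣D∣≡1 → 4AC-B²≢1 A B C (trans (sym (0≤i⇒+∣i∣≡i (<⇒≤ 0<D))) (cong +_ ∣D∣≡1)))
      ... | p , p-prime , p∣D with separated⊎descent i₀ p-prime (∣ᵤ⇒∣ {+ p} p∣D) 0<D on
      ...   | inj₁ sep = sep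
      ...   | inj₂ (descend {N′ = N′} refl 0<D′ on′ lift) = lift (go (rec ∣N′∣<∣N∣) N′≢0 0<D′ on′)
        where
        N′≢0 : N′ ≢ 0ℤ
        N′≢0 refl = N≢0 refl
        ∣N′∣<∣N∣ : abs N′ ℕ.< abs (N′ * + p)
        ∣N′∣<∣N∣ = subst (abs N′ ℕ.<_) (sym (abs-* N′ (+ p)))
          (ℕ.m<m*n (abs N′) p {{≢-nonZero N′≢0}} (ℕ.nonTrivial⇒n>1 p {{prime⇒nonTrivial p-prime}}))

    onConic⇒separated : ∀ A B C {N} {x y : I → ℤ} → N ≢ 0ℤ →
      0ℤ < + 4 * A * C - B * B → OnConic A B C N x y → Separated x y
    onConic⇒separated A B C {N} = go (<-wellFounded (abs N))

-- The identity cos² + sin² = 1 for the Taylor series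

module Pythagorean where

  open import Data.Nat.Base as ℕ using (ℕ; zero; suc)
  import Data.Nat.Properties as ℕ
  open import Data.Product.Base using (∃-syntax; _,_; proj₁; proj₂)
  open import Data.Rational.Base hiding (_≃_)
  open import Data.Rational.Properties
  open import Data.Rational.Solver using (module +-*-Solver)
  open import Function.Base using (_∘_)
  open import Relation.Binary.PropositionalEquality

  open +-*-Solver using (solve; _:+_; _:*_; _:-_; :-_; _:=_; con)

  -- The coefficient Σ f i * g (k - i) of a product of power series. Recursion through `f ∘ suc`
  -- keeps subtraction out of the indices.
  cauchyProduct : (f g : ℕ → ℚ) → ℕ → ℚ
  cauchyProduct f g zero    = f 0 * g 0
  cauchyProduct f g (suc k) = f 0 * g (suc k) + cauchyProduct (f ∘ suc) g k

  cauchyProduct-last : ∀ f g k → cauchyProduct f g (suc k) ≡ cauchyProduct f (g ∘ suc) k + f (suc k) * g 0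
  cauchyProduct-last f g zero    = refl
  cauchyProduct-last f g (suc k) = trans
    (cong (λ z → f 0 * g (suc (suc k)) + z) (cauchyProduct-last (f ∘ suc) g k))
    (sym (+-assoc (f 0 * g (suc (suc k))) (cauchyProduct (f ∘ suc) (g ∘ suc) k) (f (suc (suc k)) * g 0)))

  cauchyProduct-cong : ∀ {f f′ g g′} → (∀ i → f i ≡ f′ i) → (∀ i → g i ≡ g′ i) → ∀ k →
    cauchyProduct f g k ≡ cauchyProduct f′ g′ k
  cauchyProduct-cong f≗ g≗ zero    = cong₂ _*_ (f≗ 0) (g≗ 0)
  cauchyProduct-cong f≗ g≗ (suc k) = cong₂ _+_ (cong₂ _*_ (f≗ 0) (g≗ (suc k))) (cauchyProduct-cong (f≗ ∘ suc) g≗ k)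

  cauchyProduct-scale : ∀ a b f g k → cauchyProduct (λ i → a * f i) (λ i → b * g i) k ≡ (a * b) * cauchyProduct f g k
  cauchyProduct-scale a b f g zero    =
    solve 4 (λ a b f g → (a :* f) :* (b :* g) := (a :* b) :* (f :* g)) refl a b (f 0) (g 0)
  cauchyProduct-scale a b f g (suc k) = trans
    (cong (λ z → (a * f 0) * (b * g (suc k)) + z) (cauchyProduct-scale a b (f ∘ suc) g k))
    (solve 5 (λ a b f g h → (a :* f) :* (b :* g) :+ (a :* b) :* h := (a :* b) :* (f :* g :+ h)) refl
      a b (f 0) (g (suc k)) (cauchyProduct (f ∘ suc) g k))

  -- The shift a makes the induction on k go through, which moves f to f ∘ suc.
  cauchyProduct-weight : ∀ a f g k → (a + fromℕ k) * cauchyProduct f g k ≡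
    cauchyProduct (λ i → (a + fromℕ i) * f i) g k + cauchyProduct f (λ i → fromℕ i * g i) k
  cauchyProduct-weight a f g zero rewrite fromℕ-0 =
    solve 3 (λ a f g → (a :+ con 0ℚ) :* (f :* g) := ((a :+ con 0ℚ) :* f) :* g :+ f :* (con 0ℚ :* g)) refl a (f 0) (g 0)
  cauchyProduct-weight a f g (suc k) = begin
    (a + n) * (f 0 * g (suc k) + P)
      ≡⟨ *-distribˡ-+ (a + n) (f 0 * g (suc k)) P ⟩
    (a + n) * (f 0 * g (suc k)) + (a + n) * P
      ≡⟨ cong (λ z → (a + n) * (f 0 * g (suc k)) + z * P) (shift k) ⟩
    (a + n) * (f 0 * g (suc k)) + ((a + 1ℚ) + fromℕ k) * P
      ≡⟨ cong (λ z → (a + n) * (f 0 * g (suc k)) + z) (cauchyProduct-weight (a + 1ℚ) (f ∘ suc) g k) ⟩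
    (a + n) * (f 0 * g (suc k)) + (cauchyProduct (λ i → ((a + 1ℚ) + fromℕ i) * f (suc i)) g k + S)
      ≡⟨ cong (λ z → (a + n) * (f 0 * g (suc k)) + (z + S))
           (cauchyProduct-cong {g = g} (λ i → cong (_* f (suc i)) (sym (shift i))) (λ _ → refl) k) ⟩
    (a + n) * (f 0 * g (suc k)) + (R + S)
      ≡⟨ solve 6 (λ a n f g R S → (a :+ n) :* (f :* g) :+ (R :+ S) := (((a :+ con 0ℚ) :* f) :* g :+ R) :+ (f :* (n :* g) :+ S)) refl
           a n (f 0) (g (suc k)) R S ⟩
    (((a + 0ℚ) * f 0) * g (suc k) + R) + (f 0 * (n * g (suc k)) + S)
      ≡⟨ cong (λ z → (((a + z) * f 0) * g (suc k) + R) + (f 0 * (n * g (suc k)) + S)) (sym fromℕ-0) ⟩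
    (((a + fromℕ 0) * f 0) * g (suc k) + R) + (f 0 * (n * g (suc k)) + S) ∎
    where
    open ≡-Reasoning
    n P R S : ℚ
    n = fromℕ (suc k)
    P = cauchyProduct (f ∘ suc) g k
    R = cauchyProduct (λ i → (a + fromℕ (suc i)) * f (suc i)) g k
    S = cauchyProduct (f ∘ suc) (λ i → fromℕ i * g i) k
    shift : ∀ i → a + fromℕ (suc i) ≡ (a + 1ℚ) + fromℕ i
    shift i = trans (cong (a +_) (fromℕ-suc i)) (sym (+-assoc a 1ℚ (fromℕ i)))

  -- The product rule for power series whose coefficients satisfy (k+1) f (k+1) = f′ k.
  cauchyProduct-derivative : ∀ {f f′ g g′} →
    (∀ k → fromℕ (suc k) * f (suc k) ≡ f′ k) → (∀ k → fromℕ (suc k) * g (suc k) ≡ g′ k) →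
    ∀ k → fromℕ (suc k) * cauchyProduct f g (suc k) ≡ cauchyProduct f′ g k + cauchyProduct f g′ k
  cauchyProduct-derivative {f} {f′} {g} {g′} df dg k = begin
    fromℕ (suc k) * cauchyProduct f g (suc k)
      ≡⟨ cong (_* cauchyProduct f g (suc k)) (sym (+-identityˡ (fromℕ (suc k)))) ⟩
    (0ℚ + fromℕ (suc k)) * cauchyProduct f g (suc k)
      ≡⟨ cauchyProduct-weight 0ℚ f g (suc k) ⟩
    cauchyProduct (λ i → (0ℚ + fromℕ i) * f i) g (suc k) + cauchyProduct f (λ i → fromℕ i * g i) (suc k)
      ≡⟨ cong₂ _+_
           (cauchyProduct-cong {g = g} (λ i → cong (_* f i) (+-identityˡ (fromℕ i))) (λ _ → refl) (suc k))
           (cauchyProduct-last f (λ i → fromℕ i * g i) k) ⟩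
    (fromℕ 0 * f 0 * g (suc k) + cauchyProduct (λ i → fromℕ (suc i) * f (suc i)) g k)
      + (cauchyProduct f (λ i → fromℕ (suc i) * g (suc i)) k + f (suc k) * (fromℕ 0 * g 0))
      ≡⟨ cong₂ (λ A B → (fromℕ 0 * f 0 * g (suc k) + A) + (B + f (suc k) * (fromℕ 0 * g 0)))
           (cauchyProduct-cong {g = g} df (λ _ → refl) k) (cauchyProduct-cong {f} (λ _ → refl) dg k) ⟩
    (fromℕ 0 * f 0 * g (suc k) + A) + (B + f (suc k) * (fromℕ 0 * g 0))
      ≡⟨ cong (λ z → (z * f 0 * g (suc k) + A) + (B + f (suc k) * (z * g 0))) fromℕ-0 ⟩
    (0ℚ * f 0 * g (suc k) + A) + (B + f (suc k) * (0ℚ * g 0))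
      ≡⟨ solve 6 (λ a b c d A B → (con 0ℚ :* a :* b :+ A) :+ (B :+ c :* (con 0ℚ :* d)) := A :+ B) refl
           (f 0) (g (suc k)) (f (suc k)) (g 0) A B ⟩
    A + B ∎
    where
    open ≡-Reasoning
    A B : ℚ
    A = cauchyProduct f′ g k
    B = cauchyProduct f g′ k

  Σ<-head : ∀ n f → Σ< (suc n) f ≡ f 0 + Σ< n (f ∘ suc)
  Σ<-head zero    f = trans (+-identityˡ (f 0)) (sym (+-identityʳ (f 0)))
  Σ<-head (suc n) f = trans (cong (_+ f (suc n)) (Σ<-head n f)) (+-assoc (f 0) (Σ< n (f ∘ suc)) (f (suc n)))

  Σ<-*ˡ : ∀ n a f → Σ< n (λ i → a * f i) ≡ a * Σ< n f
  Σ<-*ˡ zero    a f = sym (*-zeroʳ a)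
  Σ<-*ˡ (suc n) a f = trans (cong (_+ a * f n) (Σ<-*ˡ n a f)) (sym (*-distribˡ-+ a (Σ< n f) (f n)))

  Σ<-+ : ∀ n f g → Σ< n (λ i → f i + g i) ≡ Σ< n f + Σ< n g
  Σ<-+ zero    f g = refl
  Σ<-+ (suc n) f g = trans (cong (_+ (f n + g n)) (Σ<-+ n f g))
    (solve 4 (λ a b c d → (a :+ b) :+ (c :+ d) := (a :+ c) :+ (b :+ d)) refl (Σ< n f) (Σ< n g) (f n) (g n))

  -- Σ_{i < n} f i * (t - Σ_{j < n - i} g j)
  defect : (f g : ℕ → ℚ) → ℚ → ℕ → ℚ
  defect f g t zero    = 0ℚ
  defect f g t (suc n) = f 0 * (t - Σ< (suc n) g) + defect (f ∘ suc) g t n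

  -- The first n coefficients of the product sum f i * g j over the triangle i + j < n. Grouped by
  -- i, the inner sums are partial sums of g of length n - i.
  defect-spec : ∀ f g t n → Σ< n f * t - Σ< n (cauchyProduct f g) ≡ defect f g t n
  defect-spec f g t zero    = solve 1 (λ t → con 0ℚ :* t :- con 0ℚ := con 0ℚ) refl t
  defect-spec f g t (suc n) = begin
    Σ< (suc n) f * t - Σ< (suc n) (cauchyProduct f g)
      ≡⟨ cong₂ (λ a b → a * t - b) (Σ<-head n f) (begin
           Σ< (suc n) (cauchyProduct f g)
             ≡⟨ Σ<-head n (cauchyProduct f g) ⟩
           f 0 * g 0 + Σ< n (λ k → f 0 * g (suc k) + cauchyProduct (f ∘ suc) g k)
             ≡⟨ cong (f 0 * g 0 +_) (Σ<-+ n (λ k → f 0 * g (suc k)) (cauchyProduct (f ∘ suc) g)) ⟩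
           f 0 * g 0 + (Σ< n (λ k → f 0 * g (suc k)) + P)
             ≡⟨ cong (λ z → f 0 * g 0 + (z + P)) (Σ<-*ˡ n (f 0) (g ∘ suc)) ⟩
           f 0 * g 0 + (f 0 * Σ< n (g ∘ suc) + P)
             ≡⟨ solve 4 (λ a b c P → a :* b :+ (a :* c :+ P) := a :* (b :+ c) :+ P) refl (f 0) (g 0) (Σ< n (g ∘ suc)) P ⟩
           f 0 * (g 0 + Σ< n (g ∘ suc)) + P
             ≡⟨ cong (λ z → f 0 * z + P) (sym (Σ<-head n g)) ⟩
           f 0 * Σ< (suc n) g + P ∎) ⟩
    (f 0 + F) * t - (f 0 * Σ< (suc n) g + P)
      ≡⟨ solve 5 (λ f F t G P → (f :+ F) :* t :- (f :* G :+ P) := f :* (t :- G) :+ (F :* t :- P)) refl (f 0) F t (Σ< (suc n) g) P ⟩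
    f 0 * (t - Σ< (suc n) g) + (F * t - P)
      ≡⟨ cong (f 0 * (t - Σ< (suc n) g) +_) (defect-spec (f ∘ suc) g t n) ⟩
    f 0 * (t - Σ< (suc n) g) + defect (f ∘ suc) g t n ∎
    where
    open ≡-Reasoning
    F P : ℚ
    F = Σ< n (f ∘ suc)
    P = Σ< n (cauchyProduct (f ∘ suc) g)

  module _ (g : ℕ → ℚ) (t : ℚ) where

    open ≤-Reasoning

    private
      head-bound : ∀ (f M : ℕ → ℚ) n {β} → (∀ i → ∣ f i ∣ ≤ M i) → ∣ t - Σ< (suc n) g ∣ ≤ β →
        ∣ defect f g t (suc n) ∣ ≤ β * M 0 + ∣ defect (f ∘ suc) g t n ∣
      head-bound f M n {β} f≤M t-S≤β = begin
        ∣ f 0 * (t - Σ< (suc n) g) + D ∣        ≤⟨ ∣p+q∣≤∣p∣+∣q∣ (f 0 * (t - Σ< (suc n) g)) D ⟩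
        ∣ f 0 * (t - Σ< (suc n) g) ∣ + ∣ D ∣    ≡⟨ cong (_+ ∣ D ∣) (∣p*q∣≡∣p∣*∣q∣ (f 0) (t - Σ< (suc n) g)) ⟩
        ∣ f 0 ∣ * ∣ t - Σ< (suc n) g ∣ + ∣ D ∣  ≤⟨ +-monoˡ-≤ ∣ D ∣ (*-mono-≤-≤ (0≤∣p∣ (t - Σ< (suc n) g)) (≤-trans (0≤∣p∣ (f 0)) (f≤M 0)) (f≤M 0) t-S≤β) ⟩
        M 0 * β + ∣ D ∣                         ≡⟨ cong (_+ ∣ D ∣) (*-comm (M 0) β) ⟩
        β * M 0 + ∣ D ∣                         ∎
        where D = defect (f ∘ suc) g t n

    defect-bound : ∀ f (M : ℕ → ℚ) n {β} → (∀ i → ∣ f i ∣ ≤ M i) → (∀ j → j ℕ.≤ n → ∣ t - Σ< j g ∣ ≤ β) →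
      ∣ defect f g t n ∣ ≤ β * Σ< n M
    defect-bound f M zero    {β} f≤M h = ≤-reflexive (sym (*-zeroʳ β))
    defect-bound f M (suc n) {β} f≤M h = begin
      ∣ defect f g t (suc n) ∣                     ≤⟨ head-bound f M n f≤M (h (suc n) ℕ.≤-refl) ⟩
      β * M 0 + ∣ defect (f ∘ suc) g t n ∣         ≤⟨ +-monoʳ-≤ (β * M 0) (defect-bound (f ∘ suc) (M ∘ suc) n (f≤M ∘ suc) (λ j j≤n → h j (ℕ.m≤n⇒m≤1+n j≤n))) ⟩
      β * M 0 + β * Σ< n (M ∘ suc)                 ≡⟨ sym (*-distribˡ-+ β (M 0) (Σ< n (M ∘ suc))) ⟩
      β * (M 0 + Σ< n (M ∘ suc))                   ≡⟨ cong (β *_) (sym (Σ<-head n M)) ⟩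
      β * Σ< (suc n) M                             ∎

    -- With n = k + L, the indices i < k leave partial sums of g of length above L, which are within
    -- δ of t. The last L indices only have the crude bound β, but their weight is a tail of the
    -- series M.
    defect-bound-split : ∀ f (M : ℕ → ℚ) k L {β δ} → (∀ i → ∣ f i ∣ ≤ M i) →
      (∀ j → j ℕ.≤ L → ∣ t - Σ< j g ∣ ≤ β) → (∀ j → L ℕ.≤ j → j ℕ.≤ k ℕ.+ L → ∣ t - Σ< j g ∣ ≤ δ) →
      ∣ defect f g t (k ℕ.+ L) ∣ ≤ δ * Σ< k M + β * (Σ< (k ℕ.+ L) M - Σ< k M)
    defect-bound-split f M zero L {β} {δ} f≤M hβ hδ = ≤-trans (defect-bound f M L f≤M hβ) (≤-reflexive
      (solve 3 (λ β δ S → β :* S := δ :* con 0ℚ :+ β :* (S :- con 0ℚ)) refl β δ (Σ< L M)))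
    defect-bound-split f M (suc k) L {β} {δ} f≤M hβ hδ = begin
      ∣ defect f g t (suc k ℕ.+ L) ∣
        ≤⟨ head-bound f M (k ℕ.+ L) f≤M (hδ (suc k ℕ.+ L) (ℕ.m≤n+m L (suc k)) ℕ.≤-refl) ⟩
      δ * M 0 + ∣ defect (f ∘ suc) g t (k ℕ.+ L) ∣
        ≤⟨ +-monoʳ-≤ (δ * M 0) (defect-bound-split (f ∘ suc) (M ∘ suc) k L (f≤M ∘ suc) hβ
             (λ j L≤j j≤ → hδ j L≤j (ℕ.m≤n⇒m≤1+n j≤))) ⟩
      δ * M 0 + (δ * A + β * (B - A))
        ≡⟨ solve 5 (λ δ β m A B → δ :* m :+ (δ :* A :+ β :* (B :- A)) := δ :* (m :+ A) :+ β :* ((m :+ B) :- (m :+ A))) refl δ β (M 0) A B ⟩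
      δ * (M 0 + A) + β * ((M 0 + B) - (M 0 + A))
        ≡⟨ cong₂ (λ a b → δ * a + β * (b - a)) (sym (Σ<-head k M)) (sym (Σ<-head (k ℕ.+ L) M)) ⟩
      δ * Σ< (suc k) M + β * (Σ< (suc k ℕ.+ L) M - Σ< (suc k) M) ∎
      where
      A = Σ< k (M ∘ suc)
      B = Σ< (k ℕ.+ L) (M ∘ suc)

  0≤Σ< : ∀ {f} → (∀ k → 0ℚ ≤ f k) → ∀ n → 0ℚ ≤ Σ< n f
  0≤Σ< 0≤f zero    = ≤-refl
  0≤Σ< 0≤f (suc n) = +-mono-≤ (0≤Σ< 0≤f n) (0≤f n)

  p-q≤p : ∀ {p q} → 0ℚ ≤ q → p - q ≤ p
  p-q≤p {p} 0≤q = p≤q+r⇒p-q≤r (subst (p ≤_) (+-comm p _) (p≤p+q 0≤q))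

  -- The threshold N depends on the majorant M alone and not on f and g, so that it holds for all
  -- arguments of the Taylor polynomials in a bounded range at once.
  mertens : ∀ M → (∀ k → 0ℚ ≤ M k) → IsCauchy (λ n → Σ< n M) → ∀ ε → 0ℚ < ε →
    ∃[ N ] ∀ f g → (∀ k → ∣ f k ∣ ≤ M k) → (∀ k → ∣ g k ∣ ≤ M k) → ∀ n → N ℕ.≤ n →
    ∣ Σ< n f * Σ< n g - Σ< n (cauchyProduct f g) ∣ ≤ ε
  mertens M 0≤M cM ε 0<ε with bounded⁺ (λ n → Σ< n M) cM
  ... | B , 0<B , N , Σ≤B with divide (0<½* 0<ε) 0<B
  ... | δ , 0<δ , δB with cM δ 0<δ
  -- For n ≥ 2L the cut k = n - L is itself at least L, so the tail of M beyond k is below δ as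
  -- well. Both parts of the split then contribute at most δ B = ε / 2.
  ... | L , close = N ℕ.⊔ (L ℕ.+ L) , bound
    where
    open ≤-Reasoning
    bound : ∀ f g → (∀ k → ∣ f k ∣ ≤ M k) → (∀ k → ∣ g k ∣ ≤ M k) → ∀ n → N ℕ.⊔ (L ℕ.+ L) ℕ.≤ n →
      ∣ Σ< n f * Σ< n g - Σ< n (cauchyProduct f g) ∣ ≤ ε
    bound f g f≤M g≤M n N≤n = begin
      ∣ Σ< n f * Σ< n g - Σ< n (cauchyProduct f g) ∣   ≡⟨ cong ∣_∣ (defect-spec f g (Σ< n g) n) ⟩
      ∣ defect f g (Σ< n g) n ∣                        ≡⟨ cong (λ n → ∣ defect f g t n ∣) (sym k+L≡n) ⟩
      ∣ defect f g t (k ℕ.+ L) ∣                       ≤⟨ defect-bound-split g t f M k L f≤M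
                                                            (λ j j≤L → tailB j (ℕ.≤-trans j≤L L≤n))
                                                            (λ j L≤j j≤ → tailδ j L≤j (subst (j ℕ.≤_) k+L≡n j≤)) ⟩
      δ * Σ< k M + B * (Σ< (k ℕ.+ L) M - Σ< k M)       ≡⟨ cong (λ n → δ * Σ< k M + B * (Σ< n M - Σ< k M)) k+L≡n ⟩
      δ * Σ< k M + B * (Σ< n M - Σ< k M)               ≤⟨ +-mono-≤ (*-mono-≤ʳ (<⇒≤ 0<δ) Σk≤B) (*-mono-≤ʳ (<⇒≤ 0<B) (tailM k L≤k)) ⟩
      δ * B + B * δ                                    ≡⟨ cong (δ * B +_) (*-comm B δ) ⟩
      δ * B + δ * B                                    ≡⟨ cong₂ _+_ δB δB ⟩
      ε * ½ + ε * ½                                    ≡⟨ halves ε ⟩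
      ε                                                ∎
      where
      k : ℕ
      k = n ℕ.∸ L
      t : ℚ
      t = Σ< n g
      2L≤n : L ℕ.+ L ℕ.≤ n
      2L≤n = ≤⊔ʳ {N} {L ℕ.+ L} N≤n
      L≤n : L ℕ.≤ n
      L≤n = ℕ.≤-trans (ℕ.m≤m+n L L) 2L≤n
      k+L≡n : k ℕ.+ L ≡ n
      k+L≡n = ℕ.m∸n+n≡m L≤n
      L≤k : L ℕ.≤ k
      L≤k = subst (ℕ._≤ k) (ℕ.m+n∸n≡m L L) (ℕ.∸-monoˡ-≤ L 2L≤n)
      Σn≤B : Σ< n M ≤ B
      Σn≤B = ≤-trans (p≤∣p∣ (Σ< n M)) (Σ≤B n (≤⊔ˡ {N} {L ℕ.+ L} N≤n))
      tailM : ∀ j → L ℕ.≤ j → Σ< n M - Σ< j M ≤ δ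
      tailM j L≤j = ≤-trans (p≤∣p∣ (Σ< n M - Σ< j M)) (<⇒≤ (close n j L≤n L≤j))
      tailδ : ∀ j → L ℕ.≤ j → j ℕ.≤ n → ∣ t - Σ< j g ∣ ≤ δ
      tailδ j L≤j j≤n = ≤-trans (Σ-tail g M g≤M (ℕ.≤⇒≤′ j≤n)) (tailM j L≤j)
      tailB : ∀ j → j ℕ.≤ n → ∣ t - Σ< j g ∣ ≤ B
      tailB j j≤n = ≤-trans (Σ-tail g M g≤M (ℕ.≤⇒≤′ j≤n)) (≤-trans (p-q≤p (0≤Σ< 0≤M j)) Σn≤B)
      Σk≤B : Σ< k M ≤ B
      Σk≤B = ≤-trans (subst (_≤ Σ< n M) (solve 2 (λ a b → a :- (a :- b) := b) refl (Σ< n M) (Σ< k M))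
        (p-q≤p (≤-trans (0≤∣p∣ (Σ< n M - Σ< k M))
          (Σ-tail M M (λ i → ≤-reflexive (0≤p⇒∣p∣≡p (0≤M i))) (ℕ.≤⇒≤′ (ℕ.m∸n≤m n L)))))) Σn≤B

  cosCoeff-suc : ∀ k → cosCoeff (suc k) ≡ - sinCoeff k
  cosCoeff-suc 0             = refl
  cosCoeff-suc 1             = refl
  cosCoeff-suc (suc (suc k)) = cong -_ (cosCoeff-suc k)

  sinCoeff-suc : ∀ k → sinCoeff (suc k) ≡ cosCoeff k
  sinCoeff-suc 0             = refl
  sinCoeff-suc 1             = refl
  sinCoeff-suc (suc (suc k)) = cong -_ (sinCoeff-suc k)

  module _ (q : ℚ) where

    -- The coefficients of cos(q t) and sin(q t) as power series in t. Differentiation in t brings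
    -- out the factors -q and q.
    cosTerm sinTerm : ℕ → ℚ
    cosTerm k = cosCoeff k * expTerm q k
    sinTerm k = sinCoeff k * expTerm q k

    private
      expTerm-suc : ∀ a k → fromℕ (suc k) * (a * expTerm q (suc k)) ≡ q * (a * expTerm q k)
      expTerm-suc a k = begin
        fromℕ (suc k) * (a * ((expTerm q k * q) * r))
          ≡⟨ solve 5 (λ n a e q r → n :* (a :* ((e :* q) :* r)) := (q :* (a :* e)) :* (n :* r)) refl
               (fromℕ (suc k)) a (expTerm q k) q r ⟩
        (q * (a * expTerm q k)) * (fromℕ (suc k) * r)
          ≡⟨ cong ((q * (a * expTerm q k)) *_) (ExpBound.r-inverse 0 k) ⟩
        (q * (a * expTerm q k)) * 1ℚ
          ≡⟨ *-identityʳ (q * (a * expTerm q k)) ⟩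
        q * (a * expTerm q k) ∎
        where
        open ≡-Reasoning
        r : ℚ
        r = ExpBound.r 0 k

    cosTerm-derivative : ∀ k → fromℕ (suc k) * cosTerm (suc k) ≡ - q * sinTerm k
    cosTerm-derivative k = trans (expTerm-suc (cosCoeff (suc k)) k)
      (trans (cong (λ z → q * (z * expTerm q k)) (cosCoeff-suc k))
        (solve 3 (λ q s e → q :* ((:- s) :* e) := (:- q) :* (s :* e)) refl q (sinCoeff k) (expTerm q k)))

    sinTerm-derivative : ∀ k → fromℕ (suc k) * sinTerm (suc k) ≡ q * cosTerm k
    sinTerm-derivative k = trans (expTerm-suc (sinCoeff (suc k)) k)
      (cong (λ z → q * (z * expTerm q k)) (sinCoeff-suc k))

    private
      scaleˡ : ∀ a f g k → cauchyProduct (λ i → a * f i) g k ≡ a * cauchyProduct f g k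
      scaleˡ a f g k = trans (cauchyProduct-cong {λ i → a * f i} (λ _ → refl) (λ i → sym (*-identityˡ (g i))) k)
        (trans (cauchyProduct-scale a 1ℚ f g k) (cong (_* cauchyProduct f g k) (*-identityʳ a)))

      scaleʳ : ∀ a f g k → cauchyProduct f (λ i → a * g i) k ≡ a * cauchyProduct f g k
      scaleʳ a f g k = trans (cauchyProduct-cong {g = λ i → a * g i} (λ i → sym (*-identityˡ (f i))) (λ _ → refl) k)
        (trans (cauchyProduct-scale 1ℚ a f g k) (cong (_* cauchyProduct f g k) (*-identityˡ a)))

    pythagorasTerm : ℕ → ℚ
    pythagorasTerm k = cauchyProduct cosTerm cosTerm k + cauchyProduct sinTerm sinTerm k

    -- Times k + 1 this is a coefficient of the derivative of cos²(q t) + sin²(q t), where the terms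
    -- ± q sin cos cancel.
    pythagorasTerm-suc : ∀ k → pythagorasTerm (suc k) ≡ 0ℚ
    pythagorasTerm-suc k = *-cancelˡ-/ (begin
      n * pythagorasTerm (suc k)
        ≡⟨ *-distribˡ-+ n (cauchyProduct cosTerm cosTerm (suc k)) (cauchyProduct sinTerm sinTerm (suc k)) ⟩
      n * cauchyProduct cosTerm cosTerm (suc k) + n * cauchyProduct sinTerm sinTerm (suc k)
        ≡⟨ cong₂ _+_ (cauchyProduct-derivative cosTerm-derivative cosTerm-derivative k)
                     (cauchyProduct-derivative sinTerm-derivative sinTerm-derivative k) ⟩
      (cauchyProduct (λ i → - q * sinTerm i) cosTerm k + cauchyProduct cosTerm (λ i → - q * sinTerm i) k)
        + (cauchyProduct (λ i → q * cosTerm i) sinTerm k + cauchyProduct sinTerm (λ i → q * cosTerm i) k)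
        ≡⟨ cong₂ _+_ (cong₂ _+_ (scaleˡ (- q) sinTerm cosTerm k) (scaleʳ (- q) cosTerm sinTerm k))
                     (cong₂ _+_ (scaleˡ q cosTerm sinTerm k) (scaleʳ q sinTerm cosTerm k)) ⟩
      (- q * SC + - q * CS) + (q * CS + q * SC)
        ≡⟨ solve 3 (λ q a b → ((:- q) :* a :+ (:- q) :* b) :+ (q :* b :+ q :* a) := con 0ℚ) refl q SC CS ⟩
      0ℚ ∎)
      where
      open ≡-Reasoning
      n SC CS : ℚ
      n = fromℕ (suc k)
      SC = cauchyProduct sinTerm cosTerm k
      CS = cauchyProduct cosTerm sinTerm k
      *-cancelˡ-/ : ∀ {z} → n * z ≡ 0ℚ → z ≡ 0ℚ
      *-cancelˡ-/ {z} nz≡0 = begin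
        z                     ≡⟨ sym (*-identityˡ z) ⟩
        1ℚ * z                ≡⟨ cong (_* z) (sym (ExpBound.r-inverse 0 k)) ⟩
        (n * r) * z           ≡⟨ solve 3 (λ n r z → (n :* r) :* z := r :* (n :* z)) refl n r z ⟩
        r * (n * z)           ≡⟨ cong (r *_) nz≡0 ⟩
        r * 0ℚ                ≡⟨ *-zeroʳ r ⟩
        0ℚ                    ∎
        where
        r : ℚ
        r = ExpBound.r 0 k

    Σ-pythagorasTerm : ∀ n → Σ< (suc n) pythagorasTerm ≡ 1ℚ
    Σ-pythagorasTerm zero    = refl
    Σ-pythagorasTerm (suc n) = trans
      (cong₂ _+_ (Σ-pythagorasTerm n) (pythagorasTerm-suc n)) (+-identityʳ 1ℚ)

  -- Uniformity in q is needed because the n-th term of `cos θ` evaluates its polynomial at the n-th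
  -- approximation of θ. With at least one term the product coefficients sum to exactly 1, so only
  -- the two errors of `mertens` remain.
  pythagoras : ∀ b {η} → 0ℚ < η →
    ∃[ N ] ∀ q n → ∣ q ∣ ≤ fromℕ b → N ℕ.≤ n →
    ∣ (taylor cosCoeff (suc n) q * taylor cosCoeff (suc n) q + taylor sinCoeff (suc n) q * taylor sinCoeff (suc n) q) - 1ℚ ∣ ≤ η + η
  pythagoras b {η} 0<η = N , close
    where
    open ≤-Reasoning
    open ExpBound b using (M; 0≤M; S-cauchy; taylorTerm≤M)
    product-bound = mertens M 0≤M S-cauchy η 0<η
    N : ℕ
    N = proj₁ product-bound
    close : ∀ q n → ∣ q ∣ ≤ fromℕ b → N ℕ.≤ n →
      ∣ (taylor cosCoeff (suc n) q * taylor cosCoeff (suc n) q + taylor sinCoeff (suc n) q * taylor sinCoeff (suc n) q) - 1ℚ ∣ ≤ η + η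
    close q n q≤b N≤n = begin
      ∣ (Σ< m (cosTerm q) * Σ< m (cosTerm q) + Σ< m (sinTerm q) * Σ< m (sinTerm q)) - 1ℚ ∣
        ≡⟨ cong (λ z → ∣ (Σ< m (cosTerm q) * Σ< m (cosTerm q) + Σ< m (sinTerm q) * Σ< m (sinTerm q)) - z ∣)
             (sym (trans (sym (Σ<-+ m CC SS)) (Σ-pythagorasTerm q n))) ⟩
      ∣ (Σ< m (cosTerm q) * Σ< m (cosTerm q) + Σ< m (sinTerm q) * Σ< m (sinTerm q)) - (Σ< m CC + Σ< m SS) ∣
        ≤⟨ regroup (Σ< m (cosTerm q) * Σ< m (cosTerm q)) (Σ< m (sinTerm q) * Σ< m (sinTerm q)) (Σ< m CC) (Σ< m SS) ⟩
      ∣ Σ< m (cosTerm q) * Σ< m (cosTerm q) - Σ< m CC ∣ + ∣ Σ< m (sinTerm q) * Σ< m (sinTerm q) - Σ< m SS ∣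
        ≤⟨ +-mono-≤ (proj₂ product-bound (cosTerm q) (cosTerm q) cos≤ cos≤ m N≤m)
                    (proj₂ product-bound (sinTerm q) (sinTerm q) sin≤ sin≤ m N≤m) ⟩
      η + η ∎
      where
      m : ℕ
      m = suc n
      CC SS : ℕ → ℚ
      CC = cauchyProduct (cosTerm q) (cosTerm q)
      SS = cauchyProduct (sinTerm q) (sinTerm q)
      N≤m : N ℕ.≤ m
      N≤m = ℕ.m≤n⇒m≤1+n N≤n
      cos≤ : ∀ k → ∣ cosTerm q k ∣ ≤ M k
      cos≤ = taylorTerm≤M cosCoeff ∣cosCoeff∣≤1 q≤b
      sin≤ : ∀ k → ∣ sinTerm q k ∣ ≤ M k
      sin≤ = taylorTerm≤M sinCoeff ∣sinCoeff∣≤1 q≤b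
      regroup : ∀ x y z w → ∣ (x + y) - (z + w) ∣ ≤ ∣ x - z ∣ + ∣ y - w ∣
      regroup x y z w = subst (λ v → ∣ v ∣ ≤ ∣ x - z ∣ + ∣ y - w ∣)
        (solve 4 (λ a b c d → (a :- c) :+ (b :- d) := (a :+ b) :- (c :+ d)) refl x y z w)
        (∣p+q∣≤∣p∣+∣q∣ (x - z) (y - w))

  ½ε<ε : ∀ {ε} → 0ℚ < ε → ε * ½ < ε
  ½ε<ε {ε} 0<ε = subst₂ _<_ (+-identityˡ (ε * ½)) (halves ε) (+-monoˡ-< (ε * ½) (0<½* 0<ε))

  cos²+sin²≃1 : ∀ θ → cos θ *ʳ cos θ +ʳ sin θ *ʳ sin θ ≃ fromℚ 1ℚ
  cos²+sin²≃1 θ ε 0<ε = suc (K ℕ.⊔ N) , close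
    where
    η : ℚ
    η = ε * ½ * ½
    θ-bounded = bounded (seq θ) (cauchy θ)
    b K N : ℕ
    b = proj₁ θ-bounded
    K = proj₁ (proj₂ θ-bounded)
    approximate = pythagoras b {η} (0<½* (0<½* 0<ε))
    N = proj₁ approximate
    close : ∀ n → suc (K ℕ.⊔ N) ℕ.≤ n →
      ∣ (taylor cosCoeff n (seq θ n) * taylor cosCoeff n (seq θ n) + taylor sinCoeff n (seq θ n) * taylor sinCoeff n (seq θ n)) - 1ℚ ∣ < ε
    close (suc n) (ℕ.s≤s KN≤n) = ≤-<-trans
      (proj₂ approximate (seq θ (suc n)) n
        (proj₂ (proj₂ θ-bounded) (suc n) (ℕ.m≤n⇒m≤1+n (≤⊔ˡ {K} {N} KN≤n))) (≤⊔ʳ {K} {N} KN≤n))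
      (subst (_< ε) (sym (halves (ε * ½))) (½ε<ε 0<ε))

-- From a real ellipse through integral pairs to an integral conic

module Ellipses where

  open BinaryForms using (Separated; onConic; onConic⇒separated; separated-linear)
  open import Data.Fin.Base using (Fin; zero)
  open import Data.Fin.Properties using (any?)
  open import Data.Integer.Base as ℤ using (ℤ; 0ℤ) renaming (+_ to pos)
  import Data.Integer.Properties as ℤ
  open import Data.Integer.Solver using () renaming (module +-*-Solver to ℤ-Solver)
  open import Data.Nat.Base as ℕ using (ℕ; suc)
  import Data.Nat.Properties as ℕ
  open import Data.Product.Base using (∃-syntax; _,_)
  open import Data.Rational.Base hiding (_≃_; pos)
  open import Data.Rational.Properties
  open import Data.Rational.Solver using (module +-*-Solver)
  import Data.Rational.Unnormalised.Base as ℚᵘ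
  import Data.Rational.Unnormalised.Properties as ℚᵘ
  open import Data.Sum.Base using (_⊎_; inj₁; inj₂)
  open import Function.Base using (_∘_)
  open import Relation.Binary.PropositionalEquality
  open import Relation.Nullary using (¬_; yes; no; ¬?)
  open import Relation.Nullary.Decidable using (decidable-stable)

  open +-*-Solver using (solve; _:+_; _:*_; _:-_; :-_; _:=_; con)

  -- Opaque for the same reason as fromℕ.
  opaque
    ι : ℤ → ℚ
    ι = fromℤ

    ι≡fromℤ : ∀ i → ι i ≡ fromℤ i
    ι≡fromℤ i = refl

    ι-+ : ∀ i j → ι (i ℤ.+ j) ≡ ι i + ι j
    ι-+ = fromℤ-+

    ι-neg : ∀ i → ι (ℤ.- i) ≡ - ι i
    ι-neg = fromℤ-neg

    ι-* : ∀ i j → ι (i ℤ.* j) ≡ ι i * ι j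
    ι-* i j = toℚᵘ-injective (begin-equality
      toℚᵘ (fromℤ (i ℤ.* j))              ≃⟨ toℚᵘ-fromℤ (i ℤ.* j) ⟩
      ℚᵘ.mkℚᵘ i 0 ℚᵘ.* ℚᵘ.mkℚᵘ j 0        ≃⟨ ℚᵘ.*-cong (ℚᵘ.≃-sym (toℚᵘ-fromℤ i)) (ℚᵘ.≃-sym (toℚᵘ-fromℤ j)) ⟩
      toℚᵘ (fromℤ i) ℚᵘ.* toℚᵘ (fromℤ j)  ≃⟨ ℚᵘ.≃-sym (toℚᵘ-homo-* (fromℤ i) (fromℤ j)) ⟩
      toℚᵘ (fromℤ i * fromℤ j)            ∎)
      where open ℚᵘ.≤-Reasoning

    ι-mono-≤ : ∀ {i j} → i ℤ.≤ j → ι i ≤ ι j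
    ι-mono-≤ = fromℤ-mono-≤

    ι-0 : ι 0ℤ ≡ 0ℚ
    ι-0 = refl

    ι-1 : ι ℤ.1ℤ ≡ 1ℚ
    ι-1 = refl

    ι-3 : ι (pos 3) ≡ 1ℚ + 1ℚ + 1ℚ
    ι-3 = refl

    ι-4 : ι (pos 4) ≡ 1ℚ + 1ℚ + 1ℚ + 1ℚ
    ι-4 = refl

  ι-- : ∀ i j → ι (i ℤ.- j) ≡ ι i - ι j
  ι-- i j = trans (ι-+ i (ℤ.- j)) (cong (ι i +_) (ι-neg j))

  1≤∣ι∣ : ∀ {i} → i ≢ 0ℤ → 1ℚ ≤ ∣ ι i ∣
  1≤∣ι∣ {i} i≢0 = subst (λ z → 1ℚ ≤ ∣ z ∣)
    (trans (cong₂ _-_ (sym (ι≡fromℤ i)) (trans (sym (ι≡fromℤ 0ℤ)) ι-0)) (+-identityʳ (ι i)))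
    (1≤∣fromℤ∣-≢ i≢0)

  -- `x ≃ y` unfolds to `Null` of the difference sequence. Equations between reals are thus derived
  -- by combining null sequences and checking a rational identity at each n.
  Null : (ℕ → ℚ) → Set
  Null f = ∀ ε → 0ℚ < ε → ∃[ N ] ∀ n → N ℕ.≤ n → ∣ f n ∣ < ε

  null-cong : ∀ {f g} → (∀ n → f n ≡ g n) → Null f → Null g
  null-cong f≗g null ε 0<ε with null ε 0<ε
  ... | N , close = N , λ n N≤n → subst (λ z → ∣ z ∣ < ε) (f≗g n) (close n N≤n)

  null-dominated : ∀ {f g} → (∀ n → ∣ g n ∣ ≤ ∣ f n ∣) → Null f → Null g
  null-dominated g≤f null ε 0<ε with null ε 0<ε
  ... | N , close = N , λ n N≤n → ≤-<-trans (g≤f n) (close n N≤n)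

  null-+ : ∀ {f g} → Null f → Null g → Null (λ n → f n + g n)
  null-+ {f} {g} nf ng ε 0<ε with nf (ε * ½) (0<½* 0<ε) | ng (ε * ½) (0<½* 0<ε)
  ... | M , hf | N , hg = M ℕ.⊔ N , λ n n≥ → ≤-<-trans (∣p+q∣≤∣p∣+∣q∣ (f n) (g n))
    (subst (∣ f n ∣ + ∣ g n ∣ <_) (halves ε) (+-mono-< (hf n (≤⊔ˡ {M} {N} n≥)) (hg n (≤⊔ʳ {M} {N} n≥))))

  null-* : ∀ x {f} → Null f → Null (λ n → seq x n * f n)
  null-* x {f} nf ε 0<ε with bounded⁺ (seq x) (cauchy x)
  ... | b , 0<b , M , x≤b with divide 0<ε 0<b
  ... | δ , 0<δ , δb≡ε with nf δ 0<δ
  ... | N , close = M ℕ.⊔ N , λ n n≥ → begin-strict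
      ∣ seq x n * f n ∣       ≡⟨ ∣p*q∣≡∣p∣*∣q∣ (seq x n) (f n) ⟩
      ∣ seq x n ∣ * ∣ f n ∣   ≤⟨ *-mono-≤ˡ (0≤∣p∣ (f n)) (x≤b n (≤⊔ˡ {M} {N} n≥)) ⟩
      b * ∣ f n ∣             ≡⟨ *-comm b ∣ f n ∣ ⟩
      ∣ f n ∣ * b             <⟨ *-mono-<ˡ 0<b (close n (≤⊔ʳ {M} {N} n≥)) ⟩
      δ * b                   ≡⟨ δb≡ε ⟩
      ε                       ∎
    where open ≤-Reasoning

  null-scale : ∀ a {f} → Null f → Null (λ n → a * f n)
  null-scale a = null-* (fromℚ a)

  0≤p² : ∀ p → 0ℚ ≤ p * p
  0≤p² p with ≤-total 0ℚ p
  ... | inj₁ 0≤p = 0≤* 0≤p 0≤p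
  ... | inj₂ p≤0 = subst (0ℚ ≤_) (solve 1 (λ p → (:- p) :* (:- p) := p :* p) refl p)
    (0≤* (neg-antimono-≤ p≤0) (neg-antimono-≤ p≤0))

  null-√ : ∀ {f} → Null (λ n → f n * f n) → Null f
  null-√ {f} null ε 0<ε with null (ε * ε) (0<* 0<ε 0<ε)
  ... | N , close = N , λ n N≤n → ≰⇒> λ ε≤∣f∣ → <-irrefl refl (begin-strict
      ε * ε                ≤⟨ *-mono-≤-≤ (<⇒≤ 0<ε) (0≤∣p∣ (f n)) ε≤∣f∣ ε≤∣f∣ ⟩
      ∣ f n ∣ * ∣ f n ∣    ≡⟨ sym (∣p*q∣≡∣p∣*∣q∣ (f n) (f n)) ⟩
      ∣ f n * f n ∣        <⟨ close n N≤n ⟩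
      ε * ε                ∎)
    where open ≤-Reasoning

  form : (W Y V x y : ℚ) → ℚ
  form W Y V x y = W * x * x + Y * x * y + V * y * y

  -- The polarisation Q(z + z′) - Q(z) - Q(z′) of `form`.
  polar : (W Y V x y x′ y′ : ℚ) → ℚ
  polar W Y V x y x′ y′ = (1ℚ + 1ℚ) * W * x * x′ + Y * (x * y′ + y * x′) + (1ℚ + 1ℚ) * V * y * y′

  form-homogeneous : ∀ W Y V d x y → d * d * form W Y V x y ≡ form W Y V (d * x) (d * y)
  form-homogeneous = solve 6 (λ W Y V d x y → d :* d :* (W :* x :* x :+ Y :* x :* y :+ V :* y :* y)
    := W :* (d :* x) :* (d :* x) :+ Y :* (d :* x) :* (d :* y) :+ V :* (d :* y) :* (d :* y)) refl

  form-combination : ∀ W Y V α β x y x′ y′ → form W Y V (α * x + β * x′) (α * y + β * y′) ≡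
    α * α * form W Y V x y + β * β * form W Y V x′ y′ + α * β * polar W Y V x y x′ y′
  form-combination = solve 9 (λ W Y V α β x y x′ y′ →
    W :* (α :* x :+ β :* x′) :* (α :* x :+ β :* x′) :+ Y :* (α :* x :+ β :* x′) :* (α :* y :+ β :* y′) :+ V :* (α :* y :+ β :* y′) :* (α :* y :+ β :* y′)
    := α :* α :* (W :* x :* x :+ Y :* x :* y :+ V :* y :* y) :+ β :* β :* (W :* x′ :* x′ :+ Y :* x′ :* y′ :+ V :* y′ :* y′)
       :+ α :* β :* (con (1ℚ + 1ℚ) :* W :* x :* x′ :+ Y :* (x :* y′ :+ y :* x′) :+ con (1ℚ + 1ℚ) :* V :* y :* y′)) refl

  4ℚ : ℚ
  4ℚ = 1ℚ + 1ℚ + 1ℚ + 1ℚ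

  -- The Gram determinant of two vectors is the discriminant of the form times the square of their
  -- determinant.
  polar² : ∀ W Y V x y x′ y′ → let δ = x * y′ - y * x′ in
    polar W Y V x y x′ y′ * polar W Y V x y x′ y′ ≡
    4ℚ * (form W Y V x y * form W Y V x′ y′) - (4ℚ * W * V - Y * Y) * (δ * δ)
  polar² = solve 7 (λ W Y V x y x′ y′ →
    (con (1ℚ + 1ℚ) :* W :* x :* x′ :+ Y :* (x :* y′ :+ y :* x′) :+ con (1ℚ + 1ℚ) :* V :* y :* y′)
    :* (con (1ℚ + 1ℚ) :* W :* x :* x′ :+ Y :* (x :* y′ :+ y :* x′) :+ con (1ℚ + 1ℚ) :* V :* y :* y′)
    := con 4ℚ :* ((W :* x :* x :+ Y :* x :* y :+ V :* y :* y) :* (W :* x′ :* x′ :+ Y :* x′ :* y′ :+ V :* y′ :* y′))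
       :- (con 4ℚ :* W :* V :- Y :* Y) :* ((x :* y′ :- y :* x′) :* (x :* y′ :- y :* x′))) refl

  ι-*-ι : ∀ {a b c d} → a ℤ.* b ≡ c ℤ.* d → ι a * ι b ≡ ι c * ι d
  ι-*-ι {a} {b} {c} {d} eq = trans (sym (ι-* a b)) (trans (cong ι eq) (ι-* c d))

  ι-combination : ∀ {d z a x b y} → d ℤ.* z ≡ a ℤ.* x ℤ.+ b ℤ.* y → ι d * ι z ≡ ι a * ι x + ι b * ι y
  ι-combination {d} {z} {a} {x} {b} {y} eq = trans (sym (ι-* d z)) (trans (cong ι eq)
    (trans (ι-+ (a ℤ.* x) (b ℤ.* y)) (cong₂ _+_ (ι-* a x) (ι-* b y))))

  infix 9 _²

  _² : ℤ → ℤ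
  i ² = i ℤ.* i

  0≤i² : ∀ i → 0ℤ ℤ.≤ i ²
  0≤i² (pos n)    = subst (0ℤ ℤ.≤_) (ℤ.pos-* n n) (ℤ.+≤+ ℕ.z≤n)
  0≤i² ℤ.-[1+ n ] = ℤ.+≤+ ℕ.z≤n

  0<i² : ∀ {i} → i ≢ 0ℤ → 0ℤ ℤ.< i ²
  0<i² {i} i≢0 = ℤ.≤∧≢⇒< (0≤i² i) λ 0≡i² → i≢0 (i²≡0 (ℤ.i*j≡0⇒i≡0∨j≡0 i (sym 0≡i²)))
    where
    i²≡0 : i ≡ 0ℤ ⊎ i ≡ 0ℤ → i ≡ 0ℤ
    i²≡0 (inj₁ eq) = eq
    i²≡0 (inj₂ eq) = eq

  module _ where

    open ℤ-Solver using () renaming (solve to solveℤ; _:+_ to _⊕_; _:*_ to _⊗_; _:-_ to _⊖_; :-_ to ⊝_; _:=_ to _⊜_; con to conℤ)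

    sum-of-squares : ∀ x y → ℤ.1ℤ ℤ.* x ℤ.* x ℤ.+ 0ℤ ℤ.* x ℤ.* y ℤ.+ ℤ.1ℤ ℤ.* y ℤ.* y ≡ x ² ℤ.+ y ²
    sum-of-squares = solveℤ 2 (λ x y → conℤ ℤ.1ℤ ⊗ x ⊗ x ⊕ conℤ 0ℤ ⊗ x ⊗ y ⊕ conℤ ℤ.1ℤ ⊗ y ⊗ y ⊜ x ⊗ x ⊕ y ⊗ y) refl

    difference-zero : ∀ x y z → x ℤ.- y ℤ.- z ≡ 0ℤ → y ℤ.+ z ≡ x
    difference-zero x y z eq = trans
      (solveℤ 3 (λ x y z → y ⊕ z ⊜ x ⊖ (x ⊖ y ⊖ z)) refl x y z)
      (trans (cong (λ w → x ℤ.- w) eq) (ℤ.+-identityʳ x))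

    cramer₁ : ∀ a₀ b₀ a₁ b₁ a b → (a₀ ℤ.* b₁ ℤ.- b₀ ℤ.* a₁) ℤ.* a ≡
      (a ℤ.* b₁ ℤ.- b ℤ.* a₁) ℤ.* a₀ ℤ.+ (a₀ ℤ.* b ℤ.- b₀ ℤ.* a) ℤ.* a₁
    cramer₁ = solveℤ 6 (λ a₀ b₀ a₁ b₁ a b → (a₀ ⊗ b₁ ⊖ b₀ ⊗ a₁) ⊗ a ⊜ (a ⊗ b₁ ⊖ b ⊗ a₁) ⊗ a₀ ⊕ (a₀ ⊗ b ⊖ b₀ ⊗ a) ⊗ a₁) refl

    cramer₂ : ∀ a₀ b₀ a₁ b₁ a b → (a₀ ℤ.* b₁ ℤ.- b₀ ℤ.* a₁) ℤ.* b ≡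
      (a ℤ.* b₁ ℤ.- b ℤ.* a₁) ℤ.* b₀ ℤ.+ (a₀ ℤ.* b ℤ.- b₀ ℤ.* a) ℤ.* b₁
    cramer₂ = solveℤ 6 (λ a₀ b₀ a₁ b₁ a b → (a₀ ⊗ b₁ ⊖ b₀ ⊗ a₁) ⊗ b ⊜ (a ⊗ b₁ ⊖ b ⊗ a₁) ⊗ b₀ ⊕ (a₀ ⊗ b ⊖ b₀ ⊗ a) ⊗ b₁) refl

    expand₁ : ∀ a b₁ b a₁ → (a ℤ.* b₁ ℤ.- b ℤ.* a₁) ℤ.* ℤ.1ℤ ≡ b₁ ℤ.* a ℤ.+ ℤ.- a₁ ℤ.* b
    expand₁ = solveℤ 4 (λ a b₁ b a₁ → (a ⊗ b₁ ⊖ b ⊗ a₁) ⊗ conℤ ℤ.1ℤ ⊜ b₁ ⊗ a ⊕ (⊝ a₁) ⊗ b) refl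

    expand₂ : ∀ a₀ b b₀ a → (a₀ ℤ.* b ℤ.- b₀ ℤ.* a) ℤ.* ℤ.1ℤ ≡ ℤ.- b₀ ℤ.* a ℤ.+ a₀ ℤ.* b
    expand₂ = solveℤ 4 (λ a₀ b b₀ a → (a₀ ⊗ b ⊖ b₀ ⊗ a) ⊗ conℤ ℤ.1ℤ ⊜ (⊝ b₀) ⊗ a ⊕ a₀ ⊗ b) refl

    rearrange : ∀ κ ρ δ α β → κ ℤ.* (δ ² ℤ.- α ² ℤ.- β ²) ≡ α ℤ.* β ℤ.* ρ →
      κ ℤ.* α ℤ.* α ℤ.+ ρ ℤ.* α ℤ.* β ℤ.+ κ ℤ.* β ℤ.* β ≡ κ ℤ.* δ ²
    rearrange κ ρ δ α β eq = trans
      (solveℤ 5 (λ κ ρ δ α β → κ ⊗ α ⊗ α ⊕ ρ ⊗ α ⊗ β ⊕ κ ⊗ β ⊗ β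
        ⊜ κ ⊗ (δ ⊗ δ) ⊖ (κ ⊗ (δ ⊗ δ ⊖ α ⊗ α ⊖ β ⊗ β) ⊖ α ⊗ β ⊗ ρ)) refl κ ρ δ α β)
      (trans (cong (λ z → κ ℤ.* δ ² ℤ.- (z ℤ.- α ℤ.* β ℤ.* ρ)) eq)
        (solveℤ 2 (λ x y → x ⊖ (y ⊖ y) ⊜ x) refl (κ ℤ.* δ ²) (α ℤ.* β ℤ.* ρ)))

  OnEllipse : (W Y V Δ : ℝ) (a b : ℤ) → Set
  OnEllipse W Y V Δ a b = Null (λ n → form (seq W n) (seq Y n) (seq V n) (ι a) (ι b) - seq Δ n * seq Δ n)

  module _ (W Y V Δ : ℝ)
           (disc : ∀ n → 4ℚ * seq W n * seq V n - seq Y n * seq Y n ≡ 4ℚ * (seq Δ n * seq Δ n))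
           (Δ≢0 : ¬ Null (seq Δ)) where

    private
      T : ℝ
      T = Δ *ʳ Δ

      Q : ℤ → ℤ → ℝ
      Q a b = W *ʳ fromℚ (ι a) *ʳ fromℚ (ι a) +ʳ Y *ʳ fromℚ (ι a) *ʳ fromℚ (ι b) +ʳ V *ʳ fromℚ (ι b) *ʳ fromℚ (ι b)

      P : (a b a′ b′ : ℤ) → ℝ
      P a b a′ b′ = mkℝ (λ n → polar (seq W n) (seq Y n) (seq V n) (ι a) (ι b) (ι a′) (ι b′)) (cauchy
        (fromℚ (1ℚ + 1ℚ) *ʳ W *ʳ fromℚ (ι a) *ʳ fromℚ (ι a′) +ʳ Y *ʳ fromℚ (ι a * ι b′ + ι b * ι a′)
          +ʳ fromℚ (1ℚ + 1ℚ) *ʳ V *ʳ fromℚ (ι b) *ʳ fromℚ (ι b′)))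

    private
      T≢0 : ¬ Null (seq T)
      T≢0 = Δ≢0 ∘ null-√

      -- The passage from reals to integers: a nonzero m has absolute value at least 1, so T m
      -- tending to 0 would force T to do so. Equality of integers is decidable, hence refuting m ≠
      -- 0 is enough.
      vanishes : ∀ m → Null (λ n → seq T n * ι m) → m ≡ 0ℤ
      vanishes m null = decidable-stable (m ℤ.≟ 0ℤ) λ m≢0 → T≢0 (null-dominated (λ n → begin
        ∣ seq T n ∣               ≡⟨ sym (*-identityʳ ∣ seq T n ∣) ⟩
        ∣ seq T n ∣ * 1ℚ          ≤⟨ *-mono-≤ʳ (0≤∣p∣ (seq T n)) (1≤∣ι∣ m≢0) ⟩
        ∣ seq T n ∣ * ∣ ι m ∣     ≡⟨ sym (∣p*q∣≡∣p∣*∣q∣ (seq T n) (ι m)) ⟩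
        ∣ seq T n * ι m ∣         ∎) null)
        where open ≤-Reasoning

    nonzero : ∀ {a b} → OnEllipse W Y V Δ a b → a ≡ 0ℤ → b ≢ 0ℤ
    nonzero on refl refl = T≢0 (null-cong (λ n → trans
      (cong (λ z → - 1ℚ * (form (seq W n) (seq Y n) (seq V n) z z - seq T n)) ι-0)
      (solve 4 (λ W Y V T → con (- 1ℚ) :* ((W :* con 0ℚ :* con 0ℚ :+ Y :* con 0ℚ :* con 0ℚ :+ V :* con 0ℚ :* con 0ℚ) :- T) := T)
        refl (seq W n) (seq Y n) (seq V n) (seq T n)))
      (null-scale (- 1ℚ) on))

    -- By homogeneity e² Q(a , b) = e′² Q(a′ , b′), and both values of Q are T, so T (e′² - e²) = 0.
    -- Parallel pairs on the ellipse therefore agree up to sign.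
    proportional : ∀ {a b a′ b′} e e′ → OnEllipse W Y V Δ a b → OnEllipse W Y V Δ a′ b′ →
      e ℤ.* a ≡ e′ ℤ.* a′ → e ℤ.* b ≡ e′ ℤ.* b′ → e′ ² ≡ e ²
    proportional {a} {b} {a′} {b′} e e′ on on′ eqa eqb = ℤ.i-j≡0⇒i≡j (e′ ²) (e ²)
      (vanishes (e′ ² ℤ.- e ²) (null-cong pointwise
        (null-+ (null-scale (ι e * ι e) on) (null-scale (- (ι e′ * ι e′)) on′))))
      where
      open ≡-Reasoning
      pointwise : ∀ n → ι e * ι e * (seq (Q a b) n - seq T n) + - (ι e′ * ι e′) * (seq (Q a′ b′) n - seq T n)
        ≡ seq T n * ι (e′ ² ℤ.- e ²)
      pointwise n = begin
        ι e * ι e * (q - t) + - (ι e′ * ι e′) * (q′ - t)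
          ≡⟨ solve 5 (λ e f q r t → e :* e :* (q :- t) :+ (:- (f :* f)) :* (r :- t)
               := (e :* e :* q :- f :* f :* r) :+ t :* (f :* f :- e :* e)) refl (ι e) (ι e′) q q′ t ⟩
        (ι e * ι e * q - ι e′ * ι e′ * q′) + t * (ι e′ * ι e′ - ι e * ι e)
          ≡⟨ cong₂ (λ y z → (y - ι e′ * ι e′ * q′) + t * z) same
               (sym (trans (ι-- (e′ ²) (e ²)) (cong₂ _-_ (ι-* e′ e′) (ι-* e e)))) ⟩
        (ι e′ * ι e′ * q′ - ι e′ * ι e′ * q′) + t * ι (e′ ² ℤ.- e ²)
          ≡⟨ solve 2 (λ x y → (x :- x) :+ y := y) refl (ι e′ * ι e′ * q′) (t * ι (e′ ² ℤ.- e ²)) ⟩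
        t * ι (e′ ² ℤ.- e ²) ∎
        where
        q q′ t : ℚ
        q = seq (Q a b) n
        q′ = seq (Q a′ b′) n
        t = seq T n
        same : ι e * ι e * q ≡ ι e′ * ι e′ * q′
        same = begin
          ι e * ι e * form (seq W n) (seq Y n) (seq V n) (ι a) (ι b)
            ≡⟨ form-homogeneous (seq W n) (seq Y n) (seq V n) (ι e) (ι a) (ι b) ⟩
          form (seq W n) (seq Y n) (seq V n) (ι e * ι a) (ι e * ι b)
            ≡⟨ cong₂ (form (seq W n) (seq Y n) (seq V n)) (ι-*-ι {e} eqa) (ι-*-ι {e} eqb) ⟩
          form (seq W n) (seq Y n) (seq V n) (ι e′ * ι a′) (ι e′ * ι b′)
            ≡⟨ sym (form-homogeneous (seq W n) (seq Y n) (seq V n) (ι e′) (ι a′) (ι b′)) ⟩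
          ι e′ * ι e′ * form (seq W n) (seq Y n) (seq V n) (ι a′) (ι b′) ∎

    module _ {a₀ b₀ a₁ b₁} (on₀ : OnEllipse W Y V Δ a₀ b₀) (on₁ : OnEllipse W Y V Δ a₁ b₁) where

      private
        p : ℝ
        p = P a₀ b₀ a₁ b₁

        δ : ℤ
        δ = a₀ ℤ.* b₁ ℤ.- b₀ ℤ.* a₁

      -- Expanding Q at δ (a , b) = α (a₀ , b₀) + β (a₁ , b₁), with Q = T at all three pairs, gives
      -- δ² T = α² T + β² T + α β p. Every further pair thus yields one integral linear relation
      -- between T and the polar value p.
      combination : ∀ {a b} α β → OnEllipse W Y V Δ a b →
        δ ℤ.* a ≡ α ℤ.* a₀ ℤ.+ β ℤ.* a₁ → δ ℤ.* b ≡ α ℤ.* b₀ ℤ.+ β ℤ.* b₁ →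
        Null (λ n → seq T n * ι (δ ² ℤ.- α ² ℤ.- β ²) - ι (α ℤ.* β) * seq p n)
      combination {a} {b} α β on eqa eqb = null-cong pointwise
        (null-+ (null-scale (- (ι δ * ι δ)) on) (null-+ (null-scale (ι α * ι α) on₀) (null-scale (ι β * ι β) on₁)))
        where
        open ≡-Reasoning
        pointwise : ∀ n → - (ι δ * ι δ) * (seq (Q a b) n - seq T n) +
          (ι α * ι α * (seq (Q a₀ b₀) n - seq T n) + ι β * ι β * (seq (Q a₁ b₁) n - seq T n))
          ≡ seq T n * ι (δ ² ℤ.- α ² ℤ.- β ²) - ι (α ℤ.* β) * seq p n
        pointwise n = begin
          - (ι δ * ι δ) * (q - t) + (ι α * ι α * (q₀ - t) + ι β * ι β * (q₁ - t))
            ≡⟨ solve 7 (λ d a b q q₀ q₁ t → (:- (d :* d)) :* (q :- t) :+ (a :* a :* (q₀ :- t) :+ b :* b :* (q₁ :- t))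
                 := (a :* a :* q₀ :+ b :* b :* q₁ :- d :* d :* q) :+ t :* (d :* d :- a :* a :- b :* b)) refl
                 (ι δ) (ι α) (ι β) q q₀ q₁ t ⟩
          (ι α * ι α * q₀ + ι β * ι β * q₁ - ι δ * ι δ * q) + t * (ι δ * ι δ - ι α * ι α - ι β * ι β)
            ≡⟨ cong (λ z → (ι α * ι α * q₀ + ι β * ι β * q₁ - z) + t * (ι δ * ι δ - ι α * ι α - ι β * ι β)) expand ⟩
          (ι α * ι α * q₀ + ι β * ι β * q₁ - (ι α * ι α * q₀ + ι β * ι β * q₁ + ι α * ι β * seq p n))
            + t * (ι δ * ι δ - ι α * ι α - ι β * ι β)
            ≡⟨ solve 3 (λ x y z → (x :- (x :+ y)) :+ z := z :- y) refl (ι α * ι α * q₀ + ι β * ι β * q₁) (ι α * ι β * seq p n)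
                 (t * (ι δ * ι δ - ι α * ι α - ι β * ι β)) ⟩
          t * (ι δ * ι δ - ι α * ι α - ι β * ι β) - ι α * ι β * seq p n
            ≡⟨ cong₂ (λ y z → t * y - z * seq p n) (sym (trans (ι-- (δ ² ℤ.- α ²) (β ²))
                 (cong₂ _-_ (trans (ι-- (δ ²) (α ²)) (cong₂ _-_ (ι-* δ δ) (ι-* α α))) (ι-* β β)))) (sym (ι-* α β)) ⟩
          t * ι (δ ² ℤ.- α ² ℤ.- β ²) - ι (α ℤ.* β) * seq p n ∎
          where
          q q₀ q₁ t : ℚ
          q = seq (Q a b) n
          q₀ = seq (Q a₀ b₀) n
          q₁ = seq (Q a₁ b₁) n
          t = seq T n
          expand : ι δ * ι δ * q ≡ ι α * ι α * q₀ + ι β * ι β * q₁ + ι α * ι β * seq p n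
          expand = begin
            ι δ * ι δ * form (seq W n) (seq Y n) (seq V n) (ι a) (ι b)
              ≡⟨ form-homogeneous (seq W n) (seq Y n) (seq V n) (ι δ) (ι a) (ι b) ⟩
            form (seq W n) (seq Y n) (seq V n) (ι δ * ι a) (ι δ * ι b)
              ≡⟨ cong₂ (form (seq W n) (seq Y n) (seq V n)) (ι-combination {δ} {a} {α} {a₀} {β} {a₁} eqa) (ι-combination {δ} {b} {α} {b₀} {β} {b₁} eqb) ⟩
            form (seq W n) (seq Y n) (seq V n) (ι α * ι a₀ + ι β * ι a₁) (ι α * ι b₀ + ι β * ι b₁)
              ≡⟨ form-combination (seq W n) (seq Y n) (seq V n) (ι α) (ι β) (ι a₀) (ι b₀) (ι a₁) (ι b₁) ⟩
            ι α * ι α * q₀ + ι β * ι β * q₁ + ι α * ι β * seq p n ∎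

      -- Eliminates the real number p between two relations.
      rationalized : ∀ κ ρ m γ → Null (λ n → seq T n * ι ρ - ι κ * seq p n) → Null (λ n → seq T n * ι m - ι γ * seq p n) →
        κ ℤ.* m ≡ γ ℤ.* ρ
      rationalized κ ρ m γ nρ nm = ℤ.i-j≡0⇒i≡j (κ ℤ.* m) (γ ℤ.* ρ) (vanishes (κ ℤ.* m ℤ.- γ ℤ.* ρ)
        (null-cong pointwise (null-+ (null-scale (ι κ) nm) (null-scale (- ι γ) nρ))))
        where
        pointwise : ∀ n → ι κ * (seq T n * ι m - ι γ * seq p n) + - ι γ * (seq T n * ι ρ - ι κ * seq p n)
          ≡ seq T n * ι (κ ℤ.* m ℤ.- γ ℤ.* ρ)
        pointwise n = trans
          (solve 6 (λ k m g r t p → k :* (t :* m :- g :* p) :+ (:- g) :* (t :* r :- k :* p) := t :* (k :* m :- g :* r)) refl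
            (ι κ) (ι m) (ι γ) (ι ρ) (seq T n) (seq p n))
          (cong (seq T n *_) (sym (trans (ι-- (κ ℤ.* m) (γ ℤ.* ρ)) (cong₂ _-_ (ι-* κ m) (ι-* γ ρ)))))

      -- The limit of κ p / T is ρ, and 4T² - p² = 4Tδ² > 0.
      positive-definite : ∀ κ ρ → κ ≢ 0ℤ → δ ≢ 0ℤ → Null (λ n → seq T n * ι ρ - ι κ * seq p n) →
        0ℤ ℤ.< pos 4 ℤ.* κ ℤ.* κ ℤ.- ρ ℤ.* ρ
      positive-definite κ ρ κ≢0 δ≢0 null = ℤ.≰⇒> λ D≤0 → T≢0 (null-dominated (λ n → dominated n (ιD≤0 D≤0)) f-null)
        where
        k r d : ℚ
        k = ι κ
        r = ι ρ
        d = ι δ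
        ιD≡ : ι (pos 4 ℤ.* κ ℤ.* κ ℤ.- ρ ℤ.* ρ) ≡ 4ℚ * k * k - r * r
        ιD≡ = trans (ι-- (pos 4 ℤ.* κ ℤ.* κ) (ρ ℤ.* ρ)) (cong₂ _-_
          (trans (ι-* (pos 4 ℤ.* κ) κ) (cong (_* k) (trans (ι-* (pos 4) κ) (cong (_* k) ι-4)))) (ι-* ρ ρ))
        ιD≤0 : pos 4 ℤ.* κ ℤ.* κ ℤ.- ρ ℤ.* ρ ℤ.≤ 0ℤ → 4ℚ * k * k - r * r ≤ 0ℚ
        ιD≤0 D≤0 = subst₂ _≤_ ιD≡ ι-0 (ι-mono-≤ D≤0)

        -- Inserting κ p = T ρ into κ² p² = κ² (4T² - 4T δ²) shows that f tends to 0. If 4κ² - ρ² ≤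
        -- 0, the second factor is at least 4κ² δ² ≥ 1, which gives f ≥ T.
        f : ℕ → ℚ
        f n = seq T n * (4ℚ * (k * k * (d * d)) - seq T n * (4ℚ * k * k - r * r))

        f-null : Null f
        f-null = null-cong pointwise
          (null-+ (null-* (T *ʳ fromℚ r +ʳ fromℚ k *ʳ p) null)
            (null-scale (4ℚ * (k * k)) (null-+ (null-* (Q a₁ b₁) on₀) (null-* T on₁))))
          where
          pointwise : ∀ n → (seq T n * r + k * seq p n) * (seq T n * r - k * seq p n)
            + 4ℚ * (k * k) * (seq (Q a₁ b₁) n * (seq (Q a₀ b₀) n - seq T n) + seq T n * (seq (Q a₁ b₁) n - seq T n)) ≡ f n
          pointwise n = begin
            (t * r + k * seq p n) * (t * r - k * seq p n) + 4ℚ * (k * k) * (q₁ * (q₀ - t) + t * (q₁ - t))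
              ≡⟨ solve 6 (λ t r k p q₀ q₁ → (t :* r :+ k :* p) :* (t :* r :- k :* p) :+ con 4ℚ :* (k :* k) :* (q₁ :* (q₀ :- t) :+ t :* (q₁ :- t))
                   := t :* t :* (r :* r) :- k :* k :* (p :* p) :+ con 4ℚ :* (k :* k) :* (q₀ :* q₁ :- t :* t)) refl t r k (seq p n) q₀ q₁ ⟩
            t * t * (r * r) - k * k * (seq p n * seq p n) + 4ℚ * (k * k) * (q₀ * q₁ - t * t)
              ≡⟨ cong (λ z → t * t * (r * r) - k * k * z + 4ℚ * (k * k) * (q₀ * q₁ - t * t)) p²≡ ⟩
            t * t * (r * r) - k * k * (4ℚ * (q₀ * q₁) - 4ℚ * t * (d * d)) + 4ℚ * (k * k) * (q₀ * q₁ - t * t)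
              ≡⟨ solve 6 (λ t r k d q₀ q₁ → t :* t :* (r :* r) :- k :* k :* (con 4ℚ :* (q₀ :* q₁) :- con 4ℚ :* t :* (d :* d)) :+ con 4ℚ :* (k :* k) :* (q₀ :* q₁ :- t :* t)
                   := t :* (con 4ℚ :* (k :* k :* (d :* d)) :- t :* (con 4ℚ :* k :* k :- r :* r))) refl t r k d q₀ q₁ ⟩
            f n ∎
            where
            open ≡-Reasoning
            q₀ q₁ t : ℚ
            q₀ = seq (Q a₀ b₀) n
            q₁ = seq (Q a₁ b₁) n
            t = seq T n
            p²≡ : seq p n * seq p n ≡ 4ℚ * (q₀ * q₁) - 4ℚ * t * (d * d)
            p²≡ = trans (polar² (seq W n) (seq Y n) (seq V n) (ι a₀) (ι b₀) (ι a₁) (ι b₁))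
              (cong₂ (λ y z → 4ℚ * (q₀ * q₁) - y * (z * z)) (disc n)
                (sym (trans (ι-- (a₀ ℤ.* b₁) (b₀ ℤ.* a₁)) (cong₂ _-_ (ι-* a₀ b₁) (ι-* b₀ a₁)))))

        1≤ι² : ∀ {i} → i ≢ 0ℤ → 1ℚ ≤ ι i * ι i
        1≤ι² {i} i≢0 = subst₂ _≤_ ι-1 (ι-* i i) (ι-mono-≤ (ℤ.i<j⇒suc[i]≤j (0<i² i≢0)))

        dominated : ∀ n → 4ℚ * k * k - r * r ≤ 0ℚ → ∣ seq T n ∣ ≤ ∣ f n ∣
        dominated n D≤0 = begin
          ∣ t ∣                                  ≡⟨ 0≤p⇒∣p∣≡p 0≤t ⟩
          t                                      ≡⟨ sym (*-identityʳ t) ⟩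
          t * 1ℚ                                 ≤⟨ *-mono-≤ʳ 0≤t 1≤ ⟩
          f n                                    ≤⟨ p≤∣p∣ (f n) ⟩
          ∣ f n ∣                                ∎
          where
          open ≤-Reasoning
          t D : ℚ
          t = seq T n
          D = 4ℚ * k * k - r * r
          0≤t : 0ℚ ≤ t
          0≤t = 0≤p² (seq Δ n)
          1≤4 : 1ℚ ≤ 4ℚ
          1≤4 = p≤p+q {1ℚ} {1ℚ + 1ℚ + 1ℚ} (<⇒≤ (positive⁻¹ (1ℚ + 1ℚ + 1ℚ)))
          1≤ : 1ℚ ≤ 4ℚ * (k * k * (d * d)) - t * D
          1≤ = begin
            1ℚ                              ≤⟨ *-mono-≤-≤ {1ℚ} {4ℚ} (<⇒≤ 0<1) (≤-trans (<⇒≤ 0<1) 1≤4) 1≤4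
                                                 (*-mono-≤-≤ {1ℚ} {k * k} {1ℚ} (<⇒≤ 0<1) (0≤p² k) (1≤ι² κ≢0) (1≤ι² δ≢0)) ⟩
            4ℚ * (k * k * (d * d))          ≤⟨ p≤p+q (0≤* 0≤t (neg-antimono-≤ D≤0)) ⟩
            4ℚ * (k * k * (d * d)) + t * - D ≡⟨ cong (4ℚ * (k * k * (d * d)) +_) (sym (neg-distribʳ-* t D)) ⟩
            4ℚ * (k * k * (d * d)) - t * D  ∎

    private
      -- All pairs are the first one up to sign, so the circle through it contains them.
      parallel : ∀ {I : Set} i₀ (a b : I → ℤ) → (∀ i → OnEllipse W Y V Δ (a i) (b i)) →
        (∀ i → a i₀ ℤ.* b i ≡ b i₀ ℤ.* a i) → Separated a b
      parallel i₀ a b on ∥ = onConic⇒separated i₀ ℤ.1ℤ 0ℤ ℤ.1ℤ N≢0 (ℤ.+<+ (ℕ.s≤s ℕ.z≤n)) (onConic λ i → begin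
          ℤ.1ℤ ℤ.* a i ℤ.* a i ℤ.+ 0ℤ ℤ.* a i ℤ.* b i ℤ.+ ℤ.1ℤ ℤ.* b i ℤ.* b i
            ≡⟨ sum-of-squares (a i) (b i) ⟩
          a i ² ℤ.+ b i ²
            ≡⟨ sym (cong₂ ℤ._+_
                 (proportional (a i) (a i₀) (on i₀) (on i) (ℤ.*-comm (a i) (a i₀)) (trans (ℤ.*-comm (a i) (b i₀)) (sym (∥ i))))
                 (proportional (b i) (b i₀) (on i₀) (on i) (trans (ℤ.*-comm (b i) (a i₀)) (∥ i)) (ℤ.*-comm (b i) (b i₀)))) ⟩
          a i₀ ² ℤ.+ b i₀ ² ∎)
        where
        open ≡-Reasoning
        N≢0 : a i₀ ² ℤ.+ b i₀ ² ≢ 0ℤ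
        N≢0 N≡0 with a i₀ ℤ.≟ 0ℤ
        ... | no a≢0  = ℤ.<-irrefl (sym N≡0) (ℤ.+-mono-<-≤ (0<i² a≢0) (0≤i² (b i₀)))
        ... | yes a≡0 = ℤ.<-irrefl (sym N≡0) (ℤ.+-mono-≤-< (0≤i² (a i₀)) (0<i² (nonzero (on i₀) a≡0)))

      module _ {I : Set} (i₀ i₁ : I) (a b : I → ℤ) (on : ∀ i → OnEllipse W Y V Δ (a i) (b i)) where

        δ : ℤ
        δ = a i₀ ℤ.* b i₁ ℤ.- b i₀ ℤ.* a i₁

        -- Numerators from Cramer's rule: pair i is α i / δ times pair i₀ plus β i / δ times pair
        -- i₁. Each vanishes exactly when pair i is parallel to the other basis pair.
        α β : I → ℤ
        α i = a i ℤ.* b i₁ ℤ.- b i ℤ.* a i₁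
        β i = a i₀ ℤ.* b i ℤ.- b i₀ ℤ.* a i

        m : I → ℤ
        m i = δ ² ℤ.- α i ² ℤ.- β i ²

        p : ℝ
        p = P (a i₀) (b i₀) (a i₁) (b i₁)

        relation : ∀ i → Null (λ n → seq T n * ι (m i) - ι (α i ℤ.* β i) * seq p n)
        relation i = combination {a i₀} {b i₀} {a i₁} {b i₁} (on i₀) (on i₁) (α i) (β i) (on i)
          (cramer₁ (a i₀) (b i₀) (a i₁) (b i₁) (a i) (b i)) (cramer₂ (a i₀) (b i₀) (a i₁) (b i₁) (a i) (b i))

        lift : Separated α β → Separated a b
        lift = separated-linear (b i₁) (ℤ.- a i₁) (ℤ.- b i₀) (a i₀) (ℤ.+<+ (ℕ.s≤s ℕ.z≤n))
          (λ i → expand₁ (a i) (b i₁) (b i) (a i₁)) (λ i → expand₂ (a i₀) (b i) (b i₀) (a i))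

        -- Every pair is parallel to one of the two basis pairs. The relations then do not involve
        -- p, which may be an irrational multiple of T, so one is free to take the conic with p = 0:
        -- the circle α² + β² = δ².
        axes : δ ≢ 0ℤ → (∀ i → α i ℤ.* β i ≡ 0ℤ) → Separated a b
        axes δ≢0 αβ≡0 = lift (onConic⇒separated i₀ ℤ.1ℤ 0ℤ ℤ.1ℤ (λ δ²≡0 → ℤ.<-irrefl (sym δ²≡0) (0<i² δ≢0)) (ℤ.+<+ (ℕ.s≤s ℕ.z≤n))
          (onConic λ i → trans (sum-of-squares (α i) (β i)) (difference-zero (δ ²) (α i ²) (β i ²)
            (vanishes (m i) (null-cong (λ n → trans
              (cong (λ z → seq T n * ι (m i) - z * seq p n) (trans (cong ι (αβ≡0 i)) ι-0))
              (solve 2 (λ x p → x :- con 0ℚ :* p := x) refl (seq T n * ι (m i)) (seq p n))) (relation i))))))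

        -- Pair k is parallel to neither basis pair, and its relation T ρ = κ p fixes p / T as ρ /
        -- κ. The other relations become δ² = α² + β² + (ρ / κ) α β, which is cleared of its
        -- denominator.
        transversal : δ ≢ 0ℤ → ∀ k → α k ℤ.* β k ≢ 0ℤ → Separated a b
        transversal δ≢0 k κ≢0 = lift (onConic⇒separated i₀ κ ρ κ (κδ²≢0 ∘ ℤ.i*j≡0⇒i≡0∨j≡0 κ)
          (positive-definite (on i₀) (on i₁) κ ρ κ≢0 δ≢0 (relation k))
          (onConic λ i → rearrange κ ρ δ (α i) (β i)
            (rationalized (on i₀) (on i₁) κ ρ (m i) (α i ℤ.* β i) (relation k) (relation i))))
          where
          κ ρ : ℤ
          κ = α k ℤ.* β k
          ρ = m k
          κδ²≢0 : ¬ (κ ≡ 0ℤ ⊎ δ ² ≡ 0ℤ)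
          κδ²≢0 (inj₁ κ≡0)  = κ≢0 κ≡0
          κδ²≢0 (inj₂ δ²≡0) = ℤ.<-irrefl (sym δ²≡0) (0<i² δ≢0)

    -- The number of directions among the pairs is found by finite searches with integer tests, so
    -- no property of a real number has to be decided.
    onEllipse⇒separated : ∀ {n} (a b : Fin (suc n) → ℤ) → (∀ j → OnEllipse W Y V Δ (a j) (b j)) → Separated a b
    onEllipse⇒separated a b on with any? (λ j → ¬? (δ zero j a b on ℤ.≟ 0ℤ))
    ... | no all-parallel = parallel zero a b on λ j →
      ℤ.i-j≡0⇒i≡j (a zero ℤ.* b j) (b zero ℤ.* a j) (decidable-stable (δ zero j a b on ℤ.≟ 0ℤ) λ δ≢0 → all-parallel (j , δ≢0))
    ... | yes (j , δ≢0) with any? (λ k → ¬? (α zero j a b on k ℤ.* β zero j a b on k ℤ.≟ 0ℤ))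
    ...   | yes (k , κ≢0) = transversal zero j a b on δ≢0 k κ≢0
    ...   | no  all-axial = axes zero j a b on δ≢0 λ k →
      decidable-stable (α zero j a b on k ℤ.* β zero j a b on k ℤ.≟ 0ℤ) λ κ≢0 → all-axial (k , κ≢0)

-- The uncovered point in the plane

module Strips where

  open BinaryForms using (MiddleThird; Separated; middleThird; separated)
  open Pythagorean using (cos²+sin²≃1)
  open Ellipses
  open import Data.Fin.Base using (Fin)
  open import Data.Integer.Base as ℤ using (ℤ; 0ℤ) renaming (+_ to pos)
  import Data.Integer.Properties as ℤ
  open import Data.Integer.Solver using () renaming (module +-*-Solver to ℤ-Solver)
  open import Data.Nat.Base as ℕ using (ℕ; suc)
  import Data.Nat.Properties as ℕ
  open import Data.Product.Base using (∃-syntax; _×_; _,_; proj₁; proj₂)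
  open import Data.Rational.Base hiding (_≃_; pos)
  open import Data.Rational.Properties
  open import Data.Rational.Solver using (module +-*-Solver)
  open import Data.Sum.Base using (_⊎_; inj₁; inj₂)
  open import Data.Unit.Base using (tt)
  open import Relation.Binary.PropositionalEquality
  open import Relation.Nullary using (¬_; yes; no)
  open import Relation.Unary using (U; _≐_)

  open +-*-Solver using (solve; _:+_; _:*_; _:-_; :-_; _:=_; con)

  module _ (v₁ v₂ w₁ w₂ : ℝ) where

    det W Y V : ℝ
    det = v₁ *ʳ w₂ -ʳ v₂ *ʳ w₁
    W = w₁ *ʳ w₁ +ʳ w₂ *ʳ w₂
    Y = fromℚ (- (1ℚ + 1ℚ)) *ʳ (v₁ *ʳ w₁ +ʳ v₂ *ʳ w₂)
    V = v₁ *ʳ v₁ +ʳ v₂ *ʳ v₂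

    lagrange : ∀ n → 4ℚ * seq W n * seq V n - seq Y n * seq Y n ≡ 4ℚ * (seq det n * seq det n)
    lagrange n = solve 4 (λ v₁ v₂ w₁ w₂ →
      con 4ℚ :* (w₁ :* w₁ :+ w₂ :* w₂) :* (v₁ :* v₁ :+ v₂ :* v₂)
        :- (con (- (1ℚ + 1ℚ)) :* (v₁ :* w₁ :+ v₂ :* w₂)) :* (con (- (1ℚ + 1ℚ)) :* (v₁ :* w₁ :+ v₂ :* w₂))
      := con 4ℚ :* ((v₁ :* w₂ :- v₂ :* w₁) :* (v₁ :* w₂ :- v₂ :* w₁))) refl (seq v₁ n) (seq v₂ n) (seq w₁ n) (seq w₂ n)

    -- If the determinant vanished, so would w₂ v - v₂ w and w₁ v - v₁ w. Independence then makes w₂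
    -- and w₁ zero, and 0 v + 1 w = 0 contradicts it once more.
    det≢0 : LinearlyIndependent (v₁ , v₂) (w₁ , w₂) → ¬ Null (seq det)
    det≢0 independent null = 1≄0 (proj₂ (independent (fromℚ 0ℚ) (fromℚ 1ℚ)
        (null-cong (λ n → unit (seq v₁ n) (seq w₁ n)) w₁≃0 , null-cong (λ n → unit (seq v₂ n) (seq w₂ n)) w₂≃0)))
      where
      unit : ∀ x y → y - 0ℚ ≡ 0ℚ * x + 1ℚ * y - 0ℚ
      unit = solve 2 (λ x y → y :- con 0ℚ := con 0ℚ :* x :+ con 1ℚ :* y :- con 0ℚ) refl
      zero-null : Null (λ _ → 0ℚ)
      zero-null ε 0<ε = 0 , λ _ _ → 0<ε
      1≄0 : ¬ (fromℚ 1ℚ ≃ 0ʳ)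
      1≄0 1≃0 with 1≃0 1ℚ 0<1
      ... | N , close = <-irrefl refl (close N ℕ.≤-refl)
      w₂≃0 : w₂ ≃ 0ʳ
      w₂≃0 = proj₁ (independent w₂ (-ʳ v₂)
        ( null-cong (λ n → solve 4 (λ v₁ v₂ w₁ w₂ → v₁ :* w₂ :- v₂ :* w₁ := w₂ :* v₁ :+ (:- v₂) :* w₁ :- con 0ℚ) refl
            (seq v₁ n) (seq v₂ n) (seq w₁ n) (seq w₂ n)) null
        , null-cong (λ n → solve 2 (λ v w → con 0ℚ := w :* v :+ (:- v) :* w :- con 0ℚ) refl (seq v₂ n) (seq w₂ n)) zero-null))
      w₁≃0 : w₁ ≃ 0ʳ
      w₁≃0 = proj₁ (independent w₁ (-ʳ v₁)
        ( null-cong (λ n → solve 2 (λ v w → con 0ℚ := w :* v :+ (:- v) :* w :- con 0ℚ) refl (seq v₁ n) (seq w₁ n)) zero-null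
        , null-cong (λ n → solve 4 (λ v₁ v₂ w₁ w₂ → con (- 1ℚ) :* (v₁ :* w₂ :- v₂ :* w₁) := w₁ :* v₂ :+ (:- v₁) :* w₂ :- con 0ℚ) refl
            (seq v₁ n) (seq v₂ n) (seq w₁ n) (seq w₂ n)) (null-scale (- 1ℚ) null)))

    module _ (c s : ℝ) (unit : c *ʳ c +ʳ s *ʳ s ≃ fromℚ 1ℚ) (a b : ℤ)
             (a-eq : Null (λ n → seq c n * seq v₁ n + seq s n * seq v₂ n - ι a))
             (b-eq : Null (λ n → seq c n * seq w₁ n + seq s n * seq w₂ n - ι b)) where

      private
        a′ b′ : ℝ
        a′ = c *ʳ v₁ +ʳ s *ʳ v₂
        b′ = c *ʳ w₁ +ʳ s *ʳ w₂

        -- Solving ⟨u, v⟩ = a′, ⟨u, w⟩ = b′ for u by Cramer's rule.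
        form-at-unit : ∀ n → form (seq W n) (seq Y n) (seq V n) (seq a′ n) (seq b′ n) ≡
          seq det n * seq det n * (seq c n * seq c n + seq s n * seq s n)
        form-at-unit n = solve 6 (λ v₁ v₂ w₁ w₂ c s →
          (w₁ :* w₁ :+ w₂ :* w₂) :* (c :* v₁ :+ s :* v₂) :* (c :* v₁ :+ s :* v₂)
          :+ (con (- (1ℚ + 1ℚ)) :* (v₁ :* w₁ :+ v₂ :* w₂)) :* (c :* v₁ :+ s :* v₂) :* (c :* w₁ :+ s :* w₂)
          :+ (v₁ :* v₁ :+ v₂ :* v₂) :* (c :* w₁ :+ s :* w₂) :* (c :* w₁ :+ s :* w₂)
          := (v₁ :* w₂ :- v₂ :* w₁) :* (v₁ :* w₂ :- v₂ :* w₁) :* (c :* c :+ s :* s)) refl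
          (seq v₁ n) (seq v₂ n) (seq w₁ n) (seq w₂ n) (seq c n) (seq s n)

      unit⇒onEllipse : OnEllipse W Y V det a b
      unit⇒onEllipse = null-cong pointwise
        (null-+ (null-* (det *ʳ det) unit) (null-+ (null-* A a-eq) (null-* B b-eq)))
        where
        -- The cofactors of a′ - a and b′ - b in Q(a , b) - Q(a′ , b′), where xy - ab is split as b
        -- (x - a) + x (y - b).
        A B : ℝ
        A = -ʳ (W *ʳ (fromℚ (ι a) +ʳ a′) +ʳ Y *ʳ fromℚ (ι b))
        B = -ʳ (V *ʳ (fromℚ (ι b) +ʳ b′) +ʳ Y *ʳ a′)
        pointwise : ∀ n → seq (det *ʳ det) n * (seq c n * seq c n + seq s n * seq s n - 1ℚ)
          + (seq A n * (seq a′ n - ι a) + seq B n * (seq b′ n - ι b))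
          ≡ form (seq W n) (seq Y n) (seq V n) (ι a) (ι b) - seq det n * seq det n
        pointwise n = begin
          t * (e - 1ℚ) + (seq A n * (x - ι a) + seq B n * (y - ι b))
            ≡⟨ solve 9 (λ t e a b x y W Y V →
                 t :* (e :- con 1ℚ) :+ ((:- (W :* (a :+ x) :+ Y :* b)) :* (x :- a) :+ (:- (V :* (b :+ y) :+ Y :* x)) :* (y :- b))
                 := t :* e :- (W :* x :* x :+ Y :* x :* y :+ V :* y :* y) :+ (W :* a :* a :+ Y :* a :* b :+ V :* b :* b) :- t) refl
                 t e (ι a) (ι b) x y (seq W n) (seq Y n) (seq V n) ⟩
          t * e - form (seq W n) (seq Y n) (seq V n) x y + q - t
            ≡⟨ cong (λ z → t * e - z + q - t) (form-at-unit n) ⟩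
          t * e - t * e + q - t
            ≡⟨ solve 3 (λ z q t → z :- z :+ q :- t := q :- t) refl (t * e) q t ⟩
          q - t ∎
          where
          open ≡-Reasoning
          t e x y q : ℚ
          t = seq det n * seq det n
          e = seq c n * seq c n + seq s n * seq s n
          x = seq a′ n
          y = seq b′ n
          q = form (seq W n) (seq Y n) (seq V n) (ι a) (ι b)

  third : ℚ
  third = pos 1 / 3

  3ℚ : ℚ
  3ℚ = 1ℚ + 1ℚ + 1ℚ

  third≤ : ∀ {y} → 1ℚ ≤ 3ℚ * y → third ≤ y
  third≤ = *-cancelˡ-≤-pos 3ℚ

  -- The quotient z / m lies between q + 1/3 and q + 2/3, and an integer i is at most q or at least
  -- q + 1.
  middleThird-far : ∀ {m z} → 0ℤ ℤ.< m → MiddleThird m z → ∀ i →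
    m ℤ.≤ pos 3 ℤ.* (z ℤ.- i ℤ.* m) ⊎ m ℤ.≤ pos 3 ℤ.* (i ℤ.* m ℤ.- z)
  middleThird-far {m} {z} 0<m (middleThird q lower upper) i with i ℤ.≤? q
  ... | yes i≤q = inj₁ (ℤ.≤-trans lower (ℤ.*-monoˡ-≤-nonNeg (pos 3)
    (ℤ.+-monoʳ-≤ z (ℤ.neg-mono-≤ (ℤ.*-monoʳ-≤-nonNeg m {{ℤ.nonNegative (ℤ.<⇒≤ 0<m)}} i≤q)))))
  ... | no  i≰q = inj₂ (begin
      m                                                       ≡⟨ m-eq m ⟩
      pos 3 ℤ.* m ℤ.- pos 2 ℤ.* m                             ≤⟨ ℤ.+-monoʳ-≤ (pos 3 ℤ.* m) (ℤ.neg-mono-≤ upper) ⟩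
      pos 3 ℤ.* m ℤ.- pos 3 ℤ.* (z ℤ.- q ℤ.* m)               ≡⟨ collect m z q ⟩
      pos 3 ℤ.* ((ℤ.1ℤ ℤ.+ q) ℤ.* m ℤ.- z)                    ≤⟨ ℤ.*-monoˡ-≤-nonNeg (pos 3) (ℤ.+-monoˡ-≤ (ℤ.- z)
                                                                   (ℤ.*-monoʳ-≤-nonNeg m {{ℤ.nonNegative (ℤ.<⇒≤ 0<m)}}
                                                                     (ℤ.i<j⇒suc[i]≤j (ℤ.≰⇒> i≰q)))) ⟩
      pos 3 ℤ.* (i ℤ.* m ℤ.- z)                               ∎)
    where
    open ℤ.≤-Reasoning
    open ℤ-Solver using () renaming (solve to solveℤ; _:+_ to _⊕_; _:*_ to _⊗_; _:-_ to _⊖_; _:=_ to _⊜_; con to conℤ)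
    m-eq : ∀ m → m ≡ pos 3 ℤ.* m ℤ.- pos 2 ℤ.* m
    m-eq = solveℤ 1 (λ m → m ⊜ conℤ (pos 3) ⊗ m ⊖ conℤ (pos 2) ⊗ m) refl
    collect : ∀ m z q → pos 3 ℤ.* m ℤ.- pos 3 ℤ.* (z ℤ.- q ℤ.* m) ≡ pos 3 ℤ.* ((ℤ.1ℤ ℤ.+ q) ℤ.* m ℤ.- z)
    collect = solveℤ 3 (λ m z q → conℤ (pos 3) ⊗ m ⊖ conℤ (pos 3) ⊗ (z ⊖ q ⊗ m) ⊜ conℤ (pos 3) ⊗ ((conℤ ℤ.1ℤ ⊕ q) ⊗ m ⊖ z)) refl

  ℤ-neg-minus : ∀ x y → ℤ.- (x ℤ.- y) ≡ y ℤ.- x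
  ℤ-neg-minus = ℤ-Solver.solve 2 (λ x y → ℤ-Solver.:- (x ℤ-Solver.:- y) ℤ-Solver.:= y ℤ-Solver.:- x) refl

  middleThird⇒distℤ : ∀ {m z r} → 0ℤ ℤ.< m → 0ℚ ≤ r → r * ι m ≡ 1ℚ → MiddleThird m z → third ≤ distℤ (r * ι z)
  middleThird⇒distℤ {m} {z} {r} 0<m 0≤r rm≡1 mid = subst (λ w → third ≤ ∣ r * ι z - w ∣) (ι≡fromℤ i) (far (middleThird-far 0<m mid i))
    where
    open ≤-Reasoning
    i : ℤ
    i = round (r * ι z)
    scale : ∀ {a} → m ℤ.≤ pos 3 ℤ.* a → third ≤ r * ι a
    scale {a} m≤3a = third≤ (begin
      1ℚ                  ≡⟨ sym rm≡1 ⟩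
      r * ι m             ≤⟨ *-mono-≤ʳ 0≤r (ι-mono-≤ m≤3a) ⟩
      r * ι (pos 3 ℤ.* a) ≡⟨ cong (r *_) (trans (ι-* (pos 3) a) (cong (_* ι a) ι-3)) ⟩
      r * (3ℚ * ι a)      ≡⟨ solve 2 (λ r a → r :* (con 3ℚ :* a) := con 3ℚ :* (r :* a)) refl r (ι a) ⟩
      3ℚ * (r * ι a)      ∎)
    difference : r * ι (z ℤ.- i ℤ.* m) ≡ r * ι z - ι i
    difference = begin-equality
      r * ι (z ℤ.- i ℤ.* m)       ≡⟨ cong (r *_) (trans (ι-- z (i ℤ.* m)) (cong (λ w → ι z - w) (ι-* i m))) ⟩
      r * (ι z - ι i * ι m)       ≡⟨ solve 4 (λ r z i m → r :* (z :- i :* m) := r :* z :- i :* (r :* m)) refl r (ι z) (ι i) (ι m) ⟩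
      r * ι z - ι i * (r * ι m)   ≡⟨ cong (λ w → r * ι z - ι i * w) rm≡1 ⟩
      r * ι z - ι i * 1ℚ          ≡⟨ cong (λ w → r * ι z - w) (*-identityʳ (ι i)) ⟩
      r * ι z - ι i               ∎
    difference′ : r * ι (i ℤ.* m ℤ.- z) ≡ - (r * ι z - ι i)
    difference′ = begin-equality
      r * ι (i ℤ.* m ℤ.- z)       ≡⟨ cong (λ w → r * ι w) (sym (ℤ-neg-minus z (i ℤ.* m))) ⟩
      r * ι (ℤ.- (z ℤ.- i ℤ.* m)) ≡⟨ cong (r *_) (ι-neg (z ℤ.- i ℤ.* m)) ⟩
      r * - ι (z ℤ.- i ℤ.* m)     ≡⟨ sym (neg-distribʳ-* r (ι (z ℤ.- i ℤ.* m))) ⟩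
      - (r * ι (z ℤ.- i ℤ.* m))   ≡⟨ cong -_ difference ⟩
      - (r * ι z - ι i)           ∎
    far : m ℤ.≤ pos 3 ℤ.* (z ℤ.- i ℤ.* m) ⊎ m ℤ.≤ pos 3 ℤ.* (i ℤ.* m ℤ.- z) → third ≤ ∣ r * ι z - ι i ∣
    far (inj₁ m≤) = ≤-trans (scale m≤) (≤-trans (≤-reflexive difference) (p≤∣p∣ (r * ι z - ι i)))
    far (inj₂ m≤) = ≤-trans (scale m≤) (≤-trans (≤-reflexive difference′)
      (≤-trans (p≤∣p∣ (- (r * ι z - ι i))) (≤-reflexive (∣-p∣≡∣p∣ (r * ι z - ι i)))))

  -- Half of the gap δ between ε and 1/3 pays for approximating ρ by x, as `distℤ` is 1-Lipschitz;
  -- the other half pays for the slack in `_≤ʳ_`.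
  not-within : ∀ {ε x ρ} → ε <ʳ fromℚ third → third ≤ distℤ ρ → Null (λ n → seq x n - ρ) → ¬ ∥ x ∥ ≤ʳ ε
  not-within {ε} {x} {ρ} (δ , 0<δ , K , ε+δ≤third) far null within =
    <-irrefl refl (contradictory (null (δ * ½) (0<½* 0<δ)) (within (δ * ½) (0<½* 0<δ)))
    where
    open ≤-Reasoning
    η : ℚ
    η = δ * ½
    contradictory : ∃[ N ] (∀ n → N ℕ.≤ n → ∣ seq x n - ρ ∣ < η) → ∃[ M ] (∀ n → M ℕ.≤ n → distℤ (seq x n) ≤ seq ε n + η) →
      third < third
    contradictory (N , close) (M , near) = begin-strict
      third                                   ≤⟨ far ⟩
      distℤ ρ                                 ≤⟨ ≤-trans (p≤∣p∣ (distℤ ρ)) (∣p∣≤∣p-q∣+∣q∣ (distℤ ρ) d) ⟩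
      ∣ distℤ ρ - d ∣ + ∣ d ∣                 ≤⟨ +-monoˡ-≤ ∣ d ∣ (≤-trans (distℤ-lipschitz ρ (seq x n)) (≤-reflexive (∣p-q∣≡∣q-p∣ ρ (seq x n)))) ⟩
      ∣ seq x n - ρ ∣ + ∣ d ∣                 <⟨ +-monoˡ-< ∣ d ∣ (close n (≤⊔ˡ {N} {M ℕ.⊔ K} ℕ.≤-refl)) ⟩
      η + ∣ d ∣                               ≡⟨ cong (η +_) (0≤p⇒∣p∣≡p (0≤∣p∣ (seq x n - fromℤ (round (seq x n))))) ⟩
      η + d                                   ≤⟨ +-monoʳ-≤ η (near n (≤⊔ˡ {M} {K} (≤⊔ʳ {N} {M ℕ.⊔ K} ℕ.≤-refl))) ⟩
      η + (seq ε n + η)                       ≡⟨ solve 2 (λ h e → h :+ (e :+ h) := e :+ (h :+ h)) refl η (seq ε n) ⟩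
      seq ε n + (η + η)                       ≡⟨ cong (seq ε n +_) (halves δ) ⟩
      seq ε n + δ                             ≤⟨ ε+δ≤third n (≤⊔ʳ {M} {K} (≤⊔ʳ {N} {M ℕ.⊔ K} ℕ.≤-refl)) ⟩
      third                                   ∎
      where
      n : ℕ
      n = N ℕ.⊔ (M ℕ.⊔ K)
      d : ℚ
      d = distℤ (seq x n)

  module _ (c s x y p₁ p₂ : ℝ) (unit : c *ʳ c +ʳ s *ʳ s ≃ fromℚ 1ℚ) where

    -- Applying the transposed rotation matrix, which is the inverse because c² + s² = 1, shows that
    -- the strip coordinate of a point is its inner product with the unit vector.
    rotation-coordinate : (c *ʳ x -ʳ s *ʳ y , s *ʳ x +ʳ c *ʳ y) ≃² (p₁ , p₂) →
      x ≃ c *ʳ p₁ +ʳ s *ʳ p₂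
    rotation-coordinate (eq₁ , eq₂) = null-cong
      (λ n → solve 6 (λ c s x y p₁ p₂ →
        (:- x) :* (c :* c :+ s :* s :- con 1ℚ) :+ (c :* ((c :* x :+ (:- (s :* y))) :- p₁) :+ s :* ((s :* x :+ c :* y) :- p₂))
        := x :- (c :* p₁ :+ s :* p₂)) refl (seq c n) (seq s n) (seq x n) (seq y n) (seq p₁ n) (seq p₂ n))
      (null-+ (null-* (-ʳ x) unit) (null-+ (null-* c eq₁) (null-* s eq₂)))

  integer-value : ∀ x ((m , _) : IsInteger x) → Null (λ n → seq x n - ι m)
  integer-value x (m , x≃m) = null-cong (λ n → cong (λ z → seq x n - z) (sym (ι≡fromℤ m))) x≃m

  strips-uncovered : ∀ ε → ε <ʳ fromℚ third → ∀ n (θ : Fin (suc n) → ℝ) → Periodic θ → ¬ (strips ε θ ≐ U)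
  strips-uncovered ε ε<⅓ n θ ((v₁ , v₂) , (w₁ , w₂) , v-period , w-period , independent) (_ , covers) =
    uncovered (onEllipse⇒separated (W v₁ v₂ w₁ w₂) (Y v₁ v₂ w₁ w₂) (V v₁ v₂ w₁ w₂) (det v₁ v₂ w₁ w₂)
      (lagrange v₁ v₂ w₁ w₂) (det≢0 v₁ v₂ w₁ w₂ independent) a b λ j →
      unit⇒onEllipse v₁ v₂ w₁ w₂ (cos (θ j)) (sin (θ j)) (cos²+sin²≃1 (θ j)) (a j) (b j) (a-eq j) (b-eq j))
    where
    a b : Fin (suc n) → ℤ
    a j = proj₁ (v-period j)
    b j = proj₁ (w-period j)
    a-eq : ∀ j → Null (λ n → seq (⟨ u (θ j) , (v₁ , v₂) ⟩) n - ι (a j))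
    a-eq j = integer-value (⟨ u (θ j) , (v₁ , v₂) ⟩) (v-period j)
    b-eq : ∀ j → Null (λ n → seq (⟨ u (θ j) , (w₁ , w₂) ⟩) n - ι (b j))
    b-eq j = integer-value (⟨ u (θ j) , (w₁ , w₂) ⟩) (w-period j)

    uncovered : ¬ Separated a b
    uncovered (separated m s t 0<m middle) = point (divide 0<1 0<ιm)
      where
      0<ιm : 0ℚ < ι m
      0<ιm = <-≤-trans 0<1 (subst (_≤ ι m) ι-1 (ι-mono-≤ (ℤ.i<j⇒suc[i]≤j 0<m)))
      point : ¬ (∃[ r ] (0ℚ < r × r * ι m ≡ 1ℚ))
      point (r , 0<r , rm≡1) = outside (covers {p} tt)
        where
        σ τ : ℝ
        σ = fromℚ (r * ι s)
        τ = fromℚ (r * ι t)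
        -- With r = 1 / m this is (s v + t w) / m, whose inner product with u j is (s a j + t b j) /
        -- m.
        p : ℝ²
        p = σ · (v₁ , v₂) +² τ · (w₁ , w₂)
        value : ∀ j → Null (λ n → seq (⟨ u (θ j) , p ⟩) n - r * ι (s ℤ.* a j ℤ.+ t ℤ.* b j))
        value j = null-cong
          (λ n → trans
            (solve 11 (λ r s t c d v₁ v₂ w₁ w₂ a b →
              r :* s :* (c :* v₁ :+ d :* v₂ :- a) :+ r :* t :* (c :* w₁ :+ d :* w₂ :- b)
              := c :* (r :* s :* v₁ :+ r :* t :* w₁) :+ d :* (r :* s :* v₂ :+ r :* t :* w₂) :- r :* (s :* a :+ t :* b)) refl
              r (ι s) (ι t) (seq (cos (θ j)) n) (seq (sin (θ j)) n) (seq v₁ n) (seq v₂ n) (seq w₁ n) (seq w₂ n) (ι (a j)) (ι (b j)))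
            (cong (λ z → seq (⟨ u (θ j) , p ⟩) n - r * z)
              (sym (trans (ι-+ (s ℤ.* a j) (t ℤ.* b j)) (cong₂ _+_ (ι-* s (a j)) (ι-* t (b j)))))))
          (null-+ (null-scale (r * ι s) (a-eq j)) (null-scale (r * ι t) (b-eq j)))
        outside : ¬ strips ε θ p
        outside (j , (x , y) , within , rotate≃p) = not-within {ε} {x} ε<⅓
          (middleThird⇒distℤ 0<m (<⇒≤ 0<r) rm≡1 (middle j))
          (null-cong (λ n → solve 3 (λ x y z → (x :- y) :+ (y :- z) := x :- z) refl
              (seq x n) (seq (⟨ u (θ j) , p ⟩) n) (r * ι (s ℤ.* a j ℤ.+ t ℤ.* b j)))
            (null-+ (rotation-coordinate (cos (θ j)) (sin (θ j)) x y (proj₁ p) (proj₂ p) (cos²+sin²≃1 (θ j)) rotate≃p) (value j)))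
          within

open import Data.Fin.Base using (Fin)
open import Data.Integer.Base using (+_)
open import Data.Nat.Base using (ℕ; suc)
open import Data.Rational.Base using (_/_)
open import Relation.Binary.PropositionalEquality using (_≢_)
open import Relation.Nullary using (¬_)
open import Relation.Unary using (U; _≐_)

theorem2p3 : (ε : ℝ) → 0ʳ <ʳ ε → ε <ʳ fromℚ (+ 1 / 3) →
    (n : ℕ) (θ : Fin (suc n) → ℝ) →
    (∀ i j → i ≢ j → ¬ CongruentMod2π (θ i) (θ j)) →
    Periodic θ →
    ¬ (strips ε θ ≐ U)
theorem2p3 ε _ ε<⅓ n θ _ = Strips.strips-uncovered ε ε<⅓ n θ
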